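{- The problem $1|er|\sum C_j$ (given jobs $J$ with processing times $p_j$, a subset $J^r\subseteq J$ and a budget $K^r$, find a sequence of $J$ minimizing $\sum_{j\in J}C_j$ among all sequences with renting period of length $er\le K^r$) can be solved in $\mathrm{O}(n^2P)$ time, where $n=|J|$ and $P=\sum_{j\in J}p_j$.
   Context: An instance has a finite set $J$ of $n$ jobs; job $j$ has a non-negative integer processing time $p_j$. A non-empty subset $J^r\subseteq J$ (the r-jobs) requires an external resource. A sequence is a permutation of $J$; the jobs are processed one at a time on a single machine in this order, non-preemptively, from time $0$ without idle time. $C_j$ is the completion time of job $j$. The resource is rented once, without interruption, from the start of the first r-job to the completion of the last r-job, so $er=\max_{j\in J^r} C_j-\min_{j\in J^r}(C_j-p_j)$. -}

module Defs where

open import Data.Bool.Base using (if_then_else_)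
open import Data.Fin.Base using (Fin; toℕ)
open import Data.Fin.Permutation using (Permutation′; _⟨$⟩ʳ_; _⟨$⟩ˡ_)
open import Data.Fin.Subset using (Subset; Nonempty)
open import Data.Fin.Subset.Properties using (_∈?_)
open import Data.List.Base using (List; allFin; filter; map)
open import Data.List.Extrema.Nat using (max; min)
open import Data.Nat.Base using (ℕ; suc; _+_; _∸_; _≤_; _≤ᵇ_; _≡ᵇ_)
open import Data.Nat.Properties using (+-0-monoid)
open import Data.Product.Base using (_×_; ∃-syntax)
open import Data.Sum.Base using (_⊎_)
open import Data.Vec.Base using (lookup)
open import Relation.Binary.PropositionalEquality.Core using (_≡_)
open import Relation.Nullary.Negation.Core using (¬_)

open import Algebra.Properties.Monoid.Sum +-0-monoid using (sum-syntax)

------------------------------------------------------------------------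
-- The scheduling problem 1|er|ΣCⱼ

record Instance : Set where
  field
    n        : ℕ
    p        : Fin n → ℕ
    Jʳ       : Subset n
    nonempty : Nonempty Jʳ
    Kʳ       : ℕ

  P : ℕ
  P = ∑[ j < n ] p j

  -- π ⟨$⟩ʳ k is the job in position k, and π ⟨$⟩ˡ j the position of job j.
  Sequence : Set
  Sequence = Permutation′ n

  -- On one machine without idle time, a job completes once it and all
  -- the jobs sequenced before it have been processed.
  C : Sequence → Fin n → ℕ
  C π j = ∑[ i < n ] (if toℕ (π ⟨$⟩ˡ i) ≤ᵇ toℕ (π ⟨$⟩ˡ j) then p i else 0)

  rjobs : List (Fin n)
  rjobs = filter (_∈? Jʳ) (allFin n)

  -- The first arguments of max and min take part in the extremum.  Here
  -- they are harmless: rjobs is non-empty, completion times are ≥ 0, and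
  -- start times are at most the latest completion time.
  rentalEnd : Sequence → ℕ
  rentalEnd π = max 0 (map (C π) rjobs)

  rentalStart : Sequence → ℕ
  rentalStart π = min (rentalEnd π) (map (λ j → C π j ∸ p j) rjobs)

  er : Sequence → ℕ
  er π = rentalEnd π ∸ rentalStart π

  Feasible : Sequence → Set
  Feasible π = er π ≤ Kʳ

  totalCompletionTime : Sequence → ℕ
  totalCompletionTime π = ∑[ j < n ] C π j

  Optimal : Sequence → Set
  Optimal π = Feasible π ×
    (∀ π′ → Feasible π′ → totalCompletionTime π ≤ totalCompletionTime π′)

------------------------------------------------------------------------
-- A structured random access machine under the uniform cost criterion.
-- Registers and arrays are named by numerals fixed in the program text,
-- so a program uses only finitely many of either (interleaving the arrays
-- in a single memory costs a constant factor).  Cells hold natural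
-- numbers.  Multiplication is deliberately not a primitive: with unit
-- cost it would let numbers grow doubly exponentially in the running time.

infix  8 _![_]
infixl 6 _⊕_ _⊖_
infix  5 _≼_
infix  5 _≔_ _![_]≔_
infixr 4 IF_THEN_ELSE_ WHILE_DO_
infixr 3 _⨟_

data Exp : Set where
  lit     : ℕ → Exp
  var     : ℕ → Exp
  _![_]   : ℕ → Exp → Exp
  _⊕_ _⊖_ : Exp → Exp → Exp

data Test : Set where
  _≼_ : Exp → Exp → Test

data Program : Set where
  skip          : Program
  _≔_           : ℕ → Exp → Program
  _![_]≔_       : ℕ → Exp → Exp → Program
  _⨟_           : Program → Program → Program
  IF_THEN_ELSE_ : Test → Program → Program → Program
  WHILE_DO_     : Test → Program → Program

record State : Set where
  constructor ⟪_,_⟫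
  field
    reg : ℕ → ℕ
    arr : ℕ → ℕ → ℕ

open State public

_[_↦_] : {A : Set} → (ℕ → A) → ℕ → A → (ℕ → A)
(f [ x ↦ v ]) y = if x ≡ᵇ y then v else f y

setReg : State → ℕ → ℕ → State
setReg s x v = ⟪ reg s [ x ↦ v ] , arr s ⟫

setArr : State → ℕ → ℕ → ℕ → State
setArr s a i v = ⟪ reg s , arr s [ a ↦ arr s a [ i ↦ v ] ] ⟫

⟦_⟧ : Exp → State → ℕ
⟦ lit k    ⟧ s = k
⟦ var x    ⟧ s = reg s x
⟦ a ![ e ] ⟧ s = arr s a (⟦ e ⟧ s)
⟦ e ⊕ f    ⟧ s = ⟦ e ⟧ s + ⟦ f ⟧ s
⟦ e ⊖ f    ⟧ s = ⟦ e ⟧ s ∸ ⟦ f ⟧ s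

Holds : Test → State → Set
Holds (e ≼ f) s = ⟦ e ⟧ s ≤ ⟦ f ⟧ s

-- Every constant, register access, memory access and arithmetic operation
-- costs one unit; expressions do not branch, so their cost is their size.
cost : Exp → ℕ
cost (lit k)    = 1
cost (var x)    = 1
cost (a ![ e ]) = suc (cost e)
cost (e ⊕ f)    = suc (cost e + cost f)
cost (e ⊖ f)    = suc (cost e + cost f)

costᵗ : Test → ℕ
costᵗ (e ≼ f) = suc (cost e + cost f)

-- ⟨ c , s ⟩⇓⟨ s′ , t ⟩: started in s, the program c halts in s′ after time t.
data ⟨_,_⟩⇓⟨_,_⟩ : Program → State → State → ℕ → Set where

  skip : ∀ {s} → ⟨ skip , s ⟩⇓⟨ s , 1 ⟩

  assign : ∀ {s x e} →
    ⟨ x ≔ e , s ⟩⇓⟨ setReg s x (⟦ e ⟧ s) , suc (cost e) ⟩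

  store : ∀ {s a e f} →
    ⟨ a ![ e ]≔ f , s ⟩⇓⟨ setArr s a (⟦ e ⟧ s) (⟦ f ⟧ s) , suc (cost e + cost f) ⟩

  seq : ∀ {c d s s′ s″ t u} →
    ⟨ c , s ⟩⇓⟨ s′ , t ⟩ →
    ⟨ d , s′ ⟩⇓⟨ s″ , u ⟩ →
    ⟨ c ⨟ d , s ⟩⇓⟨ s″ , t + u ⟩

  if-true : ∀ {b c d s s′ t} →
    Holds b s →
    ⟨ c , s ⟩⇓⟨ s′ , t ⟩ →
    ⟨ IF b THEN c ELSE d , s ⟩⇓⟨ s′ , costᵗ b + t ⟩

  if-false : ∀ {b c d s s′ t} →
    ¬ Holds b s →
    ⟨ d , s ⟩⇓⟨ s′ , t ⟩ →
    ⟨ IF b THEN c ELSE d , s ⟩⇓⟨ s′ , costᵗ b + t ⟩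

  while-stop : ∀ {b c s} →
    ¬ Holds b s →
    ⟨ WHILE b DO c , s ⟩⇓⟨ s , costᵗ b ⟩

  while-step : ∀ {b c s s′ s″ t u} →
    Holds b s →
    ⟨ c , s ⟩⇓⟨ s′ , t ⟩ →
    ⟨ WHILE b DO c , s′ ⟩⇓⟨ s″ , u ⟩ →
    ⟨ WHILE b DO c , s ⟩⇓⟨ s″ , costᵗ b + (t + u) ⟩

------------------------------------------------------------------------
-- Input and output conventions

module _ (I : Instance) where
  open Instance I

  -- Cells not mentioned here may initially hold anything.
  record Input (s : State) : Set where
    field
      jobs     : reg s 0 ≡ n
      budget   : reg s 1 ≡ Kʳ
      times    : ∀ j → arr s 0 (toℕ j) ≡ p j
      resource : ∀ j → arr s 1 (toℕ j) ≡ (if lookup Jʳ j then 1 else 0)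

  Stores : State → Sequence → Set
  Stores s π = ∀ k → arr s 2 (toℕ k) ≡ toℕ (π ⟨$⟩ʳ k)

  -- Register 2 tells whether a feasible sequence exists; if so, array 2
  -- lists the jobs in the order of an optimal one.
  Output : State → Set
  Output s = (reg s 2 ≡ 1 × ∃[ π ] (Optimal π × Stores s π))
           ⊎ (reg s 2 ≡ 0 × (∀ π → ¬ Feasible π))

-- The program solves every instance I within time bound I.
_SolvesWithin_ : Program → (Instance → ℕ) → Set
c SolvesWithin bound =
  ∀ I s → Input I s →
  ∃[ s′ ] ∃[ t ] (⟨ c , s ⟩⇓⟨ s′ , t ⟩ × t ≤ bound I × Output I s′)

{-# OPTIONS --safe #-}
module Submission where

-- A sequence may be taken of the form X ++ W ++ Y, where W is the set of jobs in the rental period and contains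
-- all r-jobs; any such sequence with p(W) ≤ Kʳ is feasible.  By exchange, W and X ++ Y may be sorted by processing
-- time, so that with all jobs sorted there is a split point h such that the jobs before h (the low part) belong to
-- X or W and the others (the high part) to W or Y.  Compared with the sorted sequence, an outside job of processing
-- time q adds |c q - w| to the total completion time, where c and w are the number and the total processing time of
-- the jobs of W preceding it in the low part, or following it in the high part.  Both parts are thus solved by
-- the same dynamic programme over (number of items, c, w), run on the sorted list and on its reverse, with
-- O(n² P) states; since p(W) = w + w′, the best pair for every split point is found by a scan over w, in O(n P).

open import Data.Bool.Base using (true; false; if_then_else_)
open import Data.Empty using (⊥)
open import Data.Fin.Base using (Fin; zero; suc; toℕ; cast; fromℕ<)
open import Data.Fin.Permutation using (permutation; inverseˡ; inverseʳ; _⟨$⟩ʳ_; _⟨$⟩ˡ_)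
open import Data.Fin.Properties using (toℕ<n; toℕ-injective; toℕ-fromℕ<)
import Data.Fin.Properties as Fin
open import Data.Fin.Subset using (_∈_; _∉_)
open import Data.Fin.Subset.Properties using (_∈?_)
open import Data.List.Base
  using (List; []; _∷_; _++_; [_]; length; filter; take; drop; tabulate; lookup; allFin; applyUpTo;
         applyDownFrom; map)
open import Data.List.Extrema.Nat using (min; v≤min⁺; max≤v⁺; xs≤max; min≤xs)
open import Data.List.Membership.Propositional using () renaming (_∈_ to _∈ₗ_; _∉_ to _∉ₗ_)
open import Data.List.Membership.Propositional.Properties
  using (∈-lookup; ∈-∃++; ∈-++⁺ˡ; ∈-++⁺ʳ; ∈-++⁻; ∈-tabulate⁺; ∈-filter⁺; ∈-filter⁻; ∈-map⁺)
open import Data.List.Membership.Propositional.Properties.WithK using (unique∧set⇒bag)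
open import Data.List.Properties
  using (++-assoc; ++-identityʳ; length-++; length-take; length-filter; length-tabulate; length-applyDownFrom;
         take++drop≡id; applyUpTo-∷ʳ; filter-++; filter-accept; filter-reject; filter-all; filter-none; map-++;
         map-cong; map-id; map-∘; map-tabulate; tabulate-cong; tabulate-lookup; ∷-injectiveˡ; ∷-injectiveʳ)
open import Data.List.Relation.Binary.BagAndSetEquality using (∼bag⇒↭)
open import Data.List.Relation.Binary.Permutation.Propositional as ↭
  using (_↭_; ↭⇒↭ₛ; ↭-refl; ↭-sym; ↭-trans; ↭-reflexive)
open import Data.List.Relation.Binary.Permutation.Propositional.Properties
  using (↭-length; filter-↭; ∈-resp-↭; ++⁺ˡ; ++⁺ʳ; ++-comm)
open import Data.List.Relation.Binary.Permutation.Setoid.Properties using (Unique-resp-↭)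
open import Data.List.Relation.Unary.All using (All; []; _∷_)
import Data.List.Relation.Unary.All as All
import Data.List.Relation.Unary.All.Properties as Allₚ
open import Data.List.Relation.Unary.AllPairs using (AllPairs; []; _∷_)
import Data.List.Relation.Unary.AllPairs.Properties as AllPairsₚ
open import Data.List.Relation.Unary.Any using (here; there; index)
import Data.List.Relation.Unary.Any.Properties as Anyₚ
open import Data.List.Relation.Unary.Unique.Propositional using (Unique)
import Data.List.Relation.Unary.Unique.Propositional.Properties as Uniqueₚ
open import Data.Nat.Base
open import Data.Nat.Divisibility using (n∣m*n)
open import Data.Nat.DivMod using (m<n⇒m/n≡0; +-distrib-/-∣ˡ; m*n/n≡m)
open import Data.Nat.Properties
open import Data.Nat.Tactic.RingSolver using (solve-∀)
open import Data.Product.Base using (_×_; _,_; proj₁; proj₂; ∃-syntax; ∃₂)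
open import Data.Sum.Base as Sum using (_⊎_; inj₁; inj₂)
open import Data.Unit.Base using (⊤; tt)
import Data.Vec.Base as Vec
open import Data.Vec.Properties using (lookup⇒[]=; []=⇒lookup)
open import Defs
open import Function.Base using (_∘_; _on_; id)
open import Function.Bundles using (mk⇔)
open import Level using (0ℓ)
open import Relation.Binary.PropositionalEquality hiding ([_])
open import Relation.Nullary using (¬_; yes; no; contradiction; ¬?)
open import Relation.Unary using (Pred; Decidable)

open import Algebra.Properties.CommutativeMonoid.Sum +-0-commutativeMonoid
  using (sum-syntax; ∑-distrib-+; sum-cong-≗; sum-permute)

-- The split point comes from counting: once the outside jobs are sorted, X is an initial segment of
-- them, so any h with exactly |X| outside jobs among the first h sorted jobs separates X from Y.
-- Costs are additive over such a split because each half is permuted within itself, so the delay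
-- that the low half causes to the high half is the same as in the sorted sequence. The surcharge
-- has a simple origin. In the low part an outside job moves in front of c chosen jobs, which then
-- wait q longer each while it starts w earlier; sortedness gives w ≤ c q. In the high part it moves
-- behind them, and c q ≤ w. Adding both truncated differences covers the two cases by one formula,
-- and as this formula involves only c and w, these two numbers suffice as state. The jobs at the
-- ends of W need not be r-jobs, so er is only bounded by p(W). That is enough for feasibility; for
-- optimality, W is cut from a given sequence exactly from its first to its last r-job. The machine
-- has neither products nor infinity: products are built by repeated addition, and 0 stands for an
-- infeasible value, all finite costs being shifted by one.

∑-mono : ∀ n {f g : Fin n → ℕ} → (∀ k → f k ≤ g k) → ∑[ k < n ] f k ≤ ∑[ k < n ] g k
∑-mono zero    f≤g = z≤n
∑-mono (suc n) f≤g = +-mono-≤ (f≤g zero) (∑-mono n (f≤g ∘ suc))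

∑-const : ∀ n c → ∑[ k < n ] c ≡ n * c
∑-const zero    c = refl
∑-const (suc n) c = cong (c +_) (∑-const n c)

-- Total completion time of lists, and exchange arguments

module Total {A : Set} (p : A → ℕ) where

  -- The weight function is a parameter because it is instantiated twice: with the processing times,
  -- and in `Deficit` with their truncated differences from a threshold.
  total : List A → ℕ
  total []       = 0
  total (x ∷ xs) = p x + total xs

  total-++ : ∀ xs ys → total (xs ++ ys) ≡ total xs + total ys
  total-++ []       ys = refl
  total-++ (x ∷ xs) ys rewrite total-++ xs ys = sym (+-assoc (p x) _ _)

  total-↭ : ∀ {xs ys} → xs ↭ ys → total xs ≡ total ys
  total-↭ ↭.refl             = refl
  total-↭ (↭.prep x xs↭ys)   = cong (p x +_) (total-↭ xs↭ys)
  total-↭ (↭.swap x y xs↭ys) rewrite total-↭ xs↭ys = lemma (p x) (p y) _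
    where
    lemma : ∀ a b c → a + (b + c) ≡ b + (a + c)
    lemma = solve-∀
  total-↭ (↭.trans σ τ)      = trans (total-↭ σ) (total-↭ τ)

module Flow {A : Set} (p : A → ℕ) where

  open Total p public

  -- The total completion time of the jobs in this order: a processing time is paid once by the job
  -- itself and once by each of its successors.
  flow : List A → ℕ
  flow []       = 0
  flow (x ∷ xs) = p x * suc (length xs) + flow xs

  Sorted : List A → Set
  Sorted = AllPairs (_≤_ on p)

  flow-++ : ∀ xs ys → flow (xs ++ ys) ≡ flow xs + flow ys + total xs * length ys
  flow-++ []       ys = sym (+-identityʳ _)
  flow-++ (x ∷ xs) ys rewrite flow-++ xs ys | length-++ xs {ys} =
    lemma (p x) (length xs) (length ys) (flow xs) (flow ys) (total xs)
    where
    lemma : ∀ a m n f g t →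
      a * suc (m + n) + (f + g + t * n) ≡ a * suc m + f + g + (a + t) * n
    lemma = solve-∀

  -- Double counting of the pairs of a job and a job not before it. The right-hand side lists the
  -- completion times by position, which allows a comparison term by term.
  flow-prefixes : ∀ n xs → length xs ≡ n → flow xs ≡ ∑[ k < n ] total (take (suc (toℕ k)) xs)
  flow-prefixes zero    []       _    = refl
  flow-prefixes (suc n) (x ∷ xs) eq = begin
    p x * suc (length xs) + flow xs
      ≡⟨ cong₂ (λ a b → p x * suc a + b) |xs|≡n (flow-prefixes n xs |xs|≡n) ⟩
    p x * suc n + s
      ≡⟨ lemma (p x) n s ⟩
    p x + 0 + (n * p x + s)
      ≡⟨ cong (λ a → p x + 0 + (a + s)) (∑-const n (p x)) ⟨
    p x + 0 + (∑[ k < n ] p x + s)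
      ≡⟨ cong (p x + 0 +_) (∑-distrib-+ {n} (λ _ → p x) (λ k → total (take (suc (toℕ k)) xs))) ⟨
    p x + 0 + ∑[ k < n ] (p x + total (take (suc (toℕ k)) xs)) ∎
    where
    open ≡-Reasoning
    |xs|≡n = suc-injective eq
    s = ∑[ k < n ] total (take (suc (toℕ k)) xs)
    lemma : ∀ a n s → a * suc n + s ≡ a + 0 + (n * a + s)
    lemma = solve-∀

  threshold : ∀ xs ys → Sorted (xs ++ ys) →
    ∃[ θ ] All (λ x → p x ≤ θ) xs × All (λ y → θ ≤ p y) ys
  threshold []       []       _         = 0 , [] , []
  threshold []       (y ∷ ys) (y≤ ∷ _)  = p y , [] , ≤-refl ∷ y≤
  threshold (x ∷ xs) ys       (x≤ ∷ s) with threshold xs ys s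
  ... | θ , xs≤θ , θ≤ys = p x ⊔ θ ,
    m≤m⊔n (p x) θ ∷ All.map (λ le → ≤-trans le (m≤n⊔m (p x) θ)) xs≤θ ,
    All.zipWith (λ (a , b) → ⊔-lub a b) (Allₚ.++⁻ʳ xs x≤ , θ≤ys)

  module Deficit (θ : ℕ) where
    open Total (λ x → θ ∸ p x) public
      renaming (total to deficit; total-++ to deficit-++; total-↭ to deficit-↭)

    lemma₄ : ∀ a b c d → (a + b) + (c + d) ≡ (a + c) + (b + d)
    lemma₄ = solve-∀

    -- Each summand `p x + (θ ∸ p x)` is the maximum of `p x` and `θ`; this also explains the
    -- equality in `≤θ`.
    θ≤ : ∀ xs → length xs * θ ≤ total xs + deficit xs
    θ≤ []       = z≤n
    θ≤ (x ∷ xs) = ≤-trans (+-mono-≤ (m≤n+m∸n θ (p x)) (θ≤ xs))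
      (≤-reflexive (lemma₄ (p x) (θ ∸ p x) (total xs) (deficit xs)))

    ≤θ : ∀ {xs} → All (λ x → p x ≤ θ) xs → total xs + deficit xs ≡ length xs * θ
    ≤θ {[]}     []        = refl
    ≤θ {x ∷ xs} (le ∷ les) = trans
      (lemma₄ (p x) (total xs) (θ ∸ p x) (deficit xs))
      (cong₂ _+_ (m+[n∸m]≡n le) (≤θ les))

    deficit≡0 : ∀ {xs} → All (λ x → θ ≤ p x) xs → deficit xs ≡ 0
    deficit≡0 []         = refl
    deficit≡0 (le ∷ les) = cong₂ _+_ (m≤n⇒m∸n≡0 le) (deficit≡0 les)

  -- Any θ separating xs from ys turns the comparison into one of the truncated differences θ ∸ p,
  -- of which xs contains all the nonzero ones.
  prefix-min : ∀ {xs ys xs′ ys′} → Sorted (xs ++ ys) → xs ++ ys ↭ xs′ ++ ys′ →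
    length xs ≡ length xs′ → total xs ≤ total xs′
  prefix-min {xs} {ys} {xs′} {ys′} sorted σ eq with threshold xs ys sorted
  ... | θ , xs≤θ , θ≤ys = +-cancelʳ-≤ (deficit xs) _ _ (begin
    total xs + deficit xs    ≡⟨ ≤θ xs≤θ ⟩
    length xs * θ            ≡⟨ cong (_* θ) eq ⟩
    length xs′ * θ           ≤⟨ θ≤ xs′ ⟩
    total xs′ + deficit xs′  ≤⟨ +-monoʳ-≤ (total xs′) (begin
      deficit xs′                ≤⟨ m≤m+n _ (deficit ys′) ⟩
      deficit xs′ + deficit ys′  ≡⟨ deficit-++ xs′ ys′ ⟨
      deficit (xs′ ++ ys′)       ≡⟨ deficit-↭ σ ⟨
      deficit (xs ++ ys)         ≡⟨ deficit-++ xs ys ⟩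
      deficit xs + deficit ys    ≡⟨ cong (deficit xs +_) (deficit≡0 θ≤ys) ⟩
      deficit xs + 0             ≡⟨ +-identityʳ _ ⟩
      deficit xs                 ∎) ⟩
    total xs′ + deficit xs ∎)
    where
    open ≤-Reasoning
    open Deficit θ

  -- The shortest-processing-time rule without adjacent swaps: `prefix-min` bounds every completion
  -- time simultaneously, position by position.
  flow-min : ∀ {xs ys} → Sorted xs → xs ↭ ys → flow xs ≤ flow ys
  flow-min {xs} {ys} sorted σ = begin
    flow xs                                            ≡⟨ flow-prefixes (length xs) xs refl ⟩
    ∑[ k < length xs ] total (take (suc (toℕ k)) xs)   ≤⟨ ∑-mono (length xs) (λ k → prefix (suc (toℕ k))) ⟩
    ∑[ k < length xs ] total (take (suc (toℕ k)) ys)   ≡⟨ flow-prefixes (length xs) ys (sym (↭-length σ)) ⟨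
    flow ys                                            ∎
    where
    open ≤-Reasoning
    prefix : ∀ k → total (take k xs) ≤ total (take k ys)
    prefix k = prefix-min {take k xs} {drop k xs} {take k ys} {drop k ys}
      (subst Sorted (sym (take++drop≡id k xs)) sorted)
      (subst₂ _↭_ (sym (take++drop≡id k xs)) (sym (take++drop≡id k ys)) σ)
      (begin-equality
        length (take k xs)  ≡⟨ length-take k xs ⟩
        k ⊓ length xs       ≡⟨ cong (k ⊓_) (↭-length σ) ⟩
        k ⊓ length ys       ≡⟨ length-take k ys ⟨
        length (take k ys)  ∎)

  -- The jobs of the middle block are delayed by `total xs`, and those of `ys` by `total ws`. With
  -- the length of `xs` fixed, each of the four terms can be minimised on its own, which is how
  -- `flow-blocks-min` proceeds.
  flow-blocks : ∀ xs ws ys → flow (xs ++ ws ++ ys) ≡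
    flow (xs ++ ys) + total xs * length ws + (flow ws + total ws * length ys)
  flow-blocks xs ws ys
    rewrite flow-++ xs (ws ++ ys) | flow-++ ws ys | flow-++ xs ys | length-++ ws {ys} =
    lemma (flow xs) (flow ws) (flow ys) (total xs) (total ws) (length ws) (length ys)
    where
    lemma : ∀ f g h s t m n → f + (g + h + t * n) + s * (m + n) ≡ f + h + s * n + s * m + (g + t * n)
    lemma = solve-∀

  flow-blocks-min : ∀ {xs ws ys xs′ ws′ ys′} →
    Sorted (xs ++ ys) → Sorted ws → xs ++ ys ↭ xs′ ++ ys′ → ws ↭ ws′ → length xs ≡ length xs′ →
    flow (xs ++ ws ++ ys) ≤ flow (xs′ ++ ws′ ++ ys′)
  flow-blocks-min {xs} {ws} {ys} {xs′} {ws′} {ys′} s t σ τ eq = begin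
    flow (xs ++ ws ++ ys)
      ≡⟨ flow-blocks xs ws ys ⟩
    flow (xs ++ ys) + total xs * length ws + (flow ws + total ws * length ys)
      ≤⟨ +-mono-≤
           (+-mono-≤ (flow-min s σ)
             (*-mono-≤ (prefix-min {xs} {ys} {xs′} {ys′} s σ eq) (≤-reflexive (↭-length τ))))
           (+-mono-≤ (flow-min t τ) (≤-reflexive (cong₂ _*_ (total-↭ τ) |ys|≡|ys′|))) ⟩
    flow (xs′ ++ ys′) + total xs′ * length ws′ + (flow ws′ + total ws′ * length ys′)
      ≡⟨ flow-blocks xs′ ws′ ys′ ⟨
    flow (xs′ ++ ws′ ++ ys′) ∎
    where
    open ≤-Reasoning
    |ys|≡|ys′| : length ys ≡ length ys′
    |ys|≡|ys′| = +-cancelˡ-≡ (length xs) _ _ (begin-equality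
      length xs + length ys    ≡⟨ length-++ xs ⟨
      length (xs ++ ys)        ≡⟨ ↭-length σ ⟩
      length (xs′ ++ ys′)      ≡⟨ length-++ xs′ ⟩
      length xs′ + length ys′  ≡⟨ cong (_+ length ys′) eq ⟨
      length xs + length ys′   ∎)

-- Splitting the sorted jobs around the rental period

-- Built by appending, so that its recursion removes the last item, as that of `Choice` does.
prefix : {A : Set} → (ℕ → A) → ℕ → List A
prefix f zero    = []
prefix f (suc n) = prefix f n ++ [ f n ]

prefix≡applyUpTo : ∀ {A : Set} (f : ℕ → A) n → prefix f n ≡ applyUpTo f n
prefix≡applyUpTo f zero    = refl
prefix≡applyUpTo f (suc n) = trans (cong (_++ [ f n ]) (prefix≡applyUpTo f n)) (applyUpTo-∷ʳ f n)

-- A choice, among the items 0, …, j - 1, of those to be processed in the rental period; item i must be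
-- chosen if f i ≢ 0.
data Choice (f : ℕ → ℕ) : ℕ → Set where
  none    : Choice f 0
  inside  : ∀ {j} → Choice f j → Choice f (suc j)
  outside : ∀ {j} → f j ≡ 0 → Choice f j → Choice f (suc j)

module _ {f : ℕ → ℕ} where

  count : ∀ {j} → Choice f j → ℕ
  count none          = 0
  count (inside S)    = suc (count S)
  count (outside _ S) = count S

  count≤ : ∀ {j} (S : Choice f j) → count S ≤ j
  count≤ none          = z≤n
  count≤ (inside S)    = s≤s (count≤ S)
  count≤ (outside _ S) = m≤n⇒m≤1+n (count≤ S)

  module Measure (q : ℕ → ℕ) where

    weight : ∀ {j} → Choice f j → ℕ
    weight none             = 0
    weight (inside {j} S)   = q j + weight S
    weight (outside _ S)    = weight S

    -- The increase in total completion time, over processing all items in order of their processing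
    -- times, caused by moving the unchosen items to one side of the chosen ones.
    extra : ∀ {j} → Choice f j → ℕ
    extra none              = 0
    extra (inside S)        = extra S
    extra (outside {j} _ S) = extra S + ((count S * q j ∸ weight S) + (weight S ∸ count S * q j))

    weight≤ : ∀ {j m} → (∀ i → i < j → q i ≤ m) → (S : Choice f j) → weight S ≤ count S * m
    weight≤ q≤m none              = z≤n
    weight≤ q≤m (inside {j} S)    = +-mono-≤ (q≤m j ≤-refl) (weight≤ (λ i i<j → q≤m i (m<n⇒m<1+n i<j)) S)
    weight≤ q≤m (outside {j} _ S) = weight≤ (λ i i<j → q≤m i (m<n⇒m<1+n i<j)) S

    weight≥ : ∀ {j m} → (∀ i → i < j → m ≤ q i) → (S : Choice f j) → count S * m ≤ weight S
    weight≥ m≤q none              = z≤n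
    weight≥ m≤q (inside {j} S)    = +-mono-≤ (m≤q j ≤-refl) (weight≥ (λ i i<j → m≤q i (m<n⇒m<1+n i<j)) S)
    weight≥ m≤q (outside {j} _ S) = weight≥ (λ i i<j → m≤q i (m<n⇒m<1+n i<j)) S

  module _ {A : Set} (it : ℕ → A) where

    -- Low items are numbered from the shortest upwards and high items from the longest downwards.
    -- Appending in the first case and prepending in the second both give lists in order of
    -- processing time.
    chosen↑ unchosen↑ chosen↓ unchosen↓ : ∀ {j} → Choice f j → List A
    chosen↑ none              = []
    chosen↑ (inside {j} S)    = chosen↑ S ++ [ it j ]
    chosen↑ (outside _ S)     = chosen↑ S
    unchosen↑ none              = []
    unchosen↑ (inside S)        = unchosen↑ S
    unchosen↑ (outside {j} _ S) = unchosen↑ S ++ [ it j ]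
    chosen↓ none              = []
    chosen↓ (inside {j} S)    = it j ∷ chosen↓ S
    chosen↓ (outside _ S)     = chosen↓ S
    unchosen↓ none              = []
    unchosen↓ (inside S)        = unchosen↓ S
    unchosen↓ (outside {j} _ S) = it j ∷ unchosen↓ S

    module _ {P : Pred A 0ℓ} (P? : Decidable P) (P-forced : ∀ i → f i ≢ 0 → P (it i)) where

      -- Every set of items that contains the forced ones is a choice. This is how the rental period
      -- of an arbitrary feasible sequence enters the search space of the dynamic programme.
      choose : ∀ j → Choice f j
      choose zero    = none
      choose (suc j) with P? (it j) | f j ≟ 0
      ... | yes _ | _       = inside (choose j)
      ... | no _  | yes f≡0 = outside f≡0 (choose j)
      ... | no ¬P | no f≢0  = contradiction (P-forced j f≢0) ¬P

      filter-∷ʳ-accept : ∀ {Q : Pred A 0ℓ} (Q? : Decidable Q) {x} xs → Q x → filter Q? (xs ++ [ x ]) ≡ filter Q? xs ++ [ x ]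
      filter-∷ʳ-accept Q? xs Qx = trans (filter-++ Q? xs _) (cong (filter Q? xs ++_) (filter-accept Q? Qx))

      filter-∷ʳ-reject : ∀ {Q : Pred A 0ℓ} (Q? : Decidable Q) {x} xs → ¬ Q x → filter Q? (xs ++ [ x ]) ≡ filter Q? xs
      filter-∷ʳ-reject Q? xs ¬Qx = trans (filter-++ Q? xs _)
        (trans (cong (filter Q? xs ++_) (filter-reject Q? ¬Qx)) (++-identityʳ _))

      chosen↑-choose : ∀ j → chosen↑ (choose j) ≡ filter P? (prefix it j)
      chosen↑-choose zero    = refl
      chosen↑-choose (suc j) with P? (it j) | f j ≟ 0
      ... | yes Px | _       = trans (cong (_++ [ it j ]) (chosen↑-choose j)) (sym (filter-∷ʳ-accept P? (prefix it j) Px))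
      ... | no ¬Px | yes f≡0 = trans (chosen↑-choose j) (sym (filter-∷ʳ-reject P? (prefix it j) ¬Px))
      ... | no ¬Px | no f≢0  = contradiction (P-forced j f≢0) ¬Px

      unchosen↑-choose : ∀ j → unchosen↑ (choose j) ≡ filter (¬? ∘ P?) (prefix it j)
      unchosen↑-choose zero    = refl
      unchosen↑-choose (suc j) with P? (it j) | f j ≟ 0
      ... | yes Px | _       = trans (unchosen↑-choose j) (sym (filter-∷ʳ-reject (¬? ∘ P?) (prefix it j) (λ ¬Px → ¬Px Px)))
      ... | no ¬Px | yes f≡0 = trans (cong (_++ [ it j ]) (unchosen↑-choose j)) (sym (filter-∷ʳ-accept (¬? ∘ P?) (prefix it j) ¬Px))
      ... | no ¬Px | no f≢0  = contradiction (P-forced j f≢0) ¬Px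

      chosen↓-choose : ∀ j → chosen↓ (choose j) ≡ filter P? (applyDownFrom it j)
      chosen↓-choose zero    = refl
      chosen↓-choose (suc j) with P? (it j) | f j ≟ 0
      ... | yes Px | _       = cong (it j ∷_) (chosen↓-choose j)
      ... | no ¬Px | yes f≡0 = chosen↓-choose j
      ... | no ¬Px | no f≢0  = contradiction (P-forced j f≢0) ¬Px

      unchosen↓-choose : ∀ j → unchosen↓ (choose j) ≡ filter (¬? ∘ P?) (applyDownFrom it j)
      unchosen↓-choose zero    = refl
      unchosen↓-choose (suc j) with P? (it j) | f j ≟ 0
      ... | yes Px | _       = unchosen↓-choose j
      ... | no ¬Px | yes f≡0 = cong (it j ∷_) (unchosen↓-choose j)
      ... | no ¬Px | no f≢0  = contradiction (P-forced j f≢0) ¬Px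

  module ChoiceFlow {A : Set} (p : A → ℕ) (it : ℕ → A) where
    open Flow p
    open Measure (p ∘ it)

    length-chosen↑ : ∀ {j} (S : Choice f j) → length (chosen↑ it S) ≡ count S
    length-chosen↑ none          = refl
    length-chosen↑ (inside {j} S) rewrite length-++ (chosen↑ it S) {[ it j ]} | length-chosen↑ S = +-comm _ 1
    length-chosen↑ (outside _ S) = length-chosen↑ S

    length-chosen↓ : ∀ {j} (S : Choice f j) → length (chosen↓ it S) ≡ count S
    length-chosen↓ none          = refl
    length-chosen↓ (inside S)    = cong suc (length-chosen↓ S)
    length-chosen↓ (outside _ S) = length-chosen↓ S

    total-snoc : ∀ xs x → total (xs ++ [ x ]) ≡ p x + total xs
    total-snoc xs x rewrite total-++ xs [ x ] | +-identityʳ (p x) = +-comm _ (p x)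

    total-chosen↑ : ∀ {j} (S : Choice f j) → total (chosen↑ it S) ≡ weight S
    total-chosen↑ none           = refl
    total-chosen↑ (inside {j} S) rewrite total-snoc (chosen↑ it S) (it j) | total-chosen↑ S = refl
    total-chosen↑ (outside _ S)  = total-chosen↑ S

    total-chosen↓ : ∀ {j} (S : Choice f j) → total (chosen↓ it S) ≡ weight S
    total-chosen↓ none           = refl
    total-chosen↓ (inside {j} S) = cong (p (it j) +_) (total-chosen↓ S)
    total-chosen↓ (outside _ S)  = total-chosen↓ S

    length-↓ : ∀ {j} (S : Choice f j) → length (chosen↓ it S ++ unchosen↓ it S) ≡ j
    length-↓ none              = refl
    length-↓ (inside S)        = cong suc (length-↓ S)
    length-↓ (outside {j} _ S) = begin
      length (W ++ it j ∷ U)      ≡⟨ length-++ W ⟩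
      length W + suc (length U)   ≡⟨ +-suc _ _ ⟩
      suc (length W + length U)   ≡⟨ cong suc (length-++ W) ⟨
      suc (length (W ++ U))       ≡⟨ cong suc (length-↓ S) ⟩
      suc j                       ∎
      where
      open ≡-Reasoning
      U = unchosen↓ it S
      W = chosen↓ it S

    total-↑ : ∀ {j} (S : Choice f j) → total (unchosen↑ it S ++ chosen↑ it S) ≡ total (prefix it j)
    total-↑ none              = refl
    total-↑ (inside {j} S)    rewrite sym (++-assoc (unchosen↑ it S) (chosen↑ it S) [ it j ])
      | total-snoc (unchosen↑ it S ++ chosen↑ it S) (it j) | total-snoc (prefix it j) (it j) | total-↑ S = refl
    total-↑ (outside {j} _ S) = begin
      total ((U ++ [ it j ]) ++ W)         ≡⟨ total-++ (U ++ [ it j ]) W ⟩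
      total (U ++ [ it j ]) + total W      ≡⟨ cong (_+ total W) (total-snoc U (it j)) ⟩
      p (it j) + total U + total W         ≡⟨ +-assoc (p (it j)) _ _ ⟩
      p (it j) + (total U + total W)       ≡⟨ cong (p (it j) +_) (trans (sym (total-++ U W)) (total-↑ S)) ⟩
      p (it j) + total (prefix it j)    ≡⟨ total-snoc (prefix it j) (it j) ⟨
      total (prefix it j ++ [ it j ])   ∎
      where
      open ≡-Reasoning
      U = unchosen↑ it S
      W = chosen↑ it S

    flow-snoc : ∀ xs x → flow (xs ++ [ x ]) ≡ flow xs + (p x + total xs)
    flow-snoc xs x rewrite flow-++ xs [ x ] = lemma (flow xs) (p x) (total xs)
      where
      lemma : ∀ a b c → a + (b * 1 + 0) + c * 1 ≡ a + (b + c)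
      lemma = solve-∀

    -- A new inside item stays last and completes at the same time in both lists, by `total-↑`. A
    -- new outside item is moved in front of the chosen ones; since none of them is longer,
    -- `weight≤` makes the second difference in `extra` vanish.
    flow-↑ : ∀ {j} (S : Choice f j) → (∀ {i k} → i < k → k < j → p (it i) ≤ p (it k)) →
      flow (unchosen↑ it S ++ chosen↑ it S) ≡ flow (prefix it j) + extra S
    flow-↑ none              mono = refl
    flow-↑ (inside {j} S)    mono
      rewrite sym (++-assoc (unchosen↑ it S) (chosen↑ it S) [ it j ])
      | flow-snoc (unchosen↑ it S ++ chosen↑ it S) (it j) | flow-snoc (prefix it j) (it j) | total-↑ S
      | flow-↑ S (λ i<k k<j → mono i<k (m<n⇒m<1+n k<j)) = lemma (flow (prefix it j)) _ _
      where
      lemma : ∀ a b c → a + b + c ≡ a + c + b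
      lemma = solve-∀
    flow-↑ (outside {j} f≡0 S) mono = begin
      flow ((U ++ [ it j ]) ++ W)
        ≡⟨ flow-++ (U ++ [ it j ]) W ⟩
      flow (U ++ [ it j ]) + flow W + total (U ++ [ it j ]) * length W
        ≡⟨ cong₂ (λ a b → a + flow W + b * length W) (flow-snoc U (it j)) (total-snoc U (it j)) ⟩
      flow U + (q + total U) + flow W + (q + total U) * length W
        ≡⟨ lemma₁ (flow U) (flow W) q (total U) (length W) ⟩
      flow U + flow W + total U * length W + (q + total U + length W * q)
        ≡⟨ cong₂ (λ a b → a + (q + total U + b)) (trans (sym (flow-++ U W)) (flow-↑ S mono′)) c*q ⟩
      flow σ + extra S + (q + total U + (total W + d))
        ≡⟨ lemma₂ (flow σ) (extra S) q (total U) (total W) d ⟩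
      flow σ + (q + (total U + total W)) + (extra S + (d + 0))
        ≡⟨ cong₂ (λ a b → flow σ + (q + a) + (extra S + (d + b))) (trans (sym (total-++ U W)) (total-↑ S))
             (sym (m≤n⇒m∸n≡0 w≤)) ⟩
      flow σ + (q + total σ) + extra (outside {j = j} f≡0 S)
        ≡⟨ cong (_+ extra (outside {j = j} f≡0 S)) (sym (flow-snoc σ (it j))) ⟩
      flow (prefix it (suc j)) + extra (outside {j = j} f≡0 S) ∎
      where
      open ≡-Reasoning
      U = unchosen↑ it S
      W = chosen↑ it S
      σ = prefix it j
      q = p (it j)
      d = count S * q ∸ weight S
      mono′ : ∀ {i k} → i < k → k < j → p (it i) ≤ p (it k)
      mono′ i<k k<j = mono i<k (m<n⇒m<1+n k<j)
      w≤ : weight S ≤ count S * q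
      w≤ = weight≤ (λ i i<j → mono i<j ≤-refl) S
      c*q : length W * q ≡ total W + d
      c*q rewrite length-chosen↑ S | total-chosen↑ S = sym (m+[n∸m]≡n w≤)
      lemma₁ : ∀ u w q t l → u + (q + t) + w + (q + t) * l ≡ u + w + t * l + (q + t + l * q)
      lemma₁ = solve-∀
      lemma₂ : ∀ a e q t w d → a + e + (q + t + (w + d)) ≡ a + (q + (t + w)) + (e + (d + 0))
      lemma₂ = solve-∀

    -- Mirror image of `flow-↑`: the new item is the shortest so far and heads the sorted list. An
    -- outside item is moved behind the chosen ones, and by `weight≥` it is now the first difference
    -- in `extra` that vanishes.
    flow-↓ : ∀ {j} (S : Choice f j) → (∀ {i k} → i < k → k < j → p (it k) ≤ p (it i)) →
      flow (chosen↓ it S ++ unchosen↓ it S) ≡ flow (applyDownFrom it j) + extra S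
    flow-↓ none              anti = refl
    flow-↓ (inside {j} S)    anti
      rewrite length-↓ S | flow-↓ S (λ i<k k<j → anti i<k (m<n⇒m<1+n k<j))
      | length-applyDownFrom it j = sym (+-assoc (p (it j) * suc j) _ _)
    flow-↓ (outside {j} f≡0 S) anti = begin
      flow (W ++ it j ∷ U)
        ≡⟨ flow-++ W (it j ∷ U) ⟩
      flow W + (q * suc u + flow U) + total W * suc u
        ≡⟨ lemma₁ (flow W) q u (flow U) (total W) ⟩
      flow W + flow U + total W * u + (q * suc u + total W)
        ≡⟨ cong₂ (λ a b → a + (q * suc u + b)) (trans (sym (flow-++ W U)) (flow-↓ S anti′)) w≡ ⟩
      flow σ + extra S + (q * suc u + (length W * q + d))
        ≡⟨ lemma₂ (flow σ) (extra S) q u (length W) d ⟩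
      q * suc (length W + u) + flow σ + (extra S + (0 + d))
        ≡⟨ cong₂ (λ a b → q * suc a + flow σ + (extra S + (b + d))) len (sym (m≤n⇒m∸n≡0 ≤w)) ⟩
      q * suc (length σ) + flow σ + extra (outside {j = j} f≡0 S) ∎
      where
      open ≡-Reasoning
      U = unchosen↓ it S
      W = chosen↓ it S
      u = length U
      σ = applyDownFrom it j
      q = p (it j)
      d = weight S ∸ count S * q
      anti′ : ∀ {i k} → i < k → k < j → p (it k) ≤ p (it i)
      anti′ i<k k<j = anti i<k (m<n⇒m<1+n k<j)
      ≤w : count S * q ≤ weight S
      ≤w = weight≥ (λ i i<j → anti i<j ≤-refl) S
      w≡ : total W ≡ length W * q + d
      w≡ rewrite length-chosen↓ S | total-chosen↓ S = sym (m+[n∸m]≡n ≤w)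
      len : length W + u ≡ length σ
      len = trans (trans (sym (length-++ W)) (length-↓ S))
        (sym (length-applyDownFrom it j))
      lemma₁ : ∀ w q u v t → w + (q * suc u + v) + t * suc u ≡ w + v + t * u + (q * suc u + t)
      lemma₁ = solve-∀
      lemma₂ : ∀ a e q u w d → a + e + (q * suc u + (w * q + d)) ≡ q * suc (w + u) + a + (e + (0 + d))
      lemma₂ = solve-∀

-- Sequences as lists of jobs

tabulate-cast : ∀ {A : Set} {n} (xs : List A) (eq : n ≡ length xs) →
  tabulate (λ k → lookup xs (cast eq k)) ≡ xs
tabulate-cast xs refl = trans (tabulate-cong (λ k → cong (lookup xs) (Fin.cast-is-id refl k))) (tabulate-lookup xs)

tabulate-split : ∀ {A : Set} {n} (f : Fin n → A) xs {x ys} → tabulate f ≡ xs ++ x ∷ ys →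
  ∃[ k ] toℕ k ≡ length xs × f k ≡ x
tabulate-split {n = suc n} f []       refl = zero , refl , refl
tabulate-split {n = suc n} f (_ ∷ xs) eq with tabulate-split (f ∘ suc) xs (∷-injectiveʳ eq)
... | k , |xs| , fk≡x = suc k , cong suc |xs| , fk≡x

lookup-injective : ∀ {A : Set} {xs : List A} → Unique xs → ∀ {i j} → lookup xs i ≡ lookup xs j → i ≡ j
lookup-injective (x∉ ∷ u) {zero}  {zero}  eq = refl
lookup-injective (x∉ ∷ u) {zero}  {suc j} eq = contradiction eq (All.lookup x∉ (∈-lookup j))
lookup-injective (x∉ ∷ u) {suc i} {zero}  eq = contradiction (sym eq) (All.lookup x∉ (∈-lookup i))
lookup-injective (x∉ ∷ u) {suc i} {suc j} eq = cong suc (lookup-injective u eq)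

module _ {A : Set} {P : Pred A 0ℓ} (P? : Decidable P) where

  split-first : ∀ {z} xs → z ∈ₗ xs → P z → ∃₂ λ ys x → ∃[ zs ] xs ≡ ys ++ x ∷ zs × All (¬_ ∘ P) ys × P x
  split-first (x ∷ xs) z∈ Pz with P? x
  split-first (x ∷ xs) z∈           Pz | yes Px = [] , x , xs , refl , [] , Px
  split-first (x ∷ xs) (here refl)  Pz | no ¬Px = contradiction Pz ¬Px
  split-first (x ∷ xs) (there z∈)   Pz | no ¬Px with split-first xs z∈ Pz
  ... | ys , y , zs , refl , ¬Pys , Py = x ∷ ys , y , zs , refl , ¬Px ∷ ¬Pys , Py

  split-last : ∀ x xs → P x → ∃₂ λ ys y → ∃[ zs ] x ∷ xs ≡ ys ++ y ∷ zs × P y × All (¬_ ∘ P) zs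
  split-last x []       Px = [] , x , [] , refl , Px , []
  split-last x (y ∷ ys) Px with P? y
  ... | yes Py with split-last y ys Py
  ...   | us , u , zs , eq , Pu , ¬Pzs = x ∷ us , u , zs , cong (x ∷_) eq , Pu , ¬Pzs
  split-last x (y ∷ ys) Px | no ¬Py with split-last x ys Px
  ...   | [] , u , zs , refl , Pu , ¬Pzs = [] , u , y ∷ zs , refl , Pu , ¬Py ∷ ¬Pzs
  ...   | _ ∷ us , u , zs , refl , Pu , ¬Pzs = x ∷ y ∷ us , u , zs , refl , Pu , ¬Pzs

  -- The length of filter P? (prefix it h) grows by at most one with h, so it attains every value up to its last.
  split-filter : ∀ (it : ℕ → A) n k → k ≤ length (filter P? (prefix it n)) →
    ∃[ h ] h ≤ n × length (filter P? (prefix it h)) ≡ k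
  split-filter it zero    zero    le = zero , z≤n , refl
  split-filter it (suc n) k       le with k ≤? length (filter P? (prefix it n))
  ... | yes le′ with split-filter it n k le′
  ...   | h , h≤n , eq = h , m≤n⇒m≤1+n h≤n , eq
  split-filter it (suc n) k le | no k≰ = suc n , ≤-refl , ≤-antisym (begin
    length (filter P? (prefix it n ++ [ it n ]))                  ≡⟨ cong length (filter-++ P? (prefix it n) _) ⟩
    length (filter P? (prefix it n) ++ filter P? [ it n ])        ≡⟨ length-++ (filter P? (prefix it n)) ⟩
    length (filter P? (prefix it n)) + length (filter P? [ it n ]) ≤⟨ +-monoʳ-≤ _ (length-filter P? [ it n ]) ⟩
    length (filter P? (prefix it n)) + 1                          ≡⟨ +-comm _ 1 ⟩
    suc (length (filter P? (prefix it n)))                        ≤⟨ ≰⇒> k≰ ⟩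
    k                                                             ∎) le
    where open ≤-Reasoning

-- Counts items from the end. The high part belonging to split point h consists of the first `n ∸ h`
-- items in this numbering, so it too is an initial segment and can be tabulated.
mirror : {A : Set} → ℕ → (ℕ → A) → ℕ → A
mirror n f i = f (n ∸ suc i)

prefix-mirror : ∀ {A : Set} (f : ℕ → A) n m → m ≤ n →
  prefix f n ≡ prefix f (n ∸ m) ++ applyDownFrom (mirror n f) m
prefix-mirror f n zero    le = sym (++-identityʳ _)
prefix-mirror f n (suc m) le = begin
  prefix f n                                                             ≡⟨ prefix-mirror f n m (<⇒≤ le) ⟩
  prefix f (n ∸ m) ++ applyDownFrom (mirror n f) m                       ≡⟨ cong (λ k → prefix f k ++ applyDownFrom (mirror n f) m) (+-∸-assoc 1 le) ⟩
  (prefix f (n ∸ suc m) ++ [ f (n ∸ suc m) ]) ++ applyDownFrom (mirror n f) m ≡⟨ ++-assoc (prefix f (n ∸ suc m)) _ _ ⟩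
  prefix f (n ∸ suc m) ++ applyDownFrom (mirror n f) (suc m)             ∎
  where open ≡-Reasoning

cross : ∀ {A : Set} {R : A → A → Set} xs {ys x y} → AllPairs R (xs ++ ys) → x ∈ₗ xs → y ∈ₗ ys → R x y
cross (x ∷ xs) (Rx ∷ _) (here refl) y∈ = All.lookup Rx (∈-++⁺ʳ xs y∈)
cross (x ∷ xs) (_ ∷ R)  (there x∈)  y∈ = cross xs R x∈ y∈

module Schedules (I : Instance) where
  open Instance I
  open import Data.List.Membership.DecPropositional (Fin._≟_ {n}) using () renaming (_∈?_ to _∈ₗ?_)
  open Flow p renaming (Sorted to Sorted′)

  flag : Fin n → ℕ
  flag j = if Vec.lookup Jʳ j then 1 else 0

  flag≢0 : ∀ {j} → flag j ≢ 0 → j ∈ Jʳ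
  flag≢0 {j} ≢0 with Vec.lookup Jʳ j in eq
  ... | true  = lookup⇒[]= j Jʳ eq
  ... | false = contradiction refl ≢0

  flag≡0 : ∀ {j} → flag j ≡ 0 → j ∉ Jʳ
  flag≡0 {j} ≡0 j∈ with Vec.lookup Jʳ j in eq
  flag≡0 {j} () j∈ | true
  ... | false with trans (sym eq) ([]=⇒lookup j∈)
  ...   | ()

  order : Sequence → List (Fin n)
  order π = tabulate (π ⟨$⟩ʳ_)

  masked-sum : ∀ {m} (f : Fin m → Fin n) (k : Fin m) →
    ∑[ i < m ] (if toℕ i ≤ᵇ toℕ k then p (f i) else 0) ≡ total (take (suc (toℕ k)) (tabulate f))
  masked-sum {suc m} f zero    = cong (p (f zero) +_) (trans (∑-const m 0) (*-zeroʳ m))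
  masked-sum {suc m} f (suc k) = cong (p (f zero) +_) (trans
    (sum-cong-≗ (λ i → cong (if_then p (f (suc i)) else 0) (lemma (toℕ i) (toℕ k)))) (masked-sum (f ∘ suc) k))
    where
    lemma : ∀ a b → (suc a ≤ᵇ suc b) ≡ (a ≤ᵇ b)
    lemma zero    b = refl
    lemma (suc a) b = refl

  -- `sum-permute` re-indexes the sum over jobs by positions, where the mask selects an initial
  -- segment.
  C-prefix : ∀ π k → C π (π ⟨$⟩ʳ k) ≡ total (take (suc (toℕ k)) (order π))
  C-prefix π k = trans (sum-permute _ π) (trans
    (sum-cong-≗ {n} (λ i → cong₂ (λ a b → if toℕ a ≤ᵇ toℕ b then p (π ⟨$⟩ʳ i) else 0) (inverseˡ π) (inverseˡ π)))
    (masked-sum (π ⟨$⟩ʳ_) k))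

  C-split : ∀ π xs {j ys} → order π ≡ xs ++ j ∷ ys → C π j ≡ total xs + p j
  C-split π xs {j} {ys} eq with tabulate-split (π ⟨$⟩ʳ_) xs eq
  ... | k , |xs| , refl = begin
    C π (π ⟨$⟩ʳ k)                         ≡⟨ C-prefix π k ⟩
    total (take (suc (toℕ k)) (order π))   ≡⟨ cong₂ (λ a l → total (take (suc a) l)) |xs| eq ⟩
    total (take (suc (length xs)) (xs ++ j ∷ ys)) ≡⟨ cong total (take-suc-length xs) ⟩
    total (xs ++ [ j ])                    ≡⟨ total-++ xs [ j ] ⟩
    total xs + (p j + 0)                   ≡⟨ cong (total xs +_) (+-identityʳ _) ⟩
    total xs + p j                         ∎
    where
    open ≡-Reasoning
    take-suc-length : ∀ xs → take (suc (length xs)) (xs ++ j ∷ ys) ≡ xs ++ [ j ]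
    take-suc-length []       = refl
    take-suc-length (x ∷ xs) = cong (x ∷_) (take-suc-length xs)

  totalCompletionTime≡flow : ∀ π → totalCompletionTime π ≡ flow (order π)
  totalCompletionTime≡flow π = trans (sum-permute (C π) π) (trans (sum-cong-≗ {n} (C-prefix π))
    (sym (flow-prefixes n (order π) (length-tabulate (π ⟨$⟩ʳ_)))))

  P≡total : P ≡ total (allFin n)
  P≡total = go id
    where
    go : ∀ {m} (f : Fin m → Fin n) → ∑[ i < m ] p (f i) ≡ total (tabulate f)
    go {zero}  f = refl
    go {suc m} f = cong (p (f zero) +_) (go (f ∘ suc))

  unique-order : ∀ π → Unique (order π)
  unique-order π = Uniqueₚ.tabulate⁺ (λ {i} {j} eq →
    trans (sym (inverseˡ π)) (trans (cong (π ⟨$⟩ˡ_) eq) (inverseˡ π)))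

  ∈-order : ∀ π j → j ∈ₗ order π
  ∈-order π j = subst (_∈ₗ order π) (inverseʳ π) (∈-tabulate⁺ (π ⟨$⟩ˡ j))

  fromOrder : ∀ {xs} → xs ↭ allFin n → ∃[ π ] order π ≡ xs
  fromOrder {xs} σ = permutation to from to∘from from∘to , tabulate-cast xs (sym |xs|≡n)
    where
    |xs|≡n : length xs ≡ n
    |xs|≡n = trans (↭-length σ) (length-tabulate id)
    unique : Unique xs
    unique = Unique-resp-↭ (setoid (Fin n)) (↭⇒↭ₛ (↭-sym σ)) (Uniqueₚ.allFin⁺ n)
    ∈xs : ∀ j → j ∈ₗ xs
    ∈xs j = ∈-resp-↭ (↭-sym σ) (∈-tabulate⁺ j)
    to : Fin n → Fin n
    to k = lookup xs (cast (sym |xs|≡n) k)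
    from : Fin n → Fin n
    from j = cast |xs|≡n (index (∈xs j))
    to∘from : ∀ j → to (from j) ≡ j
    to∘from j = trans (cong (lookup xs) (trans (Fin.cast-trans |xs|≡n _ _) (Fin.cast-is-id refl _)))
      (sym (Anyₚ.lookup-index (∈xs j)))
    from∘to : ∀ k → from (to k) ≡ k
    from∘to k = trans (cong (cast |xs|≡n) (lookup-injective unique (sym (Anyₚ.lookup-index (∈xs (to k))))))
      (trans (Fin.cast-trans (sym |xs|≡n) _ k) (Fin.cast-is-id refl k))

  order-↭ : ∀ π → order π ↭ allFin n
  order-↭ π = ∼bag⇒↭ (unique∧set⇒bag (unique-order π) (Uniqueₚ.allFin⁺ n)
    λ {j} → mk⇔ (λ _ → ∈-tabulate⁺ j) (λ _ → ∈-order π j))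

  ∈-rjobs : ∀ {j} → j ∈ Jʳ → j ∈ₗ rjobs
  ∈-rjobs {j} j∈ = ∈-filter⁺ (_∈? Jʳ) (∈-tabulate⁺ j) j∈

  All-rjobs : ∀ {Q : Pred (Fin n) 0ℓ} → (∀ {j} → j ∈ Jʳ → Q j) → All Q rjobs
  All-rjobs ∀Q = All.tabulate (λ {j} j∈ → ∀Q (proj₂ (∈-filter⁻ (_∈? Jʳ) {xs = allFin n} j∈)))

  C≤rentalEnd : ∀ π {j} → j ∈ Jʳ → C π j ≤ rentalEnd π
  C≤rentalEnd π j∈ = All.lookup (xs≤max 0 (map (C π) rjobs)) (∈-map⁺ (C π) (∈-rjobs j∈))

  rentalStart≤ : ∀ π {j} → j ∈ Jʳ → rentalStart π ≤ C π j ∸ p j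
  rentalStart≤ π j∈ = All.lookup (min≤xs (rentalEnd π) (map (λ j → C π j ∸ p j) rjobs))
    (∈-map⁺ (λ j → C π j ∸ p j) (∈-rjobs j∈))

  -- The rental period as a block of the sequence

  record Window (π : Sequence) : Set where
    field
      before during after : List (Fin n)
      order≡   : order π ≡ before ++ during ++ after
      before∉  : All (_∉ Jʳ) before
      after∉   : All (_∉ Jʳ) after
      during≤  : total during ≤ er π

  -- The block is cut at the first and at the last r-job. As both its ends are r-jobs, the rental
  -- starts no later than the block and ends no earlier.
  window : ∀ π → Window π
  window π with split-first (_∈? Jʳ) (order π) (∈-order π (proj₁ nonempty)) (proj₂ nonempty)
  ... | xs , a , zs , eq , xs∉ , a∈ with split-last (_∈? Jʳ) a zs a∈
  ...   | ws , b , ys , eq′ , b∈ , ys∉ = record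
    { before = xs ; during = ws ++ [ b ] ; after = ys
    ; order≡ = trans eq (cong (xs ++_) (trans eq′ (sym (++-assoc ws [ b ] ys))))
    ; before∉ = xs∉ ; after∉ = ys∉
    ; during≤ = begin
        total (ws ++ [ b ])            ≡⟨ m+n∸m≡n (total xs) _ ⟨
        total xs + total (ws ++ [ b ]) ∸ total xs ≤⟨ ∸-mono latest earliest ⟩
        er π                           ∎ }
    where
    open ≤-Reasoning
    earliest : rentalStart π ≤ total xs
    earliest = ≤-trans (rentalStart≤ π a∈)
      (≤-reflexive (trans (cong (_∸ p a) (C-split π xs eq)) (m+n∸n≡m (total xs) (p a))))
    latest : total xs + total (ws ++ [ b ]) ≤ rentalEnd π
    latest = begin
      total xs + total (ws ++ [ b ])   ≡⟨ cong (total xs +_) (total-++ ws [ b ]) ⟩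
      total xs + (total ws + (p b + 0)) ≡⟨ cong (λ x → total xs + (total ws + x)) (+-identityʳ _) ⟩
      total xs + (total ws + p b)      ≡⟨ +-assoc (total xs) _ _ ⟨
      total xs + total ws + p b        ≡⟨ cong (_+ p b) (total-++ xs ws) ⟨
      total (xs ++ ws) + p b           ≡⟨ C-split π (xs ++ ws)
                                            (trans eq (trans (cong (xs ++_) eq′) (sym (++-assoc xs ws (b ∷ ys))))) ⟨
      C π b                            ≤⟨ C≤rentalEnd π b∈ ⟩
      rentalEnd π                      ∎

  er≤ : ∀ π xs ws ys → order π ≡ xs ++ ws ++ ys → All (_∉ Jʳ) xs → All (_∉ Jʳ) ys → er π ≤ total ws
  er≤ π xs ws ys eq xs∉ ys∉ = begin
    rentalEnd π ∸ rentalStart π            ≤⟨ ∸-monoʳ-≤ (rentalEnd π) earliest ⟩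
    rentalEnd π ∸ (total xs ⊓ rentalEnd π) ≤⟨ bound (total xs) (total ws) (rentalEnd π) latest ⟩
    total ws                               ∎
    where
    open ≤-Reasoning
    ∈ws : ∀ {j} → j ∈ Jʳ → j ∈ₗ ws
    ∈ws {j} j∈ with ∈-++⁻ xs (subst (j ∈ₗ_) eq (∈-order π j))
    ... | inj₁ j∈xs = contradiction j∈ (All.lookup xs∉ j∈xs)
    ... | inj₂ j∈wy with ∈-++⁻ ws j∈wy
    ...   | inj₁ j∈ws = j∈ws
    ...   | inj₂ j∈ys = contradiction j∈ (All.lookup ys∉ j∈ys)
    C≡ : ∀ {j} → j ∈ Jʳ → ∃₂ λ us vs → ws ≡ us ++ j ∷ vs × C π j ≡ total xs + total us + p j
    C≡ {j} j∈ with ∈-∃++ (∈ws j∈)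
    ... | us , vs , refl = us , vs , refl , trans
      (C-split π (xs ++ us) (trans eq (trans (cong (xs ++_) (++-assoc us (j ∷ vs) ys)) (sym (++-assoc xs us _)))))
      (cong (_+ p j) (total-++ xs us))
    latest : rentalEnd π ≤ total xs + total ws
    latest = max≤v⁺ z≤n (Allₚ.map⁺ (All-rjobs λ j∈ → helper j∈))
      where
      helper : ∀ {j} → j ∈ Jʳ → C π j ≤ total xs + total ws
      helper {j} j∈ with C≡ j∈
      ... | us , vs , refl , eq = begin
        C π j                                   ≡⟨ eq ⟩
        total xs + total us + p j               ≡⟨ +-assoc (total xs) _ _ ⟩
        total xs + (total us + p j)             ≤⟨ +-monoʳ-≤ (total xs) (+-monoʳ-≤ (total us) (m≤m+n (p j) (total vs))) ⟩
        total xs + (total us + total (j ∷ vs))  ≡⟨ cong (total xs +_) (total-++ us (j ∷ vs)) ⟨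
        total xs + total (us ++ j ∷ vs)         ∎
    -- `rentalEnd π` is the default value in the minimum defining `rentalStart π`, hence the cut-off
    -- here; `bound` treats both cases of it.
    earliest : total xs ⊓ rentalEnd π ≤ rentalStart π
    earliest = v≤min⁺ (m⊓n≤n _ _) (Allₚ.map⁺ (All-rjobs λ j∈ → helper j∈))
      where
      helper : ∀ {j} → j ∈ Jʳ → total xs ⊓ rentalEnd π ≤ C π j ∸ p j
      helper {j} j∈ with C≡ j∈
      ... | us , vs , _ , eq = begin
        total xs ⊓ rentalEnd π            ≤⟨ m⊓n≤m _ _ ⟩
        total xs                          ≤⟨ m≤m+n _ (total us) ⟩
        total xs + total us               ≡⟨ m+n∸n≡m _ (p j) ⟨
        total xs + total us + p j ∸ p j   ≡⟨ cong (_∸ p j) eq ⟨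
        C π j ∸ p j                       ∎
    bound : ∀ a w e → e ≤ a + w → e ∸ (a ⊓ e) ≤ w
    bound a w e e≤ with ≤-total a e
    ... | inj₁ a≤e rewrite m≤n⇒m⊓n≡m a≤e = m≤n+o⇒m∸n≤o e a e≤
    ... | inj₂ e≤a rewrite m≥n⇒m⊓n≡n e≤a | n∸n≡0 e = z≤n

  -- No block of jobs takes longer than `P`, so the cap excludes nothing; it limits the width of the
  -- tables to `P + 1` however large `Kʳ` is.
  budget : ℕ
  budget = Kʳ ⊓ P

  -- Arrangements given by a low and a high choice

  module Sorted (it : ℕ → Fin n) (perm : prefix it n ↭ allFin n)
                (mono : ∀ {i k} → i < k → k < n → p (it i) ≤ p (it k)) where

    it′ : ℕ → Fin n
    it′ = mirror n it

    anti : ∀ {h} → h ≤ n → ∀ {i k} → i < k → k < h → p (it′ k) ≤ p (it′ i)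
    anti h≤n {i} {k} i<k k<h = mono (∸-monoʳ-< (s≤s i<k) (≤-trans k<h h≤n))
      (∸-monoʳ-< z<s (<-trans i<k (≤-trans k<h h≤n)) )

    Low High : ℕ → Set
    Low  = Choice (flag ∘ it)
    High = Choice (flag ∘ it′)

    module L = Measure {flag ∘ it} (p ∘ it)
    module H = Measure {flag ∘ it′} (p ∘ it′)
    module LF = ChoiceFlow {flag ∘ it} p it
    module HF = ChoiceFlow {flag ∘ it′} p it′

    split : ∀ {h} → h ≤ n → prefix it n ≡ prefix it h ++ applyDownFrom it′ (n ∸ h)
    split {h} h≤n = trans (prefix-mirror it n (n ∸ h) (m∸n≤m n h))
      (cong (λ k → prefix it k ++ applyDownFrom it′ (n ∸ h)) (m∸[m∸n]≡n h≤n))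

    arrangement : ∀ {h} → Low h → High (n ∸ h) → List (Fin n)
    arrangement S T = unchosen↑ it S ++ (chosen↑ it S ++ chosen↓ it′ T) ++ unchosen↓ it′ T

    -- The arrangement regroups as a rearrangement of the low part followed by one of the high part.
    -- The mixed term of `flow-++` sees only the total of the former and the length of the latter,
    -- which do not change.
    flow-arrangement : ∀ {h} → h ≤ n → (S : Low h) (T : High (n ∸ h)) →
      flow (arrangement S T) ≡ flow (prefix it n) + (L.extra S + H.extra T)
    flow-arrangement {h} h≤n S T = begin
      flow (U ++ (W ++ W′) ++ U′)
        ≡⟨ cong flow (trans (cong (U ++_) (++-assoc W W′ U′)) (sym (++-assoc U W (W′ ++ U′)))) ⟩
      flow ((U ++ W) ++ (W′ ++ U′))
        ≡⟨ flow-++ (U ++ W) (W′ ++ U′) ⟩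
      flow (U ++ W) + flow (W′ ++ U′) + total (U ++ W) * length (W′ ++ U′)
        ≡⟨ cong₂ _+_
             (cong₂ _+_ (LF.flow-↑ S (λ i<k k<h → mono i<k (≤-trans k<h h≤n))) (HF.flow-↓ T (anti (m∸n≤m n h))))
             (cong₂ _*_ (LF.total-↑ S) (trans (HF.length-↓ T) (sym (length-applyDownFrom it′ (n ∸ h))))) ⟩
      flow σ + L.extra S + (flow τ + H.extra T) + total σ * length τ
        ≡⟨ lemma (flow σ) (L.extra S) (flow τ) (H.extra T) (total σ * length τ) ⟩
      flow σ + flow τ + total σ * length τ + (L.extra S + H.extra T)
        ≡⟨ cong (_+ (L.extra S + H.extra T)) (trans (sym (flow-++ σ τ)) (cong flow (sym (split h≤n)))) ⟩
      flow (prefix it n) + (L.extra S + H.extra T) ∎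
      where
      open ≡-Reasoning
      U  = unchosen↑ it S
      W  = chosen↑ it S
      W′ = chosen↓ it′ T
      U′ = unchosen↓ it′ T
      σ  = prefix it h
      τ  = applyDownFrom it′ (n ∸ h)
      lemma : ∀ a b c d e → a + b + (c + d) + e ≡ a + c + e + (b + d)
      lemma = solve-∀

    unchosen↑∉ : ∀ {h} (S : Low h) → All (_∉ Jʳ) (unchosen↑ it S)
    unchosen↑∉ none            = []
    unchosen↑∉ (inside S)      = unchosen↑∉ S
    unchosen↑∉ (outside f≡0 S) = Allₚ.++⁺ (unchosen↑∉ S) (flag≡0 f≡0 ∷ [])

    unchosen↓∉ : ∀ {h} (T : High h) → All (_∉ Jʳ) (unchosen↓ it′ T)
    unchosen↓∉ none            = []
    unchosen↓∉ (inside T)      = unchosen↓∉ T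
    unchosen↓∉ (outside f≡0 T) = flag≡0 f≡0 ∷ unchosen↓∉ T

    total-chosen : ∀ {h} (S : Low h) (T : High (n ∸ h)) →
      total (chosen↑ it S ++ chosen↓ it′ T) ≡ L.weight S + H.weight T
    total-chosen S T = trans (total-++ (chosen↑ it S) _) (cong₂ _+_ (LF.total-chosen↑ S) (HF.total-chosen↓ T))

    arrangement-feasible : ∀ π {h} (S : Low h) (T : High (n ∸ h)) → order π ≡ arrangement S T →
      L.weight S + H.weight T ≤ budget → Feasible π
    arrangement-feasible π S T eq ≤budget = begin
      er π                                        ≤⟨ er≤ π _ _ _ eq (unchosen↑∉ S) (unchosen↓∉ T) ⟩
      total (chosen↑ it S ++ chosen↓ it′ T)       ≡⟨ total-chosen S T ⟩
      L.weight S + H.weight T                     ≤⟨ ≤budget ⟩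
      budget                                      ≤⟨ m⊓n≤m Kʳ P ⟩
      Kʳ                                          ∎
      where open ≤-Reasoning

    sorted : Sorted′ (prefix it n)
    sorted = subst Sorted′ (sym (prefix≡applyUpTo it n)) (AllPairsₚ.applyUpTo⁺₁ it n mono)

    record Improvement (π : Sequence) : Set where
      field
        h       : ℕ
        h≤n     : h ≤ n
        low     : Low h
        high    : High (n ∸ h)
        ≤budget : L.weight low + H.weight high ≤ budget
        better  : flow (prefix it n) + (L.extra low + H.extra high) ≤ totalCompletionTime π

    -- The set of jobs in the window and the number of jobs before it are kept, while the jobs
    -- inside and those outside are each sorted; `flow-blocks-min` shows that this does not increase
    -- the cost. The result is an arrangement, whose cost `flow-arrangement` computes.
    improve : ∀ π → Feasible π → Improvement π
    improve π er≤K = go (window π)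
      where
      go : Window π → Improvement π
      go w = record
        { h = h ; h≤n = h≤n ; low = S ; high = T
        ; ≤budget = ⊓-glb (≤-trans (≤-reflexive weight≡) (≤-trans during≤ er≤K)) (≤-trans (≤-reflexive weight≡) during≤P)
        ; better = begin
            flow (prefix it n) + (L.extra S + H.extra T)  ≡⟨ flow-arrangement h≤n S T ⟨
            flow (U ++ (W ++ W′) ++ U′)
              ≤⟨ flow-blocks-min {U} {W ++ W′} {U′} {before} {during} {after}
                   (subst Sorted′ (sym UU′≡) (AllPairsₚ.filter⁺ ¬D? sorted))
                   (subst Sorted′ (sym WW′≡) (AllPairsₚ.filter⁺ D? sorted))
                   (subst (_↭ before ++ after) (sym UU′≡) outer↭)
                   WW′↭ |U|≡ ⟩
            flow (before ++ during ++ after)  ≡⟨ cong flow order≡ ⟨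
            flow (order π)                ≡⟨ totalCompletionTime≡flow π ⟨
            totalCompletionTime π         ∎ }
        where
        open ≤-Reasoning
        open Window w
        D? : Decidable (_∈ₗ during)
        D? = _∈ₗ? during
        ¬D? : Decidable (_∉ₗ during)
        ¬D? = ¬? ∘ D?

        unique : Unique (before ++ during ++ after)
        unique = subst Unique order≡ (unique-order π)
        before∌ : All (_∉ₗ during) before
        before∌ = All.tabulate λ x∈ x∈D → cross before unique x∈ (∈-++⁺ˡ x∈D) refl
        after∌ : All (_∉ₗ during) after
        after∌ = All.tabulate λ x∈ x∈D →
          cross (before ++ during) (subst Unique (sym (++-assoc before during after)) unique) (∈-++⁺ʳ before x∈D) x∈ refl

        σ : prefix it n ↭ before ++ during ++ after
        σ = ↭-trans perm (↭-trans (↭-sym (order-↭ π)) (↭-reflexive order≡))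

        outer : filter ¬D? (before ++ during ++ after) ≡ before ++ after
        outer rewrite filter-++ ¬D? before (during ++ after) | filter-++ ¬D? during after
          | filter-all ¬D? before∌ | filter-all ¬D? after∌
          | filter-none ¬D? {during} (All.tabulate λ x∈ x∉ → x∉ x∈) = refl

        inner : filter D? (before ++ during ++ after) ≡ during
        inner rewrite filter-++ D? before (during ++ after) | filter-++ D? during after
          | filter-none D? before∌ | filter-none D? after∌
          | filter-all D? {during} (All.tabulate id) = ++-identityʳ during

        outer↭ : filter ¬D? (prefix it n) ↭ before ++ after
        outer↭ = ↭-trans (filter-↭ ¬D? σ) (↭-reflexive outer)

        forced : ∀ j → flag j ≢ 0 → j ∈ₗ during
        forced j ≢0 with ∈-++⁻ before (subst (j ∈ₗ_) order≡ (∈-order π j))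
        ... | inj₁ j∈ = contradiction (flag≢0 ≢0) (All.lookup before∉ j∈)
        ... | inj₂ j∈′ with ∈-++⁻ during j∈′
        ...   | inj₁ j∈ = j∈
        ...   | inj₂ j∈ = contradiction (flag≢0 ≢0) (All.lookup after∉ j∈)

        -- Cutting the sorted jobs where exactly `length before` outside jobs have been seen gives
        -- the unchosen low jobs the length that `flow-blocks-min` requires.
        hs : ∃[ h ] h ≤ n × length (filter ¬D? (prefix it h)) ≡ length before
        hs = split-filter ¬D? it n (length before) (begin
          length before                       ≤⟨ m≤m+n _ (length after) ⟩
          length before + length after        ≡⟨ length-++ before ⟨
          length (before ++ after)            ≡⟨ ↭-length outer↭ ⟨
          length (filter ¬D? (prefix it n))   ∎)
        h = proj₁ hs
        h≤n = proj₁ (proj₂ hs)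

        S : Low h
        S = choose it D? (λ i → forced (it i)) h
        T : High (n ∸ h)
        T = choose it′ D? (λ i → forced (it′ i)) (n ∸ h)
        U  = unchosen↑ it S
        W  = chosen↑ it S
        W′ = chosen↓ it′ T
        U′ = unchosen↓ it′ T

        |U|≡ : length U ≡ length before
        |U|≡ = trans (cong length (unchosen↑-choose it D? (λ i → forced (it i)) h)) (proj₂ (proj₂ hs))

        UU′≡ : U ++ U′ ≡ filter ¬D? (prefix it n)
        UU′≡ = trans
          (cong₂ _++_ (unchosen↑-choose it D? (λ i → forced (it i)) h) (unchosen↓-choose it′ D? (λ i → forced (it′ i)) (n ∸ h)))
          (sym (trans (cong (filter ¬D?) (split h≤n)) (filter-++ ¬D? (prefix it h) _)))

        WW′≡ : W ++ W′ ≡ filter D? (prefix it n)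
        WW′≡ = trans
          (cong₂ _++_ (chosen↑-choose it D? (λ i → forced (it i)) h) (chosen↓-choose it′ D? (λ i → forced (it′ i)) (n ∸ h)))
          (sym (trans (cong (filter D?) (split h≤n)) (filter-++ D? (prefix it h) _)))

        WW′↭ : W ++ W′ ↭ during
        WW′↭ = ↭-trans (↭-reflexive WW′≡) (↭-trans (filter-↭ D? σ) (↭-reflexive inner))

        weight≡ : L.weight S + H.weight T ≡ total during
        weight≡ = trans (sym (total-chosen S T)) (total-↭ WW′↭)

        during≤P : total during ≤ P
        during≤P = begin
          total during                                     ≤⟨ m≤m+n _ (total after) ⟩
          total during + total after                       ≤⟨ m≤n+m _ (total before) ⟩
          total before + (total during + total after)      ≡⟨ cong (total before +_) (total-++ during after) ⟨
          total before + total (during ++ after)           ≡⟨ total-++ before _ ⟨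
          total (before ++ during ++ after)                ≡⟨ total-↭ (↭-trans (↭-sym σ) perm) ⟩
          total (allFin n)                                 ≡⟨ P≡total ⟨
          P                                                ∎

-- Total correctness and running time of programs

update-≡ : ∀ {A : Set} (f : ℕ → A) k {v} → (f [ k ↦ v ]) k ≡ v
update-≡ f k with k ≡ᵇ k | ≡⇒≡ᵇ k k refl
... | true | _ = refl

update-at : ∀ {A : Set} (f : ℕ → A) {k i v} → k ≡ i → (f [ k ↦ v ]) i ≡ v
update-at f refl = update-≡ f _

update-≢ : ∀ {A : Set} (f : ℕ → A) {k i v} → k ≢ i → (f [ k ↦ v ]) i ≡ f i
update-≢ f {k} {i} k≢i with k ≡ᵇ i | ≡ᵇ⇒≡ k i
... | true  | eq = contradiction (eq tt) k≢i
... | false | _  = refl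

Run : Program → State → ℕ → (State → Set) → Set
Run c s t Q = ∃[ s′ ] ∃[ u ] ⟨ c , s ⟩⇓⟨ s′ , u ⟩ × u ≤ t × Q s′

run-map : ∀ {c s t} {P Q : State → Set} → (∀ s → P s → Q s) → Run c s t P → Run c s t Q
run-map f (s′ , u , r , u≤t , Ps′) = s′ , u , r , u≤t , f s′ Ps′

run-seq : ∀ {c d s t u} {P Q : State → Set} → Run c s t P → (∀ s′ → P s′ → Run d s′ u Q) → Run (c ⨟ d) s (t + u) Q
run-seq (s′ , t , r , t≤ , Ps′) k with k s′ Ps′
... | s″ , u , r′ , u≤ , Qs″ = s″ , t + u , seq r r′ , +-mono-≤ t≤ u≤ , Qs″

-- Meant for loop-free programs only: a loop gets the precondition ⊥ and the junk running time 0.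
wp : Program → (State → Set) → State → Set
wp skip                   Q s = Q s
wp (x ≔ e)                Q s = Q (setReg s x (⟦ e ⟧ s))
wp (a ![ e ]≔ f)          Q s = Q (setArr s a (⟦ e ⟧ s) (⟦ f ⟧ s))
wp (c ⨟ d)                Q s = wp c (wp d Q) s
wp (IF b THEN c ELSE d)   Q s = (Holds b s → wp c Q s) × (¬ Holds b s → wp d Q s)
wp (WHILE b DO c)         Q s = ⊥

-- Both branches of a conditional are charged, so the bound depends on the program text alone and
-- not on the state.
time : Program → ℕ
time skip                 = 1
time (x ≔ e)              = suc (cost e)
time (a ![ e ]≔ f)        = suc (cost e + cost f)
time (c ⨟ d)              = time c + time d
time (IF b THEN c ELSE d) = costᵗ b + (time c + time d)
time (WHILE b DO c)       = 0

run-if : ∀ {b c d s t u} {Q : State → Set} → (Holds b s → Run c s t Q) → (¬ Holds b s → Run d s u Q) →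
  Run (IF b THEN c ELSE d) s (costᵗ b + (t + u)) Q
run-if {e ≼ f} {s = s} {t} {u} k l with ⟦ e ⟧ s ≤? ⟦ f ⟧ s
... | yes b with k b
...   | s′ , t′ , r , t′≤ , Qs′ = s′ , _ , if-true b r , +-monoʳ-≤ (costᵗ (e ≼ f)) (≤-trans t′≤ (m≤m+n t u)) , Qs′
run-if {e ≼ f} {s = s} {t} {u} k l | no ¬b with l ¬b
...   | s′ , t′ , r , t′≤ , Qs′ = s′ , _ , if-false ¬b r , +-monoʳ-≤ (costᵗ (e ≼ f)) (≤-trans t′≤ (m≤n+m u t)) , Qs′

run-wp : ∀ c {Q : State → Set} {s} → wp c Q s → Run c s (time c) Q
run-wp skip          q = _ , _ , skip , ≤-refl , q
run-wp (x ≔ e)       q = _ , _ , assign , ≤-refl , q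
run-wp (a ![ e ]≔ f) q = _ , _ , store , ≤-refl , q
run-wp (c ⨟ d)       q = run-seq (run-wp c q) (λ _ → run-wp d)
run-wp (IF b THEN c ELSE d) (q , q′) = run-if (run-wp c ∘ q) (run-wp d ∘ q′)

-- Indexing the invariant by the iteration number yields termination, correctness and running time
-- from one induction. The factor `suc N` accounts for the final, failing test.
run-while : ∀ {b c} N T (Inv : ℕ → State → Set) →
  (∀ k s → k < N → Inv k s → Holds b s × Run c s T (Inv (suc k))) →
  (∀ s → Inv N s → ¬ Holds b s) →
  ∀ {s} → Inv 0 s → Run (WHILE b DO c) s (suc N * (costᵗ b + T)) (Inv N)
run-while {b} {c} N T Inv step stop = go N 0 (+-identityʳ N)
  where
  B = costᵗ b
  go : ∀ m k → m + k ≡ N → ∀ {s} → Inv k s → Run (WHILE b DO c) s (suc m * (B + T)) (Inv N)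
  go zero    k refl {s} inv = s , _ , while-stop (stop s inv) , ≤-trans (m≤m+n B T) (m≤m+n _ 0) , inv
  go (suc m) k eq   {s} inv with step k s (subst (k <_) eq (m<n+m k z<s)) inv
  ... | b-holds , s′ , t , r , t≤ , inv′ with go m (suc k) (trans (+-suc m k) eq) inv′
  ...   | s″ , u , r′ , u≤ , inv″ = s″ , B + (t + u) , while-step b-holds r r′ ,
    ≤-trans (+-monoʳ-≤ B (+-mono-≤ t≤ u≤)) (≤-reflexive (sym (+-assoc B T _))) , inv″

-- A product rather than an All, so that it reduces along with the states.
Same : List ℕ → List ℕ → State → State → Set
Same (r ∷ rs) as       s s′ = reg s′ r ≡ reg s r × Same rs as s s′
Same []       (a ∷ as) s s′ = arr s′ a ≡ arr s a × Same [] as s s′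
Same []       []       s s′ = ⊤

next : ∀ k {a} → k ≡ a → k + 1 ≡ suc a
next k refl = +-comm k 1

-- Bucket sort

-- Registers: 0 n, 1 Kʳ, 2 the verdict; 3 P + 1 and later the number of sorting keys; 4 position; 5 length of the
-- output list, 6 current key; 7 the budget B = min (Kʳ, P), 8 S = B + 1, 9 (n + 1) S; 10 next free cell; 11 j, 12 c,
-- 13 c · q, 14 x, 15 q = the processing time of item j - 1; 16 and 17 values without and with that item, 18 the
-- predecessor cell with it; 19 and 20 best value and cell of a low part; 21, 22, 23 and 24 best value, low cell,
-- high cell and split point; 25 split point h, 26 weight y, 27 and 28 rows of the low and high tables, 29 cell.
-- Arrays: 0 and 1 the input, 2 the output list, 3 and 4 sorting keys and items; 5 and 6 processing times and flags
-- of the current items; 7, 8 and 9 value, choice (1 for inside) and predecessor of every cell of the tables.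

≡ᵇ-true : ∀ {a b} → a ≡ b → (a ≡ᵇ b) ≡ true
≡ᵇ-true {a} {b} a≡b with a ≡ᵇ b | ≡⇒≡ᵇ a b a≡b
... | true | _ = refl

≡ᵇ-false : ∀ {a b} → a ≢ b → (a ≡ᵇ b) ≡ false
≡ᵇ-false {a} {b} a≢b with a ≡ᵇ b | ≡ᵇ⇒≡ a b
... | true  | eq = contradiction (eq tt) a≢b
... | false | _  = refl

prefix-cong : ∀ {A : Set} {f g : ℕ → A} n → (∀ i → i < n → f i ≡ g i) → prefix f n ≡ prefix g n
prefix-cong zero    eq = refl
prefix-cong (suc n) eq = cong₂ (λ l x → l ++ [ x ]) (prefix-cong n (λ i i<n → eq i (m<n⇒m<1+n i<n))) (eq n ≤-refl)

module Buckets {A : Set} (key : ℕ → ℕ) (src : ℕ → A) where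

  one : ℕ → ℕ → List A
  one v i = if key i ≡ᵇ v then [ src i ] else []

  -- Items of equal key keep their index order. This stability does not matter when sorting by
  -- processing time, but `buckets-arrangement` relies on it.
  bucket : ℕ → ℕ → List A
  bucket v zero    = []
  bucket v (suc i) = bucket v i ++ one v i

  buckets : ℕ → ℕ → List A
  buckets zero    n = []
  buckets (suc v) n = buckets v n ++ bucket v n

  buckets-≥ : ∀ V n → V ≤ key n → buckets V (suc n) ≡ buckets V n
  buckets-≥ zero    n le = refl
  buckets-≥ (suc v) n le rewrite buckets-≥ v n (<⇒≤ le) | ≡ᵇ-false (>⇒≢ le) | ++-identityʳ (bucket v n) = refl

  -- The new item ends up last in its own bucket; each later bucket is commuted past it.
  buckets-< : ∀ V n → key n < V → buckets V (suc n) ↭ buckets V n ++ [ src n ]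
  buckets-< (suc v) n lt with key n ≟ v
  ... | yes eq rewrite buckets-≥ v n (≤-reflexive (sym eq)) | ≡ᵇ-true eq =
    ↭-reflexive (sym (++-assoc (buckets v n) (bucket v n) _))
  ... | no neq rewrite ≡ᵇ-false neq | ++-identityʳ (bucket v n) =
    ↭-trans (++⁺ʳ (bucket v n) (buckets-< v n (≤∧≢⇒< (s≤s⁻¹ lt) neq)))
      (↭-trans (↭-reflexive (++-assoc (buckets v n) _ _))
        (↭-trans (++⁺ˡ (buckets v n) (++-comm [ src n ] (bucket v n))) (↭-reflexive (sym (++-assoc (buckets v n) _ _)))))

  buckets-↭ : ∀ V n → (∀ i → i < n → key i < V) → buckets V n ↭ prefix src n
  buckets-↭ zero    zero    _  = ↭-refl
  buckets-↭ (suc V) zero    lt = ↭-trans (↭-reflexive (++-identityʳ _)) (buckets-↭ V zero (λ _ ()))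
  buckets-↭ V       (suc n) lt = ↭-trans (buckets-< V n (lt n ≤-refl))
    (++⁺ʳ [ src n ] (buckets-↭ V n (λ i i<n → lt i (m<n⇒m<1+n i<n))))

  module _ (p : A → ℕ) (key≡p : ∀ i → key i ≡ p (src i)) where

    bucket-const : ∀ v n → All (λ a → p a ≡ v) (bucket v n)
    bucket-const v zero    = []
    bucket-const v (suc i) with key i ≡ᵇ v | ≡ᵇ⇒≡ (key i) v
    ... | true  | eq = Allₚ.++⁺ (bucket-const v i) (trans (sym (key≡p i)) (eq tt) ∷ [])
    ... | false | _  = Allₚ.++⁺ (bucket-const v i) []

    buckets-bounded : ∀ V n → All (λ a → p a < V) (buckets V n)
    buckets-bounded zero    n = []
    buckets-bounded (suc v) n = Allₚ.++⁺ (All.map m<n⇒m<1+n (buckets-bounded v n))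
      (All.map (λ { refl → ≤-refl }) (bucket-const v n))

    constant-sorted : ∀ {v xs} → All (λ a → p a ≡ v) xs → AllPairs (_≤_ on p) xs
    constant-sorted []          = []
    constant-sorted (refl ∷ xs) = All.map (≤-reflexive ∘ sym) xs ∷ constant-sorted xs

    buckets-sorted : ∀ V n → AllPairs (_≤_ on p) (buckets V n)
    buckets-sorted zero    n = []
    buckets-sorted (suc v) n = AllPairsₚ.++⁺ (buckets-sorted v n) (constant-sorted (bucket-const v n))
      (All.map (λ lt → All.map (λ eq → ≤-trans (<⇒≤ lt) (≤-reflexive (sym eq))) (bucket-const v n)) (buckets-bounded v n))

-- One pass over all items for each key value takes time proportional to n V, which is within the
-- bound. The two nested comparisons test equality.
bucketStep bucketSort : Program
bucketStep =
  (IF 3 ![ var 4 ] ≼ var 6 THEN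
    (IF var 6 ≼ 3 ![ var 4 ] THEN (2 ![ var 5 ]≔ 4 ![ var 4 ] ⨟ 5 ≔ var 5 ⊕ lit 1) ELSE skip)
   ELSE skip) ⨟
  4 ≔ var 4 ⊕ lit 1
bucketSort =
  (5 ≔ lit 0 ⨟ 6 ≔ lit 0) ⨟
  WHILE var 6 ⊕ lit 1 ≼ var 3 DO
    (4 ≔ lit 0 ⨟
     (WHILE var 4 ⊕ lit 1 ≼ var 0 DO bucketStep) ⨟
     6 ≔ var 6 ⊕ lit 1)

bucketSort-time : ℕ → ℕ → ℕ
bucketSort-time n V = 4 + suc V * (5 + (2 + (suc n * (5 + time bucketStep) + 4)))

module _ {A : Set} (code : A → ℕ) where

  Listed : List A → State → Set
  Listed xs s = reg s 5 ≡ length xs × prefix (arr s 2) (length xs) ≡ map code xs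

  module _ {n V : ℕ} {key : ℕ → ℕ} {src : ℕ → A} where
    open Buckets key src

    record Keyed (s₀ s : State) : Set where
      constructor keyed
      field
        reg-n    : reg s 0 ≡ n
        reg-V    : reg s 3 ≡ V
        keys     : ∀ i → i < n → arr s 3 i ≡ key i
        sources  : ∀ i → i < n → arr s 4 i ≡ code (src i)
        same     : Same (0 ∷ 1 ∷ 2 ∷ 3 ∷ []) (0 ∷ 1 ∷ 3 ∷ 4 ∷ []) s₀ s
    open Keyed

    push : ∀ {xs x k} (f : ℕ → ℕ) → k ≡ length xs → prefix f (length xs) ≡ map code xs →
      prefix (f [ k ↦ code x ]) (length (xs ++ [ x ])) ≡ map code (xs ++ [ x ])
    push {xs} {x} f refl eq rewrite length-++ xs {[ x ]} | +-comm (length xs) 1 | map-++ code xs [ x ] =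
      cong₂ (λ l y → l ++ [ y ])
        (trans (prefix-cong (length xs) (λ i i< → update-≢ f (>⇒≢ i<))) eq)
        (update-≡ f (length xs))

    record Inner (s₀ : State) (v i : ℕ) (s : State) : Set where
      constructor inner
      field
        ks     : Keyed s₀ s
        reg-v  : reg s 6 ≡ v
        reg-i  : reg s 4 ≡ i
        listed : Listed (buckets v n ++ bucket v i) s

    record Outer (s₀ : State) (v : ℕ) (s : State) : Set where
      constructor outer
      field
        ks     : Keyed s₀ s
        reg-v  : reg s 6 ≡ v
        listed : Listed (buckets v n) s

    bucketStep-correct : ∀ s₀ v i s → i < n → Inner s₀ v i s →
      Run bucketStep s (time bucketStep) (Inner s₀ v (suc i))
    bucketStep-correct s₀ v i s i<n (inner ks rv ri (len , eq)) = run-wp bucketStep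
      ( (λ k≤v → (λ v≤k →
          inner (keyed (reg-n ks) (reg-V ks) (keys ks) (sources ks) (same ks)) rv (trans (+-comm _ 1) (cong suc ri))
            (hit (≤-antisym (subst₂ _≤_ key≡ rv k≤v) (subst₂ _≤_ rv key≡ v≤k))))
        , (λ v≰k → miss (λ { refl → v≰k (≤-reflexive (trans rv (sym key≡))) })))
      , (λ k≰v → miss (λ { refl → k≰v (≤-reflexive (trans key≡ (sym rv))) })) )
      where
      key≡ : arr s 3 (reg s 4) ≡ key i
      key≡ = trans (cong (arr s 3) ri) (keys ks i i<n)
      src≡ : arr s 4 (reg s 4) ≡ code (src i)
      src≡ = trans (cong (arr s 4) ri) (sources ks i i<n)
      hit : key i ≡ v → reg s 5 + 1 ≡ length (buckets v n ++ bucket v i ++ one v i) ×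
        prefix (arr s 2 [ reg s 5 ↦ arr s 4 (reg s 4) ]) (length (buckets v n ++ bucket v i ++ one v i))
          ≡ map code (buckets v n ++ bucket v i ++ one v i)
      hit k≡v rewrite ≡ᵇ-true k≡v | sym (++-assoc (buckets v n) (bucket v i) [ src i ]) | src≡ =
        trans (cong (_+ 1) len) (sym (length-++ (buckets v n ++ bucket v i))) ,
        push {buckets v n ++ bucket v i} (arr s 2) len eq
      miss : key i ≢ v → Inner s₀ v (suc i) (setReg s 4 (reg s 4 + 1))
      miss k≢v = inner (keyed (reg-n ks) (reg-V ks) (keys ks) (sources ks) (same ks)) rv (trans (+-comm _ 1) (cong suc ri))
        lemma
        where
        lemma : Listed (buckets v n ++ bucket v i ++ one v i) s
        lemma rewrite ≡ᵇ-false k≢v | ++-identityʳ (bucket v i) = len , eq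

    bucketSort-correct : ∀ {s} → Keyed s s → Run bucketSort s (bucketSort-time n V)
      (λ s′ → Keyed s s′ × Listed (buckets V n) s′)
    bucketSort-correct {s₀} ks₀ = run-seq
      (run-wp (5 ≔ lit 0 ⨟ 6 ≔ lit 0) {Outer s₀ 0}
        (outer (keyed (reg-n ks₀) (reg-V ks₀) (keys ks₀) (sources ks₀) (same ks₀)) refl (refl , refl)))
      λ _ inv → run-map (λ s (outer ks _ l) → ks , l) (run-while V _ (Outer s₀) step stop inv)
      where
      stop : ∀ s → Outer s₀ V s → ¬ (reg s 6 + 1 ≤ reg s 3)
      stop s (outer ks rv _) le = 1+n≰n (subst₂ _≤_ (trans (+-comm _ 1) (cong suc rv)) (reg-V ks) le)
      stop′ : ∀ v s → Inner s₀ v n s → ¬ (reg s 4 + 1 ≤ reg s 0)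
      stop′ v s (inner ks _ ri _) le = 1+n≰n (subst₂ _≤_ (trans (+-comm _ 1) (cong suc ri)) (reg-n ks) le)
      step′ : ∀ v i s → i < n → Inner s₀ v i s →
        reg s 4 + 1 ≤ reg s 0 × Run bucketStep s (time bucketStep) (Inner s₀ v (suc i))
      step′ v i s i<n inv@(inner ks _ ri _) =
        subst₂ _≤_ (sym (trans (+-comm _ 1) (cong suc ri))) (sym (reg-n ks)) i<n , bucketStep-correct s₀ v i s i<n inv
      step : ∀ v s → v < V → Outer s₀ v s → reg s 6 + 1 ≤ reg s 3 × Run _ s _ (Outer s₀ (suc v))
      step v s v<V (outer ks rv l) =
        subst₂ _≤_ (sym (trans (+-comm _ 1) (cong suc rv))) (sym (reg-V ks)) v<V ,
        run-seq (run-wp (4 ≔ lit 0) {Inner s₀ v 0}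
            (inner (keyed (reg-n ks) (reg-V ks) (keys ks) (sources ks) (same ks)) rv refl
              (subst (λ xs → Listed xs s) (sym (++-identityʳ (buckets v n))) l)))
          λ _ inv → run-seq (run-while n _ (Inner s₀ v) (step′ v) (stop′ v) inv)
          λ s′ (inner ks rv ri l) → run-wp (6 ≔ var 6 ⊕ lit 1) {Outer s₀ (suc v)}
            (outer (keyed (reg-n ks) (reg-V ks) (keys ks) (sources ks) (same ks)) (trans (+-comm _ 1) (cong suc rv)) l)

-- The tables of partial choices

-- v encodes the least cost of an element of D (with a minimiser satisfying G) as its successor, and is 0
-- if D is empty.
Min : {A : Set} (D G : A → Set) (cost : A → ℕ) → ℕ → Set
Min D G cost v = (v ≡ 0 × ∀ a → ¬ D a) ⊎
  (∃[ a ] D a × G a × v ≡ suc (cost a) × ∀ b → D b → cost a ≤ cost b)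

-- The order of values in the encoding of `Min`, with 0 read as infinity: `v` is at least as good as
-- `u`.
_⊑_ : ℕ → ℕ → Set
v ⊑ u = u ≡ 0 ⊎ (1 ≤ v × v ≤ u)

module _ {A : Set} {cost : A → ℕ} where

  min-map : ∀ {D D′ G G′ : A → Set} {v} → (∀ a → D a → D′ a) → (∀ a → D′ a → D a) → (∀ a → D a → G a → G′ a) →
    Min D G cost v → Min D′ G′ cost v
  min-map to from g (inj₁ (v≡0 , empty))           = inj₁ (v≡0 , λ a D′a → empty a (from a D′a))
  min-map to from g (inj₂ (a , Da , Ga , eq , le)) = inj₂ (a , to a Da , g a Da Ga , eq , λ b D′b → le b (from b D′b))

  -- The single comparison behind every minimisation below: `K` is the union of `D` and `E`, and the
  -- better of their two optima is optimal for `K`. The winner keeps its property `G`, so a program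
  -- has to store the data of the winner only.
  min-left : ∀ {D E G H K : A → Set} {v u} → v ⊑ u → Min D G cost v → Min E H cost u →
    (∀ a → K a → D a ⊎ E a) → (∀ a → D a → K a) → Min K G cost v
  min-left {K = K} {u = u} v⊑u (inj₂ (a , Da , Ga , refl , le)) mE split D⊆K =
    inj₂ (a , D⊆K a Da , Ga , refl , λ b Kb → least v⊑u mE (split b Kb))
    where
    least : suc (cost a) ⊑ u → Min _ _ cost u → ∀ {b} → _ ⊎ _ → cost a ≤ cost b
    least _ _ {b} (inj₁ Db) = le b Db
    least _ (inj₁ (_ , empty)) {b} (inj₂ Eb) = contradiction Eb (empty b)
    least (inj₂ (_ , v≤u)) (inj₂ (_ , _ , _ , refl , le′)) {b} (inj₂ Eb) = ≤-trans (s≤s⁻¹ v≤u) (le′ b Eb)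
  min-left (inj₁ refl) (inj₁ (v≡0 , empty)) (inj₁ (_ , empty′)) split D⊆K = inj₁ (v≡0 , λ a Ka → no-K a (split a Ka))
    where
    no-K : ∀ a → _ → ⊥
    no-K a (inj₁ Da) = empty a Da
    no-K a (inj₂ Ea) = empty′ a Ea
  min-left (inj₁ refl) (inj₁ _) (inj₂ (_ , _ , _ , () , _)) split D⊆K
  min-left (inj₂ (1≤0 , _)) (inj₁ (refl , _)) _ split D⊆K = contradiction 1≤0 λ ()

  min-right : ∀ {D E G H K : A → Set} {v u} → u ⊑ v → Min D G cost v → Min E H cost u →
    (∀ a → K a → D a ⊎ E a) → (∀ a → E a → K a) → Min K H cost u
  min-right u⊑v mD mE split E⊆K = min-left u⊑v mE mD (λ a Ka → Sum.swap (split a Ka)) E⊆K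

module _ {f : ℕ → ℕ} (tag nxt : ℕ → ℕ) where

  -- Following the links from cell `a` spells the choice from its last item downwards. As links
  -- strictly decrease, the path never leaves the cells up to `a`; hence `encodes-frame`, by which
  -- later writes do no harm.
  Encodes : ∀ {j} → ℕ → Choice f j → Set
  Encodes a none          = ⊤
  Encodes a (inside S)    = tag a ≡ 1 × nxt a < a × Encodes (nxt a) S
  Encodes a (outside _ S) = tag a ≡ 0 × nxt a < a × Encodes (nxt a) S

encodes-frame : ∀ {f tag nxt tag′ nxt′ j} a (S : Choice f j) →
  (∀ b → b ≤ a → tag′ b ≡ tag b × nxt′ b ≡ nxt b) → Encodes tag nxt a S → Encodes tag′ nxt′ a S
encodes-frame a none          eq _ = tt
encodes-frame {nxt = nxt} a (inside S) eq (t , lt , e) with eq a ≤-refl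
... | teq , neq rewrite neq = trans teq t , lt , encodes-frame (nxt a) S (λ b b≤ → eq b (≤-trans b≤ (<⇒≤ lt))) e
encodes-frame {nxt = nxt} a (outside _ S) eq (t , lt , e) with eq a ≤-refl
... | teq , neq rewrite neq = trans teq t , lt , encodes-frame (nxt a) S (λ b b≤ → eq b (≤-trans b≤ (<⇒≤ lt))) e

quotient-unique : ∀ S .{{_ : NonZero S}} {a b x y} → x < S → y < S → a * S + x ≡ b * S + y → a ≡ b
quotient-unique S {a} {b} {x} {y} x<S y<S eq = trans (sym (quot a x<S)) (trans (cong (_/ S) eq) (quot b y<S))
  where
  quot : ∀ a {x} → x < S → (a * S + x) / S ≡ a
  quot a {x} x<S = trans (+-distrib-/-∣ˡ x (n∣m*n a)) (trans (cong₂ _+_ (m*n/n≡m a S) (m<n⇒m/n≡0 x<S)) (+-identityʳ a))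

-- Cells are filled in the order of their addresses, so register 10 only ever grows by one, and a
-- predecessor lies at a distance known without multiplication: `(n + 1) S` back if the item is
-- outside, and a further `S + q` back if it is inside. The product c q grows by q from row to row.
options choose-option initial fill-cell fill row rows table : Program
options =
  (16 ≔ lit 0 ⨟
   IF 6 ![ var 11 ⊖ lit 1 ] ≼ lit 0 THEN
     (IF lit 1 ≼ 7 ![ var 10 ⊖ var 9 ]
      THEN 16 ≔ 7 ![ var 10 ⊖ var 9 ] ⊕ ((var 13 ⊖ var 14) ⊕ (var 14 ⊖ var 13)) ELSE skip)
   ELSE skip) ⨟
  -- The address of the cell for one item fewer, count c - 1 and weight x - q; it is meaningful only
  -- under the two tests that follow.
  (17 ≔ lit 0 ⨟ 18 ≔ var 10 ⊖ var 9 ⊖ var 8 ⊖ var 15 ⨟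
   IF lit 1 ≼ var 12 THEN (IF var 15 ≼ var 14 THEN 17 ≔ 7 ![ var 18 ] ELSE skip) ELSE skip)
choose-option =
  IF lit 1 ≼ var 16 THEN (IF lit 1 ≼ var 17 THEN (IF var 16 ≼ var 17 THEN omit ELSE admit) ELSE omit) ELSE admit
  where
  omit admit : Program
  omit = 7 ![ var 10 ]≔ var 16 ⨟ 8 ![ var 10 ]≔ lit 0 ⨟ 9 ![ var 10 ]≔ var 10 ⊖ var 9
  admit = 7 ![ var 10 ]≔ var 17 ⨟ 8 ![ var 10 ]≔ lit 1 ⨟ 9 ![ var 10 ]≔ var 18
-- With no items, only count 0 and weight 0 are attained, at cost 0, which is encoded as 1.
initial = IF var 12 ⊕ var 14 ≼ lit 0 THEN 7 ![ var 10 ]≔ lit 1 ELSE 7 ![ var 10 ]≔ lit 0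
fill-cell = IF var 11 ≼ lit 0 THEN initial ELSE (options ⨟ choose-option)
fill =
  fill-cell ⨟
  (10 ≔ var 10 ⊕ lit 1 ⨟ 14 ≔ var 14 ⊕ lit 1)
row =
  14 ≔ lit 0 ⨟
  (WHILE var 14 ≼ var 7 DO fill) ⨟
  (12 ≔ var 12 ⊕ lit 1 ⨟ 13 ≔ var 13 ⊕ var 15)
rows =
  (12 ≔ lit 0 ⨟ 13 ≔ lit 0 ⨟ 15 ≔ 5 ![ var 11 ⊖ lit 1 ]) ⨟
  (WHILE var 12 ≼ var 0 DO row) ⨟
  11 ≔ var 11 ⊕ lit 1
table =
  11 ≔ lit 0 ⨟
  WHILE var 11 ≼ var 0 DO rows

row-time rows-time table-time : ℕ → ℕ → ℕ
row-time n B = 2 + (suc (suc B) * (3 + time fill) + 8)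
rows-time n B = 9 + (suc (suc n) * (3 + row-time n B) + 4)
table-time n B = 2 + suc (suc n) * (3 + rows-time n B)

-- Correctness of the dynamic programme

module Table (f q : ℕ → ℕ) (n B : ℕ) where
  open Measure {f} q

  S S₂ : ℕ
  S  = suc B
  S₂ = suc n * S

  offset : ℕ → ℕ → ℕ → ℕ
  offset j c x = (j * suc n + c) * S + x

  At : ∀ {j} → ℕ → ℕ → Choice f j → Set
  At c x T = count T ≡ c × weight T ≡ x

  Cell : (val tag nxt : ℕ → ℕ) (a j c x : ℕ) → Set
  Cell val tag nxt a j c x = Min {Choice f j} (At c x) (Encodes tag nxt a) extra (val a)

  Cells : (val tag nxt : ℕ → ℕ) (base w : ℕ) → Set
  Cells val tag nxt base w = ∀ j c x → c ≤ n → x ≤ B → base + offset j c x < w → Cell val tag nxt (base + offset j c x) j c x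

  -- An address is a number in mixed radix whose lower digits are bounded. Hence a freshly written
  -- cell answers for one triple only, and `cells-extend` has nothing else to establish.
  offset-injective : ∀ {j c x j′ c′ x′} → c ≤ n → x ≤ B → c′ ≤ n → x′ ≤ B →
    offset j c x ≡ offset j′ c′ x′ → j ≡ j′ × c ≡ c′ × x ≡ x′
  offset-injective {j} {c} {x} {j′} {c′} {x′} c≤ x≤ c′≤ x′≤ eq
    with quotient-unique S {j * suc n + c} {j′ * suc n + c′} (s≤s x≤) (s≤s x′≤) eq
  ... | eq₂ with quotient-unique (suc n) {j} {j′} (s≤s c≤) (s≤s c′≤) eq₂
  ...   | refl with +-cancelˡ-≡ (j * suc n) c c′ eq₂
  ...     | refl = refl , refl , +-cancelˡ-≡ ((j * suc n + c) * S) x x′ eq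

  AgreeBelow : ℕ → State → State → Set
  AgreeBelow w s s′ = ∀ a → a < w → arr s′ 7 a ≡ arr s 7 a × arr s′ 8 a ≡ arr s 8 a × arr s′ 9 a ≡ arr s 9 a

  cell-frame : ∀ {s s′ w a j c x} → AgreeBelow w s s′ → a < w →
    Cell (arr s 7) (arr s 8) (arr s 9) a j c x → Cell (arr s′ 7) (arr s′ 8) (arr s′ 9) a j c x
  cell-frame {s} {s′} {a = a} agree a<w cell rewrite proj₁ (agree a a<w) = min-map (λ _ → id) (λ _ → id)
    (λ T _ → encodes-frame a T (λ b b≤a → proj₂ (agree b (≤-<-trans b≤a a<w)))) cell

  cells-extend : ∀ {s s′ base j c x} → c ≤ n → x ≤ B → AgreeBelow (base + offset j c x) s s′ →
    Cells (arr s 7) (arr s 8) (arr s 9) base (base + offset j c x) →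
    Cell (arr s′ 7) (arr s′ 8) (arr s′ 9) (base + offset j c x) j c x →
    Cells (arr s′ 7) (arr s′ 8) (arr s′ 9) base (suc (base + offset j c x))
  cells-extend {s} {s′} {base} {j} {c} {x} c≤n x≤B agree cells new j′ c′ x′ c′≤n x′≤B a<sw
    with m<1+n⇒m<n∨m≡n a<sw
  ... | inj₁ a<w = cell-frame {s} {s′} agree a<w (cells j′ c′ x′ c′≤n x′≤B a<w)
  ... | inj₂ eq with offset-injective {j′} {c′} {x′} {j} {c} {x} c′≤n x′≤B c≤n x≤B (+-cancelˡ-≡ base _ _ eq)
  ...   | refl , refl , refl = new

  -- Stated for values instead of a state, so that after an assignment to another register the type
  -- reduces to the same one and the old proof is reused as it is.
  record Setup (r0 r7 r8 r9 : ℕ) (a5 a6 : ℕ → ℕ) : Set where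
    constructor setup
    field
      r0≡ : r0 ≡ n
      r7≡ : r7 ≡ B
      r8≡ : r8 ≡ S
      r9≡ : r9 ≡ S₂
      a5≡ : ∀ i → i < n → a5 i ≡ q i
      a6≡ : ∀ i → i < n → a6 i ≡ f i

  SetUp : State → Set
  SetUp s = Setup (reg s 0) (reg s 7) (reg s 8) (reg s 9) (arr s 5) (arr s 6)

  Kept : State → State → Set
  Kept = Same (0 ∷ 1 ∷ 7 ∷ 8 ∷ 9 ∷ []) (0 ∷ 1 ∷ 4 ∷ 5 ∷ 6 ∷ [])

  module _ (s₀ : State) (base : ℕ) where

    -- The pointer `v` and the bound `w` of the correct cells are separate arguments because they
    -- differ by one between writing a cell and advancing the pointer, as in `Filled`.
    Written : ℕ → ℕ → State → Set
    Written v w s = SetUp s × Kept s₀ s × reg s 10 ≡ v × AgreeBelow base s₀ s × Cells (arr s 7) (arr s 8) (arr s 9) base w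

    -- Block j decides on item j - 1. For j = 0 the truncated index merely loads the time of item 0,
    -- which does not enter the initial cells.
    InRow : ℕ → ℕ → State → Set
    InRow j c s = reg s 11 ≡ j × reg s 12 ≡ c × reg s 15 ≡ arr s 5 (j ∸ 1) × reg s 13 ≡ c * arr s 5 (j ∸ 1)

    FillInv : ℕ → ℕ → ℕ → State → Set
    FillInv j c x s = Written (base + offset j c x) (base + offset j c x) s × InRow j c s × reg s 14 ≡ x

    Filled : ℕ → ℕ → ℕ → State → Set
    Filled j c x s = Written (base + offset j c x) (suc (base + offset j c x)) s × InRow j c s × reg s 14 ≡ x

    RowInv : ℕ → ℕ → State → Set
    RowInv j c s = Written (base + offset j c 0) (base + offset j c 0) s × InRow j c s

    TableInv : ℕ → State → Set
    TableInv j s = Written (base + offset j 0 0) (base + offset j 0 0) s × reg s 11 ≡ j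

    Out In : ∀ {j} → ℕ → ℕ → Choice f j → Set
    Out c x none          = ⊥
    Out c x (inside T)    = ⊥
    Out c x (outside _ T) = At c x T
    In c x none           = ⊥
    In c x (inside {j} T) = suc (count T) ≡ c × q j + weight T ≡ x
    In c x (outside _ T)  = ⊥

    -- What is known of the encoding before the cell at `w` has been written: the target `u` of the
    -- future link already encodes the rest of the choice.
    Tail : ∀ {j} (tag nxt : ℕ → ℕ) (u w : ℕ) → Choice f j → Set
    Tail tag nxt u w none          = ⊥
    Tail tag nxt u w (inside T)    = u < w × Encodes tag nxt u T
    Tail tag nxt u w (outside _ T) = u < w × Encodes tag nxt u T

    Out⇒At : ∀ {j c x} (T : Choice f j) → Out c x T → At c x T
    Out⇒At (outside _ T) at = at

    In⇒At : ∀ {j c x} (T : Choice f j) → In c x T → At c x T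
    In⇒At (inside T) at = at

    At⇒Out⊎In : ∀ {j c x} (T : Choice f (suc j)) → At c x T → Out c x T ⊎ In c x T
    At⇒Out⊎In (inside T)    at = inj₂ at
    At⇒Out⊎In (outside _ T) at = inj₁ at

    Option₁ Option₂ : ℕ → ℕ → ℕ → State → Set
    Option₁ j c x s = Min {Choice f (suc j)} (Out c x) (Tail (arr s 8) (arr s 9) (reg s 10 ∸ reg s 9) (reg s 10)) extra (reg s 16)
    Option₂ j c x s = Min {Choice f (suc j)} (In c x) (Tail (arr s 8) (arr s 9) (reg s 18) (reg s 10)) extra (reg s 17)

    up : ∀ j c x → offset (suc j) c x ≡ offset j c x + S₂
    up j c x = lemma j c x n S
      where
      lemma : ∀ j c x n S → (suc j * suc n + c) * S + x ≡ (j * suc n + c) * S + x + suc n * S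
      lemma = solve-∀

    -- Bellman's principle holds since the surcharge of an outside item depends on the count and
    -- weight of the rest only, and both are coordinates of the predecessor cell; an inside item
    -- adds no surcharge. So an optimal predecessor extends to an optimum.
    options-correct : ∀ {j c x s} → j < n → c ≤ n → x ≤ B → FillInv (suc j) c x s →
      Run options s (time options) (λ s′ → FillInv (suc j) c x s′ × Option₁ j c x s′ × Option₂ j c x s′)
    options-correct {j} {c} {x} {s} j<n c≤n x≤B inv = run-seq (run-wp first {λ s′ → FillInv (suc j) c x s′ × Option₁ j c x s′}
      (correct₁ s inv)) (λ s′ (inv′ , opt) → run-wp second (correct₂ s′ inv′ opt))
      where
      first second : Program
      first = 16 ≔ lit 0 ⨟
        IF 6 ![ var 11 ⊖ lit 1 ] ≼ lit 0 THEN
          (IF lit 1 ≼ 7 ![ var 10 ⊖ var 9 ]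
           THEN 16 ≔ 7 ![ var 10 ⊖ var 9 ] ⊕ ((var 13 ⊖ var 14) ⊕ (var 14 ⊖ var 13)) ELSE skip)
        ELSE skip
      second = 17 ≔ lit 0 ⨟ 18 ≔ var 10 ⊖ var 9 ⊖ var 8 ⊖ var 15 ⨟
        IF lit 1 ≼ var 12 THEN (IF var 15 ≼ var 14 THEN 17 ≔ 7 ![ var 18 ] ELSE skip) ELSE skip

      correct₁ : ∀ s → FillInv (suc j) c x s → wp first (λ s′ → FillInv (suc j) c x s′ × Option₁ j c x s′) s
      correct₁ s inv@((su , _ , w≡ , _ , cells) , (j≡ , c≡ , _ , cq≡) , x≡) =
        (λ f≤0 → (λ 1≤v → inv , found (n≤0⇒n≡0 (subst (_≤ 0) flag f≤0)) 1≤v) ,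
                 (λ 1≰v → inv , inj₁ (refl , lost 1≰v))) ,
        (λ f≰0 → inv , inj₁ (refl , forced f≰0))
        where
        open Setup su
        flag : arr s 6 (reg s 11 ∸ 1) ≡ f j
        flag = trans (cong (λ k → arr s 6 (k ∸ 1)) j≡) (a6≡ j j<n)
        a = base + offset j c x
        u≡ : reg s 10 ∸ reg s 9 ≡ a
        u≡ = trans (cong₂ _∸_ (trans w≡ (trans (cong (base +_) (up j c x)) (sym (+-assoc base _ S₂)))) r9≡) (m+n∸n≡m a S₂)
        a<w : a < base + offset (suc j) c x
        a<w = +-monoʳ-< base (subst (offset j c x <_) (sym (up j c x)) (m<m+n _ z<s))
        cell : Cell (arr s 7) (arr s 8) (arr s 9) a j c x
        cell = cells j c x c≤n x≤B a<w
        val≡ : arr s 7 (reg s 10 ∸ reg s 9) ≡ arr s 7 a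
        val≡ = cong (arr s 7) u≡
        diff : ℕ → ℕ → ℕ
        diff a b = (a ∸ b) + (b ∸ a)
        diff≡ : ∀ (T : Choice f j) → At c x T → diff (reg s 13) (reg s 14) ≡ diff (count T * q j) (weight T)
        diff≡ T (refl , refl) = cong₂ diff (trans cq≡ (cong (count T *_) (a5≡ j j<n))) x≡
        found : f j ≡ 0 → 1 ≤ arr s 7 (reg s 10 ∸ reg s 9) →
          Min (Out c x) (Tail (arr s 8) (arr s 9) (reg s 10 ∸ reg s 9) (reg s 10)) extra
            (arr s 7 (reg s 10 ∸ reg s 9) + diff (reg s 13) (reg s 14))
        found f≡0 1≤v with cell
        ... | inj₁ (v≡0 , _) = contradiction (subst (1 ≤_) (trans val≡ v≡0) 1≤v) λ ()
        ... | inj₂ (T , at , enc , v≡ , le) = inj₂ (outside f≡0 T , at ,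
          (subst₂ _<_ (sym u≡) (sym w≡) a<w , subst (λ b → Encodes (arr s 8) (arr s 9) b T) (sym u≡) enc) ,
          cong₂ _+_ (trans val≡ v≡) (diff≡ T at) , least)
          where
          least : ∀ T′ → Out c x T′ → extra (outside f≡0 T) ≤ extra T′
          least (outside _ T′) at′ = +-mono-≤ (le T′ at′) (≤-reflexive (trans (sym (diff≡ T at)) (diff≡ T′ at′)))
        lost : ¬ 1 ≤ arr s 7 (reg s 10 ∸ reg s 9) → (T : Choice f (suc j)) → ¬ Out c x T
        lost 1≰v (outside _ T) at with cell
        ... | inj₁ (_ , empty) = empty T at
        ... | inj₂ (_ , _ , _ , v≡ , _) = 1≰v (subst (1 ≤_) (sym (trans val≡ v≡)) z<s)
        forced : ¬ arr s 6 (reg s 11 ∸ 1) ≤ 0 → (T : Choice f (suc j)) → ¬ Out c x T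
        forced f≰0 (outside f≡0 T) at = f≰0 (≤-reflexive (trans flag f≡0))

      correct₂ : ∀ s → FillInv (suc j) c x s → Option₁ j c x s →
        wp second (λ s′ → FillInv (suc j) c x s′ × Option₁ j c x s′ × Option₂ j c x s′) s
      correct₂ s inv@((su , _ , w≡ , _ , cells) , (j≡ , c≡ , q≡ , cq≡) , x≡) opt₁ =
        (λ 1≤c → (λ q≤x → inv , opt₁ , found (subst (1 ≤_) c≡ 1≤c) (subst₂ _≤_ q≡′ x≡ q≤x)) ,
                 (λ q≰x → inv , opt₁ , inj₁ (refl , λ { (inside T) (_ , eq) →
                   q≰x (subst₂ _≤_ (sym q≡′) (trans eq (sym x≡)) (m≤m+n (q j) _)) }))) ,
        (λ 1≰c → inv , opt₁ , inj₁ (refl , λ { (inside T) (eq , _) → 1≰c (subst (1 ≤_) (trans eq (sym c≡)) z<s) }))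
        where
        open Setup su
        q≡′ : reg s 15 ≡ q j
        q≡′ = trans q≡ (a5≡ j j<n)
        u = reg s 10 ∸ reg s 9 ∸ reg s 8 ∸ reg s 15
        Goal : ℕ → ℕ → Set
        Goal c x = Min {Choice f (suc j)} (In c x) (Tail (arr s 8) (arr s 9) u (reg s 10)) extra (arr s 7 u)
        -- Generalised over `c` and `x` so that they can be matched with `suc c` and `q j + x′`.
        found′ : ∀ c x → c ≤ n → x ≤ B → reg s 10 ≡ base + offset (suc j) c x →
          Cells (arr s 7) (arr s 8) (arr s 9) base (base + offset (suc j) c x) → 1 ≤ c → q j ≤ x → Goal c x
        found′ (suc c) x c<n x≤B w≡ cells _ q≤x with m≤n⇒∃[o]m+o≡n q≤x
        ... | x′ , refl = result
          where
          a = base + offset j c x′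
          split : offset (suc j) (suc c) (q j + x′) ≡ offset j c x′ + q j + S + S₂
          split = lemma j c (q j) x′ n S
            where
            lemma : ∀ j c q x n S → (suc j * suc n + suc c) * S + (q + x) ≡ (j * suc n + c) * S + x + q + S + suc n * S
            lemma = solve-∀
          u≡ : u ≡ a
          u≡ = begin
            reg s 10 ∸ reg s 9 ∸ reg s 8 ∸ reg s 15
              ≡⟨ cong₂ _∸_ (cong₂ _∸_ (cong₂ _∸_ (trans w≡ (trans (cong (base +_) split) (lemma base (offset j c x′) (q j) S S₂))) r9≡) r8≡) q≡′ ⟩
            a + q j + S + S₂ ∸ S₂ ∸ S ∸ q j  ≡⟨ cong (λ b → b ∸ S ∸ q j) (m+n∸n≡m (a + q j + S) S₂) ⟩
            a + q j + S ∸ S ∸ q j            ≡⟨ cong (_∸ q j) (m+n∸n≡m (a + q j) S) ⟩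
            a + q j ∸ q j                    ≡⟨ m+n∸n≡m a (q j) ⟩
            a                                ∎
            where
            open ≡-Reasoning
            lemma : ∀ b o q s t → b + (o + q + s + t) ≡ b + o + q + s + t
            lemma = solve-∀
          a<w : a < base + offset (suc j) (suc c) (q j + x′)
          a<w = +-monoʳ-< base (subst (offset j c x′ <_) (sym split)
            (≤-<-trans (≤-trans (m≤m+n (offset j c x′) (q j)) (m≤m+n _ S)) (m<m+n _ z<s)))
          cell : Cell (arr s 7) (arr s 8) (arr s 9) a j c x′
          cell = cells j c x′ (<⇒≤ c<n) (≤-trans (m≤n+m x′ (q j)) x≤B) a<w
          result : Goal (suc c) (q j + x′)
          result with cell
          ... | inj₁ (v≡0 , empty) = inj₁ (trans (cong (arr s 7) u≡) v≡0 ,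
            λ { (inside T) (eq , eq′) → empty T (suc-injective eq , +-cancelˡ-≡ (q j) _ _ eq′) })
          ... | inj₂ (T , (eq , eq′) , enc , v≡ , le) = inj₂ (inside T , (cong suc eq , cong (q j +_) eq′) ,
            (subst₂ _<_ (sym u≡) (sym w≡) a<w , subst (λ b → Encodes (arr s 8) (arr s 9) b T) (sym u≡) enc) ,
            trans (cong (arr s 7) u≡) v≡ ,
            λ { (inside T′) (eq , eq′) → le T′ (suc-injective eq , +-cancelˡ-≡ (q j) _ _ eq′) })
        found : 1 ≤ c → q j ≤ x → Goal c x
        found = found′ c x c≤n x≤B w≡ cells

    choose-correct : ∀ {j c x s} → c ≤ n → x ≤ B → FillInv (suc j) c x s → Option₁ j c x s → Option₂ j c x s →
      Run choose-option s (time choose-option) (Filled (suc j) c x)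
    choose-correct {j} {c} {x} {s} c≤n x≤B inv@((su , kept , w≡ , agree , cells) , inrow , x≡) opt₁ opt₂ =
      run-wp choose-option
        ( (λ 1≤o → (λ 1≤e → (λ o≤e → omit (inj₂ (1≤o , o≤e))) , (λ o≰e → admit (inj₂ (1≤e , ≰⇒≥ o≰e))))
                 , (λ 1≰e → omit (inj₁ (n≤0⇒n≡0 (s≤s⁻¹ (≰⇒> 1≰e))))))
        , (λ 1≰o → admit (inj₁ (n≤0⇒n≡0 (s≤s⁻¹ (≰⇒> 1≰o))))))
      where
      a = base + offset (suc j) c x
      w = reg s 10
      write : ℕ → ℕ → ℕ → State
      write v t u = setArr (setArr (setArr s 7 w v) 8 w t) 9 w u
      agree-write : ∀ {v t u} → AgreeBelow a s (write v t u)
      agree-write b b<a = update-≢ (arr s 7) w≢b , update-≢ (arr s 8) w≢b , update-≢ (arr s 9) w≢b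
        where
        w≢b : w ≢ b
        w≢b w≡b = <⇒≢ b<a (trans (sym w≡b) w≡)
      finish : ∀ {v t u} → Min {Choice f (suc j)} (At c x) (Encodes (arr s 8 [ w ↦ t ]) (arr s 9 [ w ↦ u ]) a) extra v →
        Filled (suc j) c x (write v t u)
      finish {v} {t} {u} m = (su , kept , w≡ ,
        (λ b b<base → let b<a = <-≤-trans b<base (m≤m+n base _)
                          e₁ , e₂ , e₃ = agree b b<base ; f₁ , f₂ , f₃ = agree-write {v} {t} {u} b b<a
                      in trans f₁ e₁ , trans f₂ e₂ , trans f₃ e₃) ,
        cells-extend {s} {write v t u} {base} c≤n x≤B (agree-write {v} {t} {u}) cells
          (subst (Min (At c x) (Encodes (arr s 8 [ w ↦ t ]) (arr s 9 [ w ↦ u ]) a) extra) (sym (update-at (arr s 7) w≡)) m)) ,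
        inrow , x≡
      link : ∀ {v t u i} {T : Choice f i} → u < w → Encodes (arr s 8) (arr s 9) u T →
        (arr s 9 [ w ↦ u ]) a < a × Encodes (arr s 8 [ w ↦ t ]) (arr s 9 [ w ↦ u ]) ((arr s 9 [ w ↦ u ]) a) T
      link {v} {t} {u} {T = T} u<w enc rewrite update-at (arr s 9) {v = u} w≡ = u<a ,
        encodes-frame u T (λ b b≤u → proj₂ (agree-write {v} {t} {u} b (≤-<-trans b≤u u<a))) enc
        where
        u<a : u < a
        u<a = subst (u <_) w≡ u<w
      omit : reg s 16 ⊑ reg s 17 → Filled (suc j) c x (write (reg s 16) 0 (reg s 10 ∸ reg s 9))
      omit o⊑e = finish (min-left o⊑e
        (min-map {D = Out c x} (λ _ at → at) (λ _ at → at)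
          (λ { (outside _ T) _ (u<w , enc) → update-at (arr s 8) w≡ , link {0} {T = T} u<w enc }) opt₁)
        opt₂ At⇒Out⊎In Out⇒At)
      admit : reg s 17 ⊑ reg s 16 → Filled (suc j) c x (write (reg s 17) 1 (reg s 18))
      admit e⊑o = finish (min-right e⊑o opt₁
        (min-map {D = In c x} (λ _ at → at) (λ _ at → at)
          (λ { (inside T) _ (u<w , enc) → update-at (arr s 8) w≡ , link {0} {T = T} u<w enc }) opt₂)
        At⇒Out⊎In In⇒At)

    fill-correct : ∀ {j c x s} → j ≤ n → c ≤ n → x ≤ B → FillInv j c x s → Run fill s (time fill) (FillInv j c (suc x))
    fill-correct {j} {c} {x} {s} j≤n c≤n x≤B inv = run-seq {P = Filled j c x} (write j j≤n inv) advance
      where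
      advance : ∀ s′ → Filled j c x s′ → Run (10 ≔ var 10 ⊕ lit 1 ⨟ 14 ≔ var 14 ⊕ lit 1) s′ (time (10 ≔ var 10 ⊕ lit 1 ⨟ 14 ≔ var 14 ⊕ lit 1)) (FillInv j c (suc x))
      advance s′ ((su , kept , w≡ , agree , cells) , inrow , x≡) = run-wp (10 ≔ var 10 ⊕ lit 1 ⨟ 14 ≔ var 14 ⊕ lit 1)
        ((su , kept , trans (next (reg s′ 10) w≡) w′≡ , agree ,
          subst (Cells (arr s′ 7) (arr s′ 8) (arr s′ 9) base) w′≡ cells) , inrow , next (reg s′ 14) x≡)
        where
        w′≡ : suc (base + offset j c x) ≡ base + offset j c (suc x)
        w′≡ = trans (sym (+-suc base _)) (cong (base +_) (sym (+-suc _ x)))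
      write : ∀ j → j ≤ n → FillInv j c x s → Run fill-cell s (time fill-cell) (Filled j c x)
      write (suc j) j<n inv@(_ , (j≡ , _) , _) = run-if
        {c = initial} {t = time initial}
        (λ j≤0 → contradiction (subst (_≤ 0) j≡ j≤0) λ ())
        (λ _ → run-seq (options-correct j<n c≤n x≤B inv) λ _ (inv′ , opt₁ , opt₂) → choose-correct c≤n x≤B inv′ opt₁ opt₂)
      write zero _ inv@((su , kept , w≡ , agree , cells) , inrow@(j≡ , c≡ , _) , x≡) = run-if
        {d = options ⨟ choose-option} {u = time (options ⨟ choose-option)}
        (λ _ → run-wp initial
          ( (λ c+x≤0 → finish 1 (inj₂ (none ,
              ( sym (trans (sym c≡) (m+n≡0⇒m≡0 (reg s 12) (n≤0⇒n≡0 c+x≤0)))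
              , sym (trans (sym x≡) (m+n≡0⇒n≡0 (reg s 12) (n≤0⇒n≡0 c+x≤0)))) , tt , refl , λ _ _ → z≤n)))
          , (λ c+x≰0 → finish 0 (inj₁ (refl , λ { none (c≡0 , x≡0) →
              c+x≰0 (≤-reflexive (cong₂ _+_ (trans c≡ (sym c≡0)) (trans x≡ (sym x≡0)))) })))))
        (λ j≰0 → contradiction (≤-reflexive j≡) j≰0)
        where
        a = base + offset 0 c x
        w = reg s 10
        finish : ∀ v → Min {Choice f 0} (At c x) (λ _ → ⊤) extra v → Filled 0 c x (setArr s 7 w v)
        finish v m = (su , kept , w≡ ,
          (λ b b<base → let e₁ , e₂ , e₃ = agree b b<base
                        in trans (update-≢ (arr s 7) (w≢ (<-≤-trans b<base (m≤m+n base _)))) e₁ , e₂ , e₃) ,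
          cells-extend {s} {setArr s 7 w v} {base} c≤n x≤B (λ b b<a → update-≢ (arr s 7) (w≢ b<a) , refl , refl) cells
            (subst (Min (At c x) (Encodes (arr s 8) (arr s 9) a) extra) (sym (update-at (arr s 7) w≡))
              (min-map (λ _ at → at) (λ _ at → at) (λ { none _ _ → tt }) m))) , inrow , x≡
          where
          w≢ : ∀ {b} → b < a → w ≢ b
          w≢ b<a w≡b = <⇒≢ b<a (trans (sym w≡b) w≡)

    row-correct : ∀ {j c s} → j ≤ n → c ≤ n → RowInv j c s → Run row s (row-time n B) (RowInv j (suc c))
    row-correct {j} {c} {s} j≤n c≤n (written , inrow) =
      run-seq (run-wp (14 ≔ lit 0) {FillInv j c 0} (written , inrow , refl)) λ s₁ inv₁ →
      run-seq (run-while {var 14 ≼ var 7} S (time fill) (FillInv j c) step stop inv₁) λ s₂ → λ where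
        ((su , kept , w≡ , agree , cells) , (j≡ , c≡ , q≡ , cq≡) , x≡) →
          run-wp (12 ≔ var 12 ⊕ lit 1 ⨟ 13 ≔ var 13 ⊕ var 15) {RowInv j (suc c)}
            ((su , kept , trans w≡ w′≡ , agree , subst (Cells (arr s₂ 7) (arr s₂ 8) (arr s₂ 9) base) w′≡ cells) ,
             (j≡ , next (reg s₂ 12) c≡ , q≡ , trans (cong₂ _+_ cq≡ q≡) (+-comm (c * _) _)))
      where
      w′≡ : base + offset j c S ≡ base + offset j (suc c) 0
      w′≡ = cong (base +_) (lemma j c n S)
        where
        lemma : ∀ j c n S → (j * suc n + c) * S + S ≡ (j * suc n + suc c) * S + 0
        lemma = solve-∀
      step : ∀ x s → x < S → FillInv j c x s → reg s 14 ≤ reg s 7 × Run fill s (time fill) (FillInv j c (suc x))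
      step x s x<S inv@((su , _) , _ , x≡) =
        subst₂ _≤_ (sym x≡) (sym (Setup.r7≡ su)) (s≤s⁻¹ x<S) , fill-correct j≤n c≤n (s≤s⁻¹ x<S) inv
      stop : ∀ s → FillInv j c S s → ¬ reg s 14 ≤ reg s 7
      stop s ((su , _) , _ , x≡) le = 1+n≰n (subst₂ _≤_ x≡ (Setup.r7≡ su) le)

    table-loop : ∀ {s} → TableInv 0 s → Run (WHILE var 11 ≼ var 0 DO rows) s (suc (suc n) * (3 + rows-time n B)) (TableInv (suc n))
    table-loop = run-while {var 11 ≼ var 0} (suc n) (rows-time n B) TableInv step stop
      where
      step : ∀ j s → j < suc n → TableInv j s → reg s 11 ≤ reg s 0 × Run rows s (rows-time n B) (TableInv (suc j))
      step j s j<sn (written@(su , _) , j≡) = subst₂ _≤_ (sym j≡) (sym (Setup.r0≡ su)) (s≤s⁻¹ j<sn) ,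
        run-seq (run-wp (12 ≔ lit 0 ⨟ 13 ≔ lit 0 ⨟ 15 ≔ 5 ![ var 11 ⊖ lit 1 ]) {RowInv j 0}
          (written , j≡ , refl , cong (λ k → arr s 5 (k ∸ 1)) j≡ , refl)) λ s₁ inv₁ →
        run-seq (run-while {var 12 ≼ var 0} (suc n) (row-time n B) (RowInv j) step′ stop′ inv₁) λ s₂ → λ where
          ((su , kept , w≡ , agree , cells) , (j≡ , _)) →
            run-wp (11 ≔ var 11 ⊕ lit 1) {TableInv (suc j)}
              ((su , kept , trans w≡ w′≡ , agree , subst (Cells (arr s₂ 7) (arr s₂ 8) (arr s₂ 9) base) w′≡ cells) ,
               next (reg s₂ 11) j≡)
        where
        w′≡ : base + offset j (suc n) 0 ≡ base + offset (suc j) 0 0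
        w′≡ = cong (base +_) (lemma j n S)
          where
          lemma : ∀ j n S → (j * suc n + suc n) * S + 0 ≡ (suc j * suc n + 0) * S + 0
          lemma = solve-∀
        step′ : ∀ c s → c < suc n → RowInv j c s → reg s 12 ≤ reg s 0 × Run row s (row-time n B) (RowInv j (suc c))
        step′ c s c<sn inv@((su , _) , (_ , c≡ , _)) =
          subst₂ _≤_ (sym c≡) (sym (Setup.r0≡ su)) (s≤s⁻¹ c<sn) , row-correct (s≤s⁻¹ j<sn) (s≤s⁻¹ c<sn) inv
        stop′ : ∀ s → RowInv j (suc n) s → ¬ reg s 12 ≤ reg s 0
        stop′ s ((su , _) , (_ , c≡ , _)) le = 1+n≰n (subst₂ _≤_ c≡ (Setup.r0≡ su) le)
      stop : ∀ s → TableInv (suc n) s → ¬ reg s 11 ≤ reg s 0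
      stop s ((su , _) , j≡) le = 1+n≰n (subst₂ _≤_ j≡ (Setup.r0≡ su) le)

  -- The base is whatever register 10 holds on entry: the same program builds the low table at
  -- address 0 and the high table right behind it.
  table-correct : ∀ {s} → SetUp s → let base = reg s 10 in
    Run table s (table-time n B) (λ s′ → Written s base (base + suc n * S₂) (base + suc n * S₂) s′)
  table-correct {s} su = run-seq (run-wp (11 ≔ lit 0) {TableInv s (reg s 10) 0} (init , refl)) λ _ inv →
    run-map (λ { s′ (written , _) → subst (λ w → Written s (reg s 10) w w s′) (cong (reg s 10 +_) (lemma n S)) written })
      (table-loop s (reg s 10) inv)
    where
    lemma : ∀ n S → (suc n * suc n + 0) * S + 0 ≡ suc n * (suc n * S)
    lemma = solve-∀
    init : Written s (reg s 10) (reg s 10 + 0) (reg s 10 + 0) s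
    init = su , (refl , refl , refl , refl , refl , refl , refl , refl , refl , refl , tt) , sym (+-identityʳ _) ,
      (λ _ _ → refl , refl , refl) , λ j c x _ _ lt → contradiction (+-cancelˡ-< (reg s 10) _ _ lt) λ ()

-- Combining a low and a high choice

-- Only the high part is looked up at an exact weight, B - y. Register 19 is a running minimum over
-- all low choices of weight at most y, never reset while y grows; this avoids a search over pairs
-- of weights, as well as over pairs of counts.
low-step high-step scan-step scan-row scan : Program
low-step =
  (IF lit 1 ≼ 7 ![ var 29 ] THEN
     (IF lit 1 ≼ var 19 THEN (IF var 19 ≼ 7 ![ var 29 ] THEN skip ELSE update) ELSE update)
   ELSE skip) ⨟
  (29 ≔ var 29 ⊕ var 8 ⨟ 12 ≔ var 12 ⊕ lit 1)
  where
  update : Program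
  update = 19 ≔ 7 ![ var 29 ] ⨟ 20 ≔ var 29
high-step =
  (IF lit 1 ≼ 7 ![ var 29 ] THEN
     (IF lit 1 ≼ var 19 THEN
        (IF lit 1 ≼ var 21 THEN (IF var 21 ≼ var 19 ⊕ 7 ![ var 29 ] THEN skip ELSE update) ELSE update)
      ELSE skip)
   ELSE skip) ⨟
  (29 ≔ var 29 ⊕ var 8 ⨟ 12 ≔ var 12 ⊕ lit 1)
  where
  update : Program
  update = 21 ≔ var 19 ⊕ 7 ![ var 29 ] ⨟ 22 ≔ var 20 ⨟ 23 ≔ var 29 ⨟ 24 ≔ var 25
scan-step =
  (12 ≔ lit 0 ⨟ 29 ≔ var 27 ⊕ var 26) ⨟
  (WHILE var 12 ≼ var 0 DO low-step) ⨟
  (12 ≔ lit 0 ⨟ 29 ≔ var 28 ⊕ (var 7 ⊖ var 26)) ⨟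
  (WHILE var 12 ≼ var 0 DO high-step) ⨟
  26 ≔ var 26 ⊕ lit 1
scan-row =
  (19 ≔ lit 0 ⨟ 26 ≔ lit 0) ⨟
  (WHILE var 26 ≼ var 7 DO scan-step) ⨟
  (27 ≔ var 27 ⊕ var 9 ⨟ 28 ≔ var 28 ⊖ var 9 ⨟ 25 ≔ var 25 ⊕ lit 1)
scan =
  -- Register 10 points behind the high table, so register 28 starts at its last block, with all n
  -- items: the partner of h = 0.
  (21 ≔ lit 0 ⨟ 25 ≔ lit 0 ⨟ 27 ≔ lit 0 ⨟ 28 ≔ var 10 ⊖ var 9) ⨟
  WHILE var 25 ≼ var 0 DO scan-row

scan-step-time scan-row-time scan-time : ℕ → ℕ → ℕ
scan-step-time n B = 6 + (suc (suc n) * (3 + time low-step) + (8 + (suc (suc n) * (3 + time high-step) + 4)))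
scan-row-time n B = 4 + (suc (suc B) * (3 + scan-step-time n B) + 12)
scan-time n B = 10 + suc (suc n) * (3 + scan-row-time n B)

module Scan (n B base : ℕ) (f q f′ q′ : ℕ → ℕ) (A : ℕ → ℕ → ℕ) where
  open Table f q n B using (S; S₂; offset)
  module L = Measure {f} q
  module H = Measure {f′} q′

  LowCells HighCells : Set
  LowCells  = ∀ j c x → j ≤ n → c ≤ n → x ≤ B → Table.Cell f q n B (A 7) (A 8) (A 9) (offset j c x) j c x
  HighCells = ∀ j c x → j ≤ n → c ≤ n → x ≤ B → Table.Cell f′ q′ n B (A 7) (A 8) (A 9) (base + offset j c x) j c x

  Pair : Set
  Pair = ∃[ h ] h ≤ n × Choice f h × Choice f′ (n ∸ h)

  -- The additional successor arises because both summands are encoded values, so that their sum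
  -- exceeds the true cost by two.
  pairCost : Pair → ℕ
  pairCost (_ , _ , T , T′) = suc (L.extra T + H.extra T′)

  Affordable : Pair → Set
  Affordable (_ , _ , T , T′) = L.weight T + H.weight T′ ≤ B

  -- The pairs met before the scan reaches split point h, weight B ∸ y and count c of the second component.
  Before : ℕ → ℕ → ℕ → Pair → Set
  Before h y c (h′ , _ , T , T′) = L.weight T + H.weight T′ ≤ B ×
    (h′ < h ⊎ (h′ ≡ h × (B ∸ H.weight T′ < y ⊎ (B ∸ H.weight T′ ≡ y × count T′ < c))))

  -- Given the weight `B ∸ y` of the high part, the condition on the low weight is just the budget.
  Now : ℕ → ℕ → ℕ → Pair → Set
  Now h y c (h′ , _ , T , T′) = h′ ≡ h × L.weight T ≤ y × count T′ ≡ c × H.weight T′ ≡ B ∸ y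

  LowBefore : ∀ {h} → ℕ → ℕ → Choice f h → Set
  LowBefore y c T = L.weight T < y ⊎ (L.weight T ≡ y × count T < c)

  PairEncodes : (a b h : ℕ) → Pair → Set
  PairEncodes a b h (h′ , _ , T , T′) = h ≡ h′ × Encodes (A 8) (A 9) a T × Encodes (A 8) (A 9) b T′

  LowBest : (h y c v a : ℕ) → Set
  LowBest h y c v a = Min {Choice f h} (LowBefore y c) (Encodes (A 8) (A 9) a) L.extra v

  Best : (h y c v a b k : ℕ) → Set
  Best h y c v a b k = Min (Before h y c) (PairEncodes a b k) pairCost v

  Common : ℕ → State → Set
  Common h s = (arr s ≡ A) × reg s 0 ≡ n × reg s 7 ≡ B × reg s 8 ≡ S × reg s 9 ≡ S₂ ×
    reg s 25 ≡ h × reg s 27 ≡ h * S₂ × reg s 28 ≡ base + n * S₂ ∸ h * S₂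

  LowInv HighInv : ℕ → ℕ → ℕ → State → Set
  LowInv h y c s = Common h s × reg s 26 ≡ y × reg s 12 ≡ c × reg s 29 ≡ offset h c y ×
    LowBest h y c (reg s 19) (reg s 20) × Best h y 0 (reg s 21) (reg s 22) (reg s 23) (reg s 24)
  HighInv h y c s = Common h s × reg s 26 ≡ y × reg s 12 ≡ c × reg s 29 ≡ base + offset (n ∸ h) c (B ∸ y) ×
    LowBest h (suc y) 0 (reg s 19) (reg s 20) × Best h y c (reg s 21) (reg s 22) (reg s 23) (reg s 24)

  StepInv : ℕ → ℕ → State → Set
  StepInv h y s = Common h s × reg s 26 ≡ y ×
    LowBest h y 0 (reg s 19) (reg s 20) × Best h y 0 (reg s 21) (reg s 22) (reg s 23) (reg s 24)

  RowInv : ℕ → State → Set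
  RowInv h s = Common h s × Best h 0 0 (reg s 21) (reg s 22) (reg s 23) (reg s 24)

  offset-next : ∀ j c x → offset j c x + S ≡ offset j (suc c) x
  offset-next j c x = lemma j c x n S
    where
    lemma : ∀ j c x n S → (j * suc n + c) * S + x + S ≡ (j * suc n + suc c) * S + x
    lemma = solve-∀

  positive? : ∀ {k} → ¬ 1 ≤ k → k ≡ 0
  positive? 1≰k = n≤0⇒n≡0 (s≤s⁻¹ (≰⇒> 1≰k))

  low-step-correct : LowCells → ∀ {h y c s} → h ≤ n → c ≤ n → y ≤ B → LowInv h y c s →
    Run low-step s (time low-step) (LowInv h y (suc c))
  low-step-correct cells {h} {y} {c} {s} h≤n c≤n y≤B (com@(arr≡ , _ , _ , r8 , _) , y≡ , c≡ , a≡ , low , best) =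
    run-wp low-step
      ( (λ 1≤v → (λ 1≤l → (λ l≤v → stay (inj₂ (1≤l , subst (reg s 19 ≤_) v≡ l≤v))) ,
                          (λ l≰v → move (inj₂ (subst (1 ≤_) v≡ 1≤v , subst (_≤ reg s 19) v≡ (≰⇒≥ l≰v))))) ,
                 (λ 1≰l → move (inj₁ (positive? 1≰l)))) ,
        (λ 1≰v → stay (inj₁ (trans (sym v≡) (positive? 1≰v)))) )
    where
    a = offset h c y
    v≡ : arr s 7 (reg s 29) ≡ A 7 a
    v≡ = cong₂ (λ F → F 7) arr≡ a≡
    a′≡ : reg s 29 + reg s 8 ≡ offset h (suc c) y
    a′≡ = trans (cong₂ _+_ a≡ r8) (offset-next h c y)
    split : ∀ (T : Choice f h) → LowBefore y (suc c) T → LowBefore y c T ⊎ Table.At f q n B c y T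
    split T (inj₁ w<y) = inj₁ (inj₁ w<y)
    split T (inj₂ (w≡y , c<)) with m<1+n⇒m<n∨m≡n c<
    ... | inj₁ c< = inj₁ (inj₂ (w≡y , c<))
    ... | inj₂ c≡ = inj₂ (c≡ , w≡y)
    old : ∀ (T : Choice f h) → LowBefore y c T → LowBefore y (suc c) T
    old T (inj₁ w<y) = inj₁ w<y
    old T (inj₂ (w≡y , c<)) = inj₂ (w≡y , m<n⇒m<1+n c<)
    stay : reg s 19 ⊑ A 7 a → LowInv h y (suc c) (setReg (setReg s 29 (reg s 29 + reg s 8)) 12 (reg s 12 + 1))
    stay l⊑v = com , y≡ , next (reg s 12) c≡ , a′≡ , min-left l⊑v low (cells h c y h≤n c≤n y≤B) split old , best
    move : A 7 a ⊑ reg s 19 → LowInv h y (suc c)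
      (setReg (setReg (setReg (setReg s 19 (arr s 7 (reg s 29))) 20 (reg s 29)) 29 (reg s 29 + reg s 8)) 12 (reg s 12 + 1))
    move v⊑l = com , y≡ , next (reg s 12) c≡ , a′≡ ,
      subst₂ (LowBest h y (suc c)) (sym v≡) (sym a≡)
        (min-right v⊑l low (cells h c y h≤n c≤n y≤B) split (λ { T (refl , w≡) → inj₂ (w≡ , ≤-refl) })) ,
      best

  combine : ∀ {h y c v u a b} → h ≤ n → 1 ≤ v → 1 ≤ u → LowBest h (suc y) 0 v a →
    Min {Choice f′ (n ∸ h)} (Table.At f′ q′ n B c (B ∸ y)) (Encodes (A 8) (A 9) b) H.extra u →
    Min (Now h y c) (PairEncodes a b h) pairCost (v + u)
  combine h≤n 1≤v 1≤u (inj₁ (refl , _)) _ = contradiction 1≤v λ ()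
  combine h≤n 1≤v 1≤u (inj₂ _) (inj₁ (refl , _)) = contradiction 1≤u λ ()
  combine {h} {y} {c} {a = a} {b} h≤n _ _ (inj₂ (T , T∈ , enc , refl , le)) (inj₂ (T′ , (c≡ , w≡) , enc′ , refl , le′)) =
    inj₂ ((h , h≤n , T , T′) , (refl , low {T} T∈ , c≡ , w≡) , (refl , enc , enc′) , +-suc (suc (L.extra T)) _ , least)
    where
    low : ∀ {T : Choice f h} → LowBefore (suc y) 0 T → L.weight T ≤ y
    low (inj₁ w<) = s≤s⁻¹ w<
    least : ∀ p → Now h y c p → suc (L.extra T + H.extra T′) ≤ pairCost p
    least (_ , _ , U , U′) (refl , w≤y , c≡ , w≡) = s≤s (+-mono-≤ (le U (inj₁ (s≤s w≤y))) (le′ U′ (c≡ , w≡)))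

  no-low : ∀ {h y c v a b k} → v ≡ 0 → LowBest h (suc y) 0 v a → Min (Now h y c) (PairEncodes a b k) pairCost 0
  no-low _    (inj₁ (_ , empty)) = inj₁ (refl , λ { (_ , _ , T , _) (refl , w≤y , _) → empty T (inj₁ (s≤s w≤y)) })
  no-low refl (inj₂ (_ , _ , _ , () , _))

  no-high : ∀ {h y c u a b k} → u ≡ 0 →
    Min {Choice f′ (n ∸ h)} (Table.At f′ q′ n B c (B ∸ y)) (Encodes (A 8) (A 9) b) H.extra u →
    Min (Now h y c) (PairEncodes a b k) pairCost 0
  no-high _    (inj₁ (_ , empty)) = inj₁ (refl , λ { (_ , _ , _ , T′) (refl , _ , at) → empty T′ at })
  no-high refl (inj₂ (_ , _ , _ , () , _))

  high-step-correct : HighCells → ∀ {h y c s} → h ≤ n → c ≤ n → y ≤ B → HighInv h y c s →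
    Run high-step s (time high-step) (HighInv h y (suc c))
  high-step-correct cells {h} {y} {c} {s} h≤n c≤n y≤B
    (com@(arr≡ , _ , _ , r8 , _ , h≡ , _) , y≡ , c≡ , a≡ , low , best) =
    run-wp high-step
      ( (λ 1≤u → (λ 1≤l → (λ 1≤g → (λ g≤t → stay (inj₂ (1≤g , subst (λ u → reg s 21 ≤ reg s 19 + u) u≡ g≤t)) (both 1≤l 1≤u)) ,
                                   (λ g≰t → move (inj₂ (m≤n⇒m≤n+o _ 1≤l , subst (λ u → reg s 19 + u ≤ reg s 21) u≡ (≰⇒≥ g≰t))) (both 1≤l 1≤u))) ,
                          (λ 1≰g → move (inj₁ (positive? 1≰g)) (both 1≤l 1≤u))) ,
                 (λ 1≰l → stay (inj₁ refl) (no-low {b = reg s 23} {reg s 24} (positive? 1≰l) low))) ,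
        (λ 1≰u → stay (inj₁ refl) (no-high {a = reg s 22} {k = reg s 24} (trans (sym u≡) (positive? 1≰u)) cell)) )
    where
    a = base + offset (n ∸ h) c (B ∸ y)
    cell = cells (n ∸ h) c (B ∸ y) (m∸n≤m n h) c≤n (m∸n≤m B y)
    u≡ : arr s 7 (reg s 29) ≡ A 7 a
    u≡ = cong₂ (λ F → F 7) arr≡ a≡
    a′≡ : reg s 29 + reg s 8 ≡ base + offset (n ∸ h) (suc c) (B ∸ y)
    a′≡ = trans (cong₂ _+_ a≡ r8) (trans (+-assoc base _ S) (cong (base +_) (offset-next (n ∸ h) c (B ∸ y))))
    both : 1 ≤ reg s 19 → 1 ≤ arr s 7 (reg s 29) → Min (Now h y c) (PairEncodes (reg s 20) a h) pairCost (reg s 19 + A 7 a)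
    both 1≤l 1≤u = combine h≤n 1≤l (subst (1 ≤_) u≡ 1≤u) low cell
    split : ∀ p → Before h y (suc c) p → Before h y c p ⊎ Now h y c p
    split p (≤B , inj₁ h<) = inj₁ (≤B , inj₁ h<)
    split p (≤B , inj₂ (h≡ , inj₁ <y)) = inj₁ (≤B , inj₂ (h≡ , inj₁ <y))
    split (_ , _ , T , T′) (≤B , inj₂ (h≡ , inj₂ (≡y , c<))) with m<1+n⇒m<n∨m≡n c<
    ... | inj₁ c< = inj₁ (≤B , inj₂ (h≡ , inj₂ (≡y , c<)))
    ... | inj₂ c≡ = inj₂ (h≡ , ≤-trans (m+n≤o⇒m≤o∸n _ ≤B) (≤-reflexive ≡y) , c≡ ,
                          trans (sym (m∸[m∸n]≡n (≤-trans (m≤n+m _ (L.weight T)) ≤B))) (cong (B ∸_) ≡y))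
    old : ∀ p → Before h y c p → Before h y (suc c) p
    old p (≤B , inj₁ h<) = ≤B , inj₁ h<
    old p (≤B , inj₂ (h≡ , inj₁ <y)) = ≤B , inj₂ (h≡ , inj₁ <y)
    old p (≤B , inj₂ (h≡ , inj₂ (≡y , c<))) = ≤B , inj₂ (h≡ , inj₂ (≡y , m<n⇒m<1+n c<))
    new : ∀ p → Now h y c p → Before h y (suc c) p
    new (_ , _ , T , T′) (refl , w≤y , refl , w≡) =
      ≤-trans (+-mono-≤ w≤y (≤-reflexive w≡)) (≤-reflexive (m+[n∸m]≡n y≤B)) ,
      inj₂ (refl , inj₂ (trans (cong (B ∸_) w≡) (m∸[m∸n]≡n y≤B) , ≤-refl))
    stay : ∀ {u G} → reg s 21 ⊑ u → Min (Now h y c) G pairCost u →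
      HighInv h y (suc c) (setReg (setReg s 29 (reg s 29 + reg s 8)) 12 (reg s 12 + 1))
    stay g⊑t m = com , y≡ , next (reg s 12) c≡ , a′≡ , low , min-left g⊑t best m split old
    move : (reg s 19 + A 7 a) ⊑ reg s 21 → Min (Now h y c) (PairEncodes (reg s 20) a h) pairCost (reg s 19 + A 7 a) →
      HighInv h y (suc c) (setReg (setReg (setReg (setReg (setReg (setReg s 21 (reg s 19 + arr s 7 (reg s 29)))
        22 (reg s 20)) 23 (reg s 29)) 24 (reg s 25)) 29 (reg s 29 + reg s 8)) 12 (reg s 12 + 1))
    move t⊑g m = com , y≡ , next (reg s 12) c≡ , a′≡ , low , result
      where
      result : Best h y (suc c) (reg s 19 + arr s 7 (reg s 29)) (reg s 20) (reg s 29) (reg s 25)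
      result rewrite u≡ | a≡ | h≡ = min-right t⊑g best m split new

  -- A choice among h ≤ n items counts at most n, so the counts 0 to n exhaust weight y.
  -- `best-advance` uses the same fact for the high part.
  low-advance : ∀ {h y v a} → h ≤ n → LowBest h y (suc n) v a → LowBest h (suc y) 0 v a
  low-advance {h} {y} h≤n = min-map to from (λ _ _ e → e)
    where
    to : ∀ (T : Choice f h) → LowBefore y (suc n) T → LowBefore (suc y) 0 T
    to T (inj₁ w<y)       = inj₁ (m<n⇒m<1+n w<y)
    to T (inj₂ (w≡y , _)) = inj₁ (s≤s (≤-reflexive w≡y))
    from : ∀ (T : Choice f h) → LowBefore (suc y) 0 T → LowBefore y (suc n) T
    from T (inj₂ (_ , ()))
    from T (inj₁ w<) with m<1+n⇒m<n∨m≡n w<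
    ... | inj₁ w<y = inj₁ w<y
    ... | inj₂ w≡y = inj₂ (w≡y , s≤s (≤-trans (count≤ T) h≤n))

  best-advance : ∀ {h y v a b k} → Best h y (suc n) v a b k → Best h (suc y) 0 v a b k
  best-advance {h} {y} = min-map to from (λ _ _ e → e)
    where
    to : ∀ p → Before h y (suc n) p → Before h (suc y) 0 p
    to p (≤B , inj₁ h<)                    = ≤B , inj₁ h<
    to p (≤B , inj₂ (h≡ , inj₁ <y))        = ≤B , inj₂ (h≡ , inj₁ (m<n⇒m<1+n <y))
    to p (≤B , inj₂ (h≡ , inj₂ (≡y , _)))  = ≤B , inj₂ (h≡ , inj₁ (s≤s (≤-reflexive ≡y)))
    from : ∀ p → Before h (suc y) 0 p → Before h y (suc n) p
    from p (≤B , inj₁ h<) = ≤B , inj₁ h<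
    from p (≤B , inj₂ (h≡ , inj₂ (_ , ())))
    from (h′ , _ , _ , T′) (≤B , inj₂ (h≡ , inj₁ <sy)) with m<1+n⇒m<n∨m≡n <sy
    ... | inj₁ <y = ≤B , inj₂ (h≡ , inj₁ <y)
    ... | inj₂ ≡y = ≤B , inj₂ (h≡ , inj₂ (≡y , s≤s (≤-trans (count≤ T′) (m∸n≤m n h′))))

  row-advance : ∀ {h v a b k} → Best h (suc B) 0 v a b k → Best (suc h) 0 0 v a b k
  row-advance {h} = min-map to from (λ _ _ e → e)
    where
    to : ∀ p → Before h (suc B) 0 p → Before (suc h) 0 0 p
    to p (≤B , inj₁ h<)       = ≤B , inj₁ (m<n⇒m<1+n h<)
    to p (≤B , inj₂ (h≡ , _)) = ≤B , inj₁ (s≤s (≤-reflexive h≡))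
    from : ∀ p → Before (suc h) 0 0 p → Before h (suc B) 0 p
    from _ (≤B , inj₂ (_ , inj₁ ()))
    from _ (≤B , inj₂ (_ , inj₂ (_ , ())))
    from (_ , _ , _ , T′) (≤B , inj₁ h<s) with m<1+n⇒m<n∨m≡n h<s
    ... | inj₁ h< = ≤B , inj₁ h<
    ... | inj₂ h≡ = ≤B , inj₂ (h≡ , inj₁ (s≤s (m∸n≤m B (H.weight T′))))

  module Loops (lows : LowCells) (highs : HighCells) where

    scan-step-correct : ∀ {h y s} → h ≤ n → y ≤ B → StepInv h y s → Run scan-step s (scan-step-time n B) (StepInv h (suc y))
    scan-step-correct {h} {y} {s} h≤n y≤B (com@(arr≡ , r0 , r7 , r8 , r9 , h≡ , rl , rh) , y≡ , low , best) =
      run-seq (run-wp (12 ≔ lit 0 ⨟ 29 ≔ var 27 ⊕ var 26) {LowInv h y 0}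
        (com , y≡ , refl , trans (cong₂ _+_ rl y≡) (start h y) , low , best)) λ s₁ inv₁ →
      run-seq (run-while {var 12 ≼ var 0} (suc n) (time low-step) (LowInv h y) step stop inv₁) λ s₂ → λ where
        (com@(_ , _ , r7 , _ , _ , _ , _ , rh) , y≡ , _ , _ , low , best) →
          run-seq (run-wp (12 ≔ lit 0 ⨟ 29 ≔ var 28 ⊕ (var 7 ⊖ var 26)) {HighInv h y 0}
            (com , y≡ , refl , trans (cong₂ _+_ rh (cong₂ _∸_ r7 y≡)) start′ , low-advance h≤n low , best)) λ s₃ inv₃ →
          run-seq (run-while {var 12 ≼ var 0} (suc n) (time high-step) (HighInv h y) step′ stop′ inv₃) λ s₄ → λ where
            (com , y≡ , _ , _ , low , best) → run-wp (26 ≔ var 26 ⊕ lit 1) {StepInv h (suc y)}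
              (com , next (reg s₄ 26) y≡ , low , best-advance best)
      where
      start : ∀ h y → h * S₂ + y ≡ offset h 0 y
      start h y = lemma h y n S
        where
        lemma : ∀ h y n S → h * (suc n * S) + y ≡ (h * suc n + 0) * S + y
        lemma = solve-∀
      start′ : base + n * S₂ ∸ h * S₂ + (B ∸ y) ≡ base + offset (n ∸ h) 0 (B ∸ y)
      start′ = begin
        base + n * S₂ ∸ h * S₂ + (B ∸ y)    ≡⟨ cong (_+ (B ∸ y)) (+-∸-assoc base (*-monoˡ-≤ S₂ h≤n)) ⟩
        base + (n * S₂ ∸ h * S₂) + (B ∸ y)  ≡⟨ cong (λ k → base + k + (B ∸ y)) (*-distribʳ-∸ S₂ n h) ⟨
        base + (n ∸ h) * S₂ + (B ∸ y)       ≡⟨ +-assoc base _ _ ⟩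
        base + ((n ∸ h) * S₂ + (B ∸ y))     ≡⟨ cong (base +_) (start (n ∸ h) (B ∸ y)) ⟩
        base + offset (n ∸ h) 0 (B ∸ y)     ∎
        where open ≡-Reasoning
      step : ∀ c s → c < suc n → LowInv h y c s → reg s 12 ≤ reg s 0 × Run low-step s (time low-step) (LowInv h y (suc c))
      step c s c<sn inv@((_ , r0 , _) , _ , c≡ , _) =
        subst₂ _≤_ (sym c≡) (sym r0) (s≤s⁻¹ c<sn) , low-step-correct lows h≤n (s≤s⁻¹ c<sn) y≤B inv
      stop : ∀ s → LowInv h y (suc n) s → ¬ reg s 12 ≤ reg s 0
      stop s ((_ , r0 , _) , _ , c≡ , _) le = 1+n≰n (subst₂ _≤_ c≡ r0 le)
      step′ : ∀ c s → c < suc n → HighInv h y c s → reg s 12 ≤ reg s 0 × Run high-step s (time high-step) (HighInv h y (suc c))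
      step′ c s c<sn inv@((_ , r0 , _) , _ , c≡ , _) =
        subst₂ _≤_ (sym c≡) (sym r0) (s≤s⁻¹ c<sn) , high-step-correct highs h≤n (s≤s⁻¹ c<sn) y≤B inv
      stop′ : ∀ s → HighInv h y (suc n) s → ¬ reg s 12 ≤ reg s 0
      stop′ s ((_ , r0 , _) , _ , c≡ , _) le = 1+n≰n (subst₂ _≤_ c≡ r0 le)

    scan-row-correct : ∀ {h s} → h ≤ n → RowInv h s → Run scan-row s (scan-row-time n B) (RowInv (suc h))
    scan-row-correct {h} {s} h≤n (com , best) =
      run-seq (run-wp (19 ≔ lit 0 ⨟ 26 ≔ lit 0) {StepInv h 0}
        (com , refl , inj₁ (refl , λ { T (inj₁ ()) ; T (inj₂ (_ , ())) }) , best)) λ s₁ inv₁ →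
      run-seq (run-while {var 26 ≼ var 7} S (scan-step-time n B) (StepInv h) step stop inv₁) λ s₂ → λ where
        ((arr≡ , r0 , r7 , r8 , r9 , h≡ , rl , rh) , _ , _ , best) →
          run-wp (27 ≔ var 27 ⊕ var 9 ⨟ 28 ≔ var 28 ⊖ var 9 ⨟ 25 ≔ var 25 ⊕ lit 1) {RowInv (suc h)}
            ((arr≡ , r0 , r7 , r8 , r9 , next (reg s₂ 25) h≡ ,
              trans (cong₂ _+_ rl r9) (+-comm (h * S₂) S₂) ,
              trans (cong₂ _∸_ rh r9) (trans (∸-+-assoc (base + n * S₂) (h * S₂) S₂)
                (cong (base + n * S₂ ∸_) (+-comm (h * S₂) S₂)))) ,
             row-advance best)
      where
      step : ∀ y s → y < S → StepInv h y s → reg s 26 ≤ reg s 7 × Run scan-step s (scan-step-time n B) (StepInv h (suc y))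
      step y s y<S inv@((_ , _ , r7 , _) , y≡ , _) =
        subst₂ _≤_ (sym y≡) (sym r7) (s≤s⁻¹ y<S) , scan-step-correct h≤n (s≤s⁻¹ y<S) inv
      stop : ∀ s → StepInv h S s → ¬ reg s 26 ≤ reg s 7
      stop s ((_ , _ , r7 , _) , y≡ , _) le = 1+n≰n (subst₂ _≤_ y≡ r7 le)

    scan-correct : ∀ {s} → arr s ≡ A → reg s 0 ≡ n → reg s 7 ≡ B → reg s 8 ≡ S → reg s 9 ≡ S₂ → reg s 10 ≡ base + suc n * S₂ →
      Run scan s (scan-time n B) (λ s′ → arr s′ ≡ A × reg s′ 0 ≡ n ×
        Min Affordable (PairEncodes (reg s′ 22) (reg s′ 23) (reg s′ 24)) pairCost (reg s′ 21))
    scan-correct {s} arr≡ r0 r7 r8 r9 r10 =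
      run-seq (run-wp (21 ≔ lit 0 ⨟ 25 ≔ lit 0 ⨟ 27 ≔ lit 0 ⨟ 28 ≔ var 10 ⊖ var 9) {RowInv 0}
        ((arr≡ , r0 , r7 , r8 , r9 , refl , refl , trans (cong₂ _∸_ r10 r9)
          (trans (cong (_∸ S₂) (lemma base S₂ (n * S₂))) (m+n∸n≡m (base + n * S₂) S₂))) ,
         inj₁ (refl , λ { _ (_ , inj₁ ()) ; _ (_ , inj₂ (_ , inj₁ ())) ; _ (_ , inj₂ (_ , inj₂ (_ , ()))) }))) λ _ inv →
      run-map finish (run-while {var 25 ≼ var 0} (suc n) (scan-row-time n B) RowInv step stop inv)
      where
      lemma : ∀ b s t → b + (s + t) ≡ b + t + s
      lemma = solve-∀
      step : ∀ h s → h < suc n → RowInv h s → reg s 25 ≤ reg s 0 × Run scan-row s (scan-row-time n B) (RowInv (suc h))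
      step h s h<sn inv@((_ , r0 , _ , _ , _ , h≡ , _) , _) =
        subst₂ _≤_ (sym h≡) (sym r0) (s≤s⁻¹ h<sn) , scan-row-correct (s≤s⁻¹ h<sn) inv
      stop : ∀ s → RowInv (suc n) s → ¬ reg s 25 ≤ reg s 0
      stop s ((_ , r0 , _ , _ , _ , h≡ , _) , _) le = 1+n≰n (subst₂ _≤_ h≡ r0 le)
      finish : ∀ s → RowInv (suc n) s → arr s ≡ A × reg s 0 ≡ n ×
        Min Affordable (PairEncodes (reg s 22) (reg s 23) (reg s 24)) pairCost (reg s 21)
      finish s ((arr≡ , r0 , _) , best) = arr≡ , r0 ,
        min-map (λ _ → proj₁) (λ { (_ , h≤n , _) ≤B → ≤B , inj₁ (s≤s h≤n) }) (λ _ _ e → e) best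

-- Reading off the sequence

run-weaken : ∀ {c s t u} {Q : State → Set} → t ≤ u → Run c s t Q → Run c s u Q
run-weaken t≤u (s′ , v , r , v≤t , q) = s′ , v , r , ≤-trans v≤t t≤u , q

run-then : ∀ {c d s u} {Q : State → Set} → wp c (λ s′ → Run d s′ u Q) s → Run (c ⨟ d) s (time c + u) Q
run-then {c} w = run-seq (run-wp c w) (λ _ r → r)

run-stop : ∀ {b c s t} {Q : State → Set} → ¬ Holds b s → Q s → Run (WHILE b DO c) s (1 * (costᵗ b + t)) Q
run-stop ¬b q = _ , _ , while-stop ¬b , ≤-trans (m≤m+n _ _) (m≤m+n _ 0) , q

run-step : ∀ {b c s m} {Q : State → Set} → Holds b s → wp c (λ s′ → Run (WHILE b DO c) s′ (m * (costᵗ b + time c)) Q) s →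
  Run (WHILE b DO c) s (suc m * (costᵗ b + time c)) Q
run-step {b} {c} b-holds w with run-wp c w
... | s′ , u , r , u≤ , s″ , v , r′ , v≤ , Qs″ = s″ , _ , while-step b-holds r r′ ,
  ≤-trans (+-monoʳ-≤ (costᵗ b) (+-mono-≤ u≤ v≤)) (≤-reflexive (sym (+-assoc (costᵗ b) (time c) _))) , Qs″

-- Each item is labelled by its block: 0 before, 1 during and 2 after the rental period. Tags of low
-- items are these labels already, and those of high items become so on subtraction from 2. Links
-- lead from the split point outwards, downwards in the low part and upwards in the mirrored high
-- part.
label-low label-high labels : Program
label-low = 4 ≔ var 4 ⊖ lit 1 ⨟ 3 ![ var 4 ]≔ 8 ![ var 29 ] ⨟ 29 ≔ 9 ![ var 29 ]
label-high = 3 ![ var 4 ]≔ lit 2 ⊖ 8 ![ var 29 ] ⨟ 29 ≔ 9 ![ var 29 ] ⨟ 4 ≔ var 4 ⊕ lit 1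
labels =
  (4 ≔ var 24 ⨟ 29 ≔ var 22) ⨟
  (WHILE lit 1 ≼ var 4 DO label-low) ⨟
  (4 ≔ var 24 ⨟ 29 ≔ var 23) ⨟
  (WHILE var 4 ⊕ lit 1 ≼ var 0 DO label-high) ⨟
  3 ≔ lit 3

labels-time : ℕ → ℕ
labels-time n = 4 + (suc n * (3 + time label-low) + (4 + (suc n * (5 + time label-high) + 2)))

low-labelled : State → State
low-labelled s = setReg (setArr (setReg s 4 (reg s 4 ∸ 1)) 3 (reg s 4 ∸ 1) (arr s 8 (reg s 29))) 29 (arr s 9 (reg s 29))

high-labelled : State → State
high-labelled s = setReg (setReg (setArr s 3 (reg s 4) (2 ∸ arr s 8 (reg s 29))) 29 (arr s 9 (reg s 29))) 4 (reg s 4 + 1)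

module Labels (n : ℕ) {f f′ : ℕ → ℕ} where

  LowKeys : (ℕ → ℕ) → ∀ {j} → Choice f j → Set
  LowKeys key none              = ⊤
  LowKeys key (inside {j} T)    = key j ≡ 1 × LowKeys key T
  LowKeys key (outside {j} _ T) = key j ≡ 0 × LowKeys key T

  HighKeys : (ℕ → ℕ) → ∀ {m} → Choice f′ m → Set
  HighKeys key none              = ⊤
  HighKeys key (inside {m} T)    = key (n ∸ suc m) ≡ 1 × HighKeys key T
  HighKeys key (outside {m} _ T) = key (n ∸ suc m) ≡ 2 × HighKeys key T

  LowKeys-cong : ∀ {key key′ j} (T : Choice f j) → (∀ i → i < j → key′ i ≡ key i) → LowKeys key T → LowKeys key′ T
  LowKeys-cong none              eq _       = tt
  LowKeys-cong (inside {j} T)    eq (k , l) = trans (eq j ≤-refl) k , LowKeys-cong T (λ i i<j → eq i (m<n⇒m<1+n i<j)) l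
  LowKeys-cong (outside {j} _ T) eq (k , l) = trans (eq j ≤-refl) k , LowKeys-cong T (λ i i<j → eq i (m<n⇒m<1+n i<j)) l

  Kept : State → State → Set
  Kept = Same (0 ∷ 23 ∷ 24 ∷ []) (4 ∷ 8 ∷ 9 ∷ [])

  LowDone : ∀ {j} → State → Choice f j → State → Set
  LowDone {j} s T s′ = LowKeys (arr s′ 3) T × (∀ i → j ≤ i → arr s′ 3 i ≡ arr s 3 i) × Kept s s′

  low-unwind : ∀ {j s v} (T : Choice f j) → reg s 4 ≡ suc j → arr s 8 (reg s 29) ≡ v →
    Run (WHILE lit 1 ≼ var 4 DO label-low) (low-labelled s) (suc j * (3 + time label-low)) (LowDone (low-labelled s) T) →
    Run (WHILE lit 1 ≼ var 4 DO label-low) s (suc (suc j) * (3 + time label-low))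
      (λ s′ → (arr s′ 3 j ≡ v × LowKeys (arr s′ 3) T) × (∀ i → suc j ≤ i → arr s′ 3 i ≡ arr s 3 i) × Kept s s′)
  low-unwind {j} {s} T 4≡ tag≡ r = run-step {m = suc j} (subst (1 ≤_) (sym 4≡) z<s) (run-map finish r)
    where
    finish : ∀ s′ → LowDone (low-labelled s) T s′ → _
    finish s′ (keys , above , kept) =
      (trans (above j ≤-refl) (trans (update-at (arr s 3) (cong (_∸ 1) 4≡)) tag≡) , keys) ,
      (λ i j<i → trans (above i (<⇒≤ j<i)) (update-≢ (arr s 3) (λ eq → <⇒≢ j<i (trans (sym (cong (_∸ 1) 4≡)) eq)))) , kept

  low-loop : ∀ {j s} (T : Choice f j) → reg s 4 ≡ j → Encodes (arr s 8) (arr s 9) (reg s 29) T →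
    Run (WHILE lit 1 ≼ var 4 DO label-low) s (suc j * (3 + time label-low)) (LowDone s T)
  low-loop none 4≡ _ = run-stop (λ le → contradiction (subst (1 ≤_) 4≡ le) λ ())
    (tt , (λ _ _ → refl) , refl , refl , refl , refl , refl , refl , tt)
  low-loop (inside T)    4≡ (tag≡ , _ , enc) = low-unwind T 4≡ tag≡ (low-loop T (cong (_∸ 1) 4≡) enc)
  low-loop (outside _ T) 4≡ (tag≡ , _ , enc) = low-unwind T 4≡ tag≡ (low-loop T (cong (_∸ 1) 4≡) enc)

  HighDone : ∀ {m} → State → Choice f′ m → State → Set
  HighDone {m} s T s′ = HighKeys (arr s′ 3) T × (∀ i → i < n ∸ m → arr s′ 3 i ≡ arr s 3 i) × Kept s s′

  high-unwind : ∀ {m s v} (T : Choice f′ m) → m < n → reg s 0 ≡ n → reg s 4 ≡ n ∸ suc m → 2 ∸ arr s 8 (reg s 29) ≡ v →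
    (reg s 4 + 1 ≡ n ∸ m → Run (WHILE var 4 ⊕ lit 1 ≼ var 0 DO label-high) (high-labelled s) (suc m * (5 + time label-high)) (HighDone (high-labelled s) T)) →
    Run (WHILE var 4 ⊕ lit 1 ≼ var 0 DO label-high) s (suc (suc m) * (5 + time label-high))
      (λ s′ → (arr s′ 3 (n ∸ suc m) ≡ v × HighKeys (arr s′ 3) T) × (∀ i → i < n ∸ suc m → arr s′ 3 i ≡ arr s 3 i) × Kept s s′)
  high-unwind {m} {s} T m<n 0≡ 4≡ tag≡ r =
    run-step {m = suc m} (subst₂ _≤_ (sym 4+1≡) (sym 0≡) (m∸n≤m n m)) (run-map finish (r 4+1≡))
    where
    i< : n ∸ suc m < n ∸ m
    i< = ∸-monoʳ-< ≤-refl m<n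
    4+1≡ : reg s 4 + 1 ≡ n ∸ m
    4+1≡ = trans (cong (_+ 1) 4≡) (trans (+-comm _ 1) (sym (+-∸-assoc 1 m<n)))
    finish : ∀ s′ → HighDone (high-labelled s) T s′ → _
    finish s′ (keys , below , kept) =
      (trans (below (n ∸ suc m) i<) (trans (update-at (arr s 3) 4≡) tag≡) , keys) ,
      (λ i i<′ → trans (below i (<-trans i<′ i<)) (update-≢ (arr s 3) (λ eq → <⇒≢ i<′ (trans (sym eq) 4≡)))) , kept

  high-loop : ∀ {m s} (T : Choice f′ m) → m ≤ n → reg s 0 ≡ n → reg s 4 ≡ n ∸ m → Encodes (arr s 8) (arr s 9) (reg s 29) T →
    Run (WHILE var 4 ⊕ lit 1 ≼ var 0 DO label-high) s (suc m * (5 + time label-high)) (HighDone s T)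
  high-loop none _ 0≡ 4≡ _ = run-stop
    (λ le → 1+n≰n (subst₂ _≤_ (trans (cong (_+ 1) 4≡) (+-comm n 1)) 0≡ le))
    (tt , (λ _ _ → refl) , refl , refl , refl , refl , refl , refl , tt)
  high-loop (inside T)    m<n 0≡ 4≡ (tag≡ , _ , enc) =
    high-unwind T m<n 0≡ 4≡ (cong (2 ∸_) tag≡) (λ 4+1≡ → high-loop T (<⇒≤ m<n) 0≡ 4+1≡ enc)
  high-loop (outside _ T) m<n 0≡ 4≡ (tag≡ , _ , enc) =
    high-unwind T m<n 0≡ 4≡ (cong (2 ∸_) tag≡) (λ 4+1≡ → high-loop T (<⇒≤ m<n) 0≡ 4+1≡ enc)

  labels-correct : ∀ {h s} (T : Choice f h) (T′ : Choice f′ (n ∸ h)) → h ≤ n → reg s 0 ≡ n → reg s 24 ≡ h →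
    Encodes (arr s 8) (arr s 9) (reg s 22) T → Encodes (arr s 8) (arr s 9) (reg s 23) T′ →
    Run labels s (labels-time n) (λ s′ → LowKeys (arr s′ 3) T × HighKeys (arr s′ 3) T′ ×
      reg s′ 3 ≡ 3 × reg s′ 0 ≡ n × arr s′ 4 ≡ arr s 4)
  labels-correct {h} {s} T T′ h≤n 0≡ 24≡ enc enc′ =
    run-then (
    run-seq (run-weaken (*-monoˡ-≤ (3 + time label-low) (s≤s h≤n)) (low-loop T 24≡ enc)) λ { s₁ (keys , _ , r0 , r23 , r24 , a4 , a8 , a9 , _) →
    run-then (
    run-seq (run-weaken (*-monoˡ-≤ (5 + time label-high) (s≤s (m∸n≤m n h)))
      (high-loop T′ (m∸n≤m n h) (trans r0 0≡) (trans r24 (trans 24≡ (sym (m∸[m∸n]≡n h≤n))))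
        (subst (λ b → Encodes (arr s₁ 8) (arr s₁ 9) b T′) (sym r23) (subst₂ (λ t x → Encodes t x (reg s 23) T′) (sym a8) (sym a9) enc′))))
      λ { s₂ (keys′ , below , r0′ , _ , _ , a4′ , _) →
    -- The second walk writes labels from `h` on only, so those of the low items survive.
    run-wp (3 ≔ lit 3) (LowKeys-cong T (λ i i<h → below i (subst (i <_) (sym (m∸[m∸n]≡n h≤n)) i<h)) keys , keys′ , refl ,
      trans r0′ (trans r0 0≡) , trans a4′ a4) }) })

  module _ {A : Set} (it : ℕ → A) (key : ℕ → ℕ) where
    open Buckets key it

    bucket-low : ∀ {j} (T : Choice f j) → LowKeys key T →
      bucket 0 j ≡ unchosen↑ it T × bucket 1 j ≡ chosen↑ it T × bucket 2 j ≡ []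
    bucket-low none              _ = refl , refl , refl
    bucket-low (inside {j} T)    (k , l) with bucket-low T l
    ... | b₀ , b₁ , b₂ rewrite k | b₀ | b₁ | b₂ = ++-identityʳ _ , refl , refl
    bucket-low (outside {j} _ T) (k , l) with bucket-low T l
    ... | b₀ , b₁ , b₂ rewrite k | b₀ | b₁ | b₂ = refl , ++-identityʳ _ , refl

    bucket-high : ∀ {m} (T : Choice f′ m) → m ≤ n → HighKeys key T →
      bucket 0 n ≡ bucket 0 (n ∸ m) × bucket 1 n ≡ bucket 1 (n ∸ m) ++ chosen↓ (mirror n it) T ×
      bucket 2 n ≡ bucket 2 (n ∸ m) ++ unchosen↓ (mirror n it) T
    bucket-high none              _   _ = refl , sym (++-identityʳ _) , sym (++-identityʳ _)
    bucket-high (inside {m} T)    m<n (k , l) with bucket-high T (<⇒≤ m<n) l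
    ... | b₀ , b₁ , b₂ rewrite +-∸-assoc 1 m<n | k | b₀ | b₁ | b₂ =
      ++-identityʳ _ , ++-assoc (bucket 1 (n ∸ suc m)) _ _ , cong (_++ unchosen↓ (mirror n it) T) (++-identityʳ _)
    bucket-high (outside {m} _ T) m<n (k , l) with bucket-high T (<⇒≤ m<n) l
    ... | b₀ , b₁ , b₂ rewrite +-∸-assoc 1 m<n | k | b₀ | b₁ | b₂ =
      ++-identityʳ _ , cong (_++ chosen↓ (mirror n it) T) (++-identityʳ _) , ++-assoc (bucket 2 (n ∸ suc m)) _ _

    -- Label 0 occurs in the low part only and label 2 in the high part only. In the bucket of label
    -- 1, stability puts the low items before the high ones.
    buckets-arrangement : ∀ {h} (T : Choice f h) (T′ : Choice f′ (n ∸ h)) → h ≤ n → LowKeys key T → HighKeys key T′ →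
      buckets 3 n ≡ unchosen↑ it T ++ (chosen↑ it T ++ chosen↓ (mirror n it) T′) ++ unchosen↓ (mirror n it) T′
    buckets-arrangement {h} T T′ h≤n l l′ with bucket-low T l | bucket-high T′ (m∸n≤m n h) l′
    ... | b₀ , b₁ , b₂ | c₀ , c₁ , c₂ rewrite c₀ | c₁ | c₂ | m∸[m∸n]≡n h≤n | b₀ | b₁ | b₂ =
      ++-assoc (unchosen↑ it T) (chosen↑ it T ++ chosen↓ (mirror n it) T′) _

-- The solver

∈-prefix : ∀ {A : Set} (f : ℕ → A) {i n} → i < n → f i ∈ₗ prefix f n
∈-prefix f {i} {suc n} i<sn with m<1+n⇒m<n∨m≡n i<sn
... | inj₁ i<n  = ∈-++⁺ˡ (∈-prefix f i<n)
... | inj₂ refl = ∈-++⁺ʳ (prefix f n) (here refl)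

prefix-pairs : ∀ {A : Set} {R : A → A → Set} (f : ℕ → A) n → AllPairs R (prefix f n) →
  ∀ {i k} → i < k → k < n → R (f i) (f k)
prefix-pairs f (suc n) pairs {i} {k} i<k k<sn with m<1+n⇒m<n∨m≡n k<sn
... | inj₁ k<n  = prefix-pairs f n (init (prefix f n) pairs) i<k k<n
  where
  init : ∀ {A : Set} {R : A → A → Set} xs {ys} → AllPairs R (xs ++ ys) → AllPairs R xs
  init []       _         = []
  init (x ∷ xs) (r ∷ rs) = Allₚ.++⁻ˡ xs r ∷ init xs rs
... | inj₂ refl = cross (prefix f n) pairs (∈-prefix f i<k) (here refl)

prefix-map : ∀ {A B : Set} (g : A → B) (f : ℕ → A) n → map g (prefix f n) ≡ prefix (g ∘ f) n
prefix-map g f zero    = refl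
prefix-map g f (suc n) = trans (map-++ g (prefix f n) [ f n ]) (cong (_++ [ g (f n) ]) (prefix-map g f n))

applyUpTo-tabulate : ∀ {A : Set} (f : ℕ → A) n → applyUpTo f n ≡ tabulate {n = n} (f ∘ toℕ)
applyUpTo-tabulate f zero    = refl
applyUpTo-tabulate f (suc n) = cong (f 0 ∷_) (applyUpTo-tabulate (f ∘ suc) n)

tabulate-injective : ∀ {A : Set} {n} {f g : Fin n → A} → tabulate f ≡ tabulate g → ∀ k → f k ≡ g k
tabulate-injective {n = suc n} eq zero    = ∷-injectiveˡ eq
tabulate-injective {n = suc n} eq (suc k) = tabulate-injective (∷-injectiveʳ eq) k

update-below : ∀ {f g : ℕ → ℕ} {r i v} → r ≡ i → v ≡ g i → (∀ k → k < i → f k ≡ g k) →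
  ∀ k → k < suc i → (f [ r ↦ v ]) k ≡ g k
update-below {f} refl v≡ eq k k<si with m<1+n⇒m<n∨m≡n k<si
... | inj₁ k<i  = trans (update-≢ f (>⇒≢ k<i)) (eq k k<i)
... | inj₂ refl = trans (update-≡ f k) v≡

collect-step collect load-low prepare-low load-high prepare-high output solver : Program
collect-step = 3 ≔ var 3 ⊕ 0 ![ var 4 ] ⨟ 3 ![ var 4 ]≔ 0 ![ var 4 ] ⨟ 4 ![ var 4 ]≔ var 4 ⨟ 4 ≔ var 4 ⊕ lit 1
collect = (3 ≔ lit 0 ⨟ 4 ≔ lit 0) ⨟ (WHILE var 4 ⊕ lit 1 ≼ var 0 DO collect-step) ⨟ 3 ≔ var 3 ⊕ lit 1
load-low =
  4 ![ var 4 ]≔ 2 ![ var 4 ] ⨟ 5 ![ var 4 ]≔ 0 ![ 2 ![ var 4 ] ] ⨟ 6 ![ var 4 ]≔ 1 ![ 2 ![ var 4 ] ] ⨟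
  -- Register 9 starts at S and gains S for each job: this produces the product `(n + 1) S`.
  9 ≔ var 9 ⊕ var 8 ⨟ 4 ≔ var 4 ⊕ lit 1
prepare-low =
  ((IF var 1 ≼ var 3 ⊖ lit 1 THEN 7 ≔ var 1 ELSE 7 ≔ var 3 ⊖ lit 1) ⨟
   8 ≔ var 7 ⊕ lit 1 ⨟ 9 ≔ var 8 ⨟ 10 ≔ lit 0 ⨟ 4 ≔ lit 0) ⨟
  WHILE var 4 ⊕ lit 1 ≼ var 0 DO load-low
load-high =
  5 ![ var 4 ]≔ 0 ![ 4 ![ var 0 ⊖ (var 4 ⊕ lit 1) ] ] ⨟ 6 ![ var 4 ]≔ 1 ![ 4 ![ var 0 ⊖ (var 4 ⊕ lit 1) ] ] ⨟
  4 ≔ var 4 ⊕ lit 1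
prepare-high = 4 ≔ lit 0 ⨟ WHILE var 4 ⊕ lit 1 ≼ var 0 DO load-high
output = IF lit 1 ≼ var 21 THEN (labels ⨟ bucketSort ⨟ 2 ≔ lit 1) ELSE 2 ≔ lit 0
solver = collect ⨟ bucketSort ⨟ prepare-low ⨟ table ⨟ prepare-high ⨟ table ⨟ scan ⨟ output

collect-time prepare-low-time prepare-high-time output-time : ℕ → ℕ
collect-time n = 4 + (suc n * (5 + time collect-step) + 4)
prepare-low-time n = 21 + suc n * (5 + time load-low)
prepare-high-time n = 2 + suc n * (5 + time load-high)
output-time n = 3 + ((labels-time n + (bucketSort-time n 3 + 2)) + 2)

solver-time : ℕ → ℕ → ℕ → ℕ
solver-time n P B = collect-time n + (bucketSort-time n (suc P) + (prepare-low-time n + (table-time n B +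
  (prepare-high-time n + (table-time n B + (scan-time n B + output-time n))))))

-- Composition of the stages

module Correctness (I : Instance) (s₀ : State) (input : Input I s₀) where
  open Instance I
  open Schedules I
  open Flow p
  open Input input using (times; resource)

  -- Made total because items and array cells are indexed by natural numbers; the value beyond the
  -- range is an arbitrary job.
  fin : ℕ → Fin n
  fin i with i <? n
  ... | yes i<n = fromℕ< i<n
  ... | no  _   = proj₁ nonempty

  toℕ-fin : ∀ {i} → i < n → toℕ (fin i) ≡ i
  toℕ-fin {i} i<n with i <? n
  ... | yes lt = toℕ-fromℕ< lt
  ... | no ≮n  = contradiction i<n ≮n

  fin-toℕ : ∀ j → fin (toℕ j) ≡ j
  fin-toℕ j = toℕ-injective (toℕ-fin (toℕ<n j))

  prefix-fin : prefix fin n ≡ allFin n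
  prefix-fin = trans (prefix≡applyUpTo fin n) (trans (applyUpTo-tabulate fin n) (tabulate-cong fin-toℕ))

  length≡n : ∀ {xs} → xs ↭ allFin n → length xs ≡ n
  length≡n σ = trans (↭-length σ) (length-tabulate id)

  Given : State → Set
  Given s = reg s 0 ≡ n × reg s 1 ≡ Kʳ × arr s 0 ≡ arr s₀ 0 × arr s 1 ≡ arr s₀ 1

  time-of : ∀ {s} → Given s → ∀ {i j} → i ≡ toℕ j → arr s 0 i ≡ p j
  time-of (_ , _ , a0 , _) {j = j} refl = trans (cong (λ f → f (toℕ j)) a0) (times j)

  flag-of : ∀ {s} → Given s → ∀ {i j} → i ≡ toℕ j → arr s 1 i ≡ flag j
  flag-of (_ , _ , _ , a1) {j = j} refl = trans (cong (λ f → f (toℕ j)) a1) (resource j)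

  enter : ∀ s {i} → reg s 0 ≡ n → reg s 4 ≡ i → i < n → reg s 4 + 1 ≤ reg s 0
  enter s 0≡ 4≡ i<n = subst₂ _≤_ (sym (next (reg s 4) 4≡)) (sym 0≡) i<n

  leave : ∀ s → reg s 0 ≡ n → reg s 4 ≡ n → ¬ reg s 4 + 1 ≤ reg s 0
  leave s 0≡ 4≡ le = 1+n≰n (subst₂ _≤_ (next (reg s 4) 4≡) 0≡ le)

  Collected : State → Set
  Collected s = Given s × reg s 3 ≡ suc P ×
    (∀ i → i < n → arr s 3 i ≡ p (fin i)) × (∀ i → i < n → arr s 4 i ≡ toℕ (fin i))

  CollectInv : ℕ → State → Set
  CollectInv i s = Given s × reg s 4 ≡ i × reg s 3 ≡ total (prefix fin i) ×
    (∀ k → k < i → arr s 3 k ≡ p (fin k)) × (∀ k → k < i → arr s 4 k ≡ toℕ (fin k))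

  collect-correct : ∀ {s} → Given s → Run collect s (collect-time n) Collected
  collect-correct {s} g = run-seq (run-wp (3 ≔ lit 0 ⨟ 4 ≔ lit 0) {CollectInv 0} (g , refl , refl , (λ _ ()) , (λ _ ()))) λ _ inv →
    run-seq (run-while {var 4 ⊕ lit 1 ≼ var 0} n (time collect-step) CollectInv step (λ { s ((0≡ , _) , 4≡ , _) → leave s 0≡ 4≡ }) inv) λ s′ → λ where
      (g , _ , 3≡ , keys , ids) → run-wp (3 ≔ var 3 ⊕ lit 1) {Collected}
        (g , next (reg s′ 3) (trans 3≡ (trans (cong total prefix-fin) (sym P≡total))) , keys , ids)
    where
    step : ∀ i s → i < n → CollectInv i s → reg s 4 + 1 ≤ reg s 0 × Run collect-step s (time collect-step) (CollectInv (suc i))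
    step i s i<n (g , 4≡ , 3≡ , keys , ids) = enter s (proj₁ g) 4≡ i<n , run-wp collect-step
      (g , next (reg s 4) 4≡ ,
       trans (cong₂ _+_ 3≡ t≡) (trans (cong (total (prefix fin i) +_) (sym (+-identityʳ _))) (sym (total-++ (prefix fin i) [ fin i ]))) ,
       update-below 4≡ t≡ keys , update-below 4≡ (trans 4≡ (sym (toℕ-fin i<n))) ids)
      where
      t≡ : arr s 0 (reg s 4) ≡ p (fin i)
      t≡ = time-of {s} g (trans 4≡ (sym (toℕ-fin i<n)))

  record IsSorted (it : ℕ → Fin n) : Set where
    constructor isSorted
    field
      perm : prefix it n ↭ allFin n
      mono : ∀ {i k} → i < k → k < n → p (it i) ≤ p (it k)

  SortedIn : (ℕ → Fin n) → State → Set
  SortedIn it s = Given s × reg s 3 ≡ suc P × (∀ i → i < n → arr s 2 i ≡ toℕ (it i))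

  sort-correct : ∀ {s} → Collected s → Run bucketSort s (bucketSort-time n (suc P))
    (λ s′ → ∃[ it ] IsSorted it × SortedIn it s′)
  sort-correct {s} ((0≡ , 1≡ , a0 , a1) , 3≡ , keys , ids) = run-map finish
    (bucketSort-correct toℕ {n} {suc P} {p ∘ fin} {fin} {s}
      (keyed 0≡ 3≡ keys ids (refl , refl , refl , refl , refl , refl , refl , refl , tt)))
    where
    open Buckets (p ∘ fin) fin
    bounded : ∀ i → i < n → p (fin i) < suc P
    bounded i i<n = s≤s (≤-trans (≤total (∈-prefix fin i<n)) (≤-reflexive (trans (cong total prefix-fin) (sym P≡total))))
      where
      ≤total : ∀ {x xs} → x ∈ₗ xs → p x ≤ total xs
      ≤total {xs = y ∷ xs} (here refl)  = m≤m+n _ (total xs)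
      ≤total {xs = y ∷ xs} (there x∈) = ≤-trans (≤total x∈) (m≤n+m _ (p y))
    list = buckets (suc P) n
    list↭ : list ↭ allFin n
    list↭ = ↭-trans (buckets-↭ (suc P) n bounded) (↭-reflexive prefix-fin)
    finish : ∀ s′ → Keyed toℕ s s′ × Listed toℕ list s′ → ∃[ it ] IsSorted it × SortedIn it s′
    finish s′ (ks , _ , listed) = it , isSorted (↭-trans (↭-reflexive it≡) list↭)
      (prefix-pairs it n (subst (AllPairs (_≤_ on p)) (sym it≡) (buckets-sorted p (λ _ → refl) (suc P) n))) ,
      (trans r0 0≡ , trans r1 1≡ , trans f0 a0 , trans f1 a1) , trans r3 3≡ , (λ i i<n → sym (toℕ-fin (ids<n i i<n)))
      where
      r0 = proj₁ (Keyed.same ks)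
      r1 = proj₁ (proj₂ (Keyed.same ks))
      r3 = proj₁ (proj₂ (proj₂ (proj₂ (Keyed.same ks))))
      f0 = proj₁ (proj₂ (proj₂ (proj₂ (proj₂ (Keyed.same ks)))))
      f1 = proj₁ (proj₂ (proj₂ (proj₂ (proj₂ (proj₂ (Keyed.same ks))))))
      ids≡ : prefix (arr s′ 2) n ≡ map toℕ list
      ids≡ = subst (λ k → prefix (arr s′ 2) k ≡ map toℕ list) (length≡n list↭) listed
      it : ℕ → Fin n
      -- The sorted order is read off the output array itself, so that the array contents agree with
      -- it by `toℕ-fin`.
      it i = fin (arr s′ 2 i)
      it≡ : prefix it n ≡ list
      it≡ = trans (sym (prefix-map fin (arr s′ 2) n)) (trans (cong (map fin) ids≡)
        (trans (sym (map-∘ list)) (trans (map-cong fin-toℕ list) (map-id list))))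
      ids<n : ∀ i → i < n → arr s′ 2 i < n
      ids<n i i<n = All.lookup (subst (All (_< n)) (sym ids≡) (Allₚ.map⁺ (All.tabulate (λ {j} _ → toℕ<n j)))) (∈-prefix (arr s′ 2) i<n)

  module Solve (it : ℕ → Fin n) (sorted : IsSorted it) where
    open IsSorted sorted
    open Sorted it perm mono hiding (sorted; module L; module H)

    B W : ℕ
    B = budget
    W = suc n * (suc n * suc B)

    module TL = Table (flag ∘ it) (p ∘ it) n B
    module TH = Table (flag ∘ it′) (p ∘ it′) n B

    Ids : State → Set
    Ids s = ∀ i → i < n → arr s 4 i ≡ toℕ (it i)

    LowReady : State → Set
    LowReady s = Given s × Ids s × reg s 10 ≡ 0 × TL.SetUp s

    LoadLow : ℕ → State → Set
    LoadLow i s = (SortedIn it s × reg s 10 ≡ 0 × reg s 7 ≡ B × reg s 8 ≡ suc B) × reg s 4 ≡ i × reg s 9 ≡ suc i * suc B ×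
      (∀ k → k < i → arr s 4 k ≡ toℕ (it k)) × (∀ k → k < i → arr s 5 k ≡ p (it k)) × (∀ k → k < i → arr s 6 k ≡ flag (it k))

    prepare-low-correct : ∀ {s} → SortedIn it s → Run prepare-low s (prepare-low-time n) LowReady
    prepare-low-correct {s} si@((0≡ , 1≡ , _) , 3≡ , _) =
      run-seq (run-wp ((IF var 1 ≼ var 3 ⊖ lit 1 THEN 7 ≔ var 1 ELSE 7 ≔ var 3 ⊖ lit 1) ⨟
          8 ≔ var 7 ⊕ lit 1 ⨟ 9 ≔ var 8 ⨟ 10 ≔ lit 0 ⨟ 4 ≔ lit 0) {LoadLow 0}
        ((λ K≤P → init (trans 1≡ (sym (m≤n⇒m⊓n≡m (subst₂ _≤_ 1≡ P≡ K≤P)))) ) ,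
         (λ K≰P → init (trans P≡ (sym (m≥n⇒m⊓n≡n (subst₂ _≤_ P≡ 1≡ (≰⇒≥ K≰P)))))))) λ _ inv →
      run-map (λ { s ((si@(g@(0≡ , _) , _ , _) , 10≡ , 7≡ , 8≡) , _ , 9≡ , ids , qs , fs) →
          g , ids , 10≡ , TL.setup 0≡ 7≡ 8≡ 9≡ qs fs })
        (run-while {var 4 ⊕ lit 1 ≼ var 0} n (time load-low) LoadLow step (λ { s ((((0≡ , _) , _) , _) , 4≡ , _) → leave s 0≡ 4≡ }) inv)
      where
      P≡ : reg s 3 ∸ 1 ≡ P
      P≡ = cong (_∸ 1) 3≡
      init : ∀ {b} → b ≡ B → LoadLow 0 (setReg (setReg (setReg (setReg (setReg s 7 b) 8 (b + 1)) 9 (b + 1)) 10 0) 4 0)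
      init {b} b≡ = (si , refl , b≡ , next b b≡) , refl , trans (next b b≡) (sym (+-identityʳ (suc B))) , (λ _ ()) , (λ _ ()) , (λ _ ())
      step : ∀ i s → i < n → LoadLow i s → reg s 4 + 1 ≤ reg s 0 × Run load-low s (time load-low) (LoadLow (suc i))
      step i s i<n (base@((g , _ , jobs≡) , _ , _ , 8≡) , 4≡ , 9≡ , ids , qs , fs) = enter s (proj₁ g) 4≡ i<n ,
        run-wp load-low (base , next (reg s 4) 4≡ , trans (cong₂ _+_ 9≡ 8≡) (+-comm _ (suc B)) ,
          update-below 4≡ id≡ ids , update-below 4≡ (time-of {s} g id≡) qs , update-below 4≡ (flag-of {s} g id≡) fs)
        where
        id≡ : arr s 2 (reg s 4) ≡ toℕ (it i)
        id≡ = trans (cong (arr s 2) 4≡) (jobs≡ i i<n)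

    LoadHigh : State → ℕ → State → Set
    LoadHigh s i s′ = Same (0 ∷ 1 ∷ 7 ∷ 8 ∷ 9 ∷ 10 ∷ []) (0 ∷ 1 ∷ 4 ∷ 7 ∷ 8 ∷ 9 ∷ []) s s′ × reg s′ 4 ≡ i ×
      (∀ k → k < i → arr s′ 5 k ≡ p (it′ k)) × (∀ k → k < i → arr s′ 6 k ≡ flag (it′ k))

    prepare-high-correct : ∀ {s} → Given s → Ids s → Run prepare-high s (prepare-high-time n) (LoadHigh s n)
    prepare-high-correct {s} g@(0≡ , _) ids =
      run-seq (run-wp (4 ≔ lit 0) {LoadHigh s 0}
        ((refl , refl , refl , refl , refl , refl , refl , refl , refl , refl , refl , refl , tt) , refl , (λ _ ()) , (λ _ ()))) λ _ inv →
      run-while {var 4 ⊕ lit 1 ≼ var 0} n (time load-high) (LoadHigh s) step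
        (λ { s′ ((r0 , _) , 4≡ , _) → leave s′ (trans r0 0≡) 4≡ }) inv
      where
      step : ∀ i s′ → i < n → LoadHigh s i s′ → reg s′ 4 + 1 ≤ reg s′ 0 × Run load-high s′ (time load-high) (LoadHigh s (suc i))
      step i s′ i<n (same@(r0 , r1 , _ , _ , _ , _ , a0 , a1 , a4 , _) , 4≡ , qs , fs) = enter s′ (trans r0 0≡) 4≡ i<n ,
        run-wp load-high (same , next (reg s′ 4) 4≡ , update-below 4≡ (time-of {s′} g′ id≡) qs , update-below 4≡ (flag-of {s′} g′ id≡) fs)
        where
        g′ : Given s′
        g′ = trans r0 0≡ , trans r1 (proj₁ (proj₂ g)) , trans a0 (proj₁ (proj₂ (proj₂ g))) , trans a1 (proj₂ (proj₂ (proj₂ g)))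
        id≡ : arr s′ 4 (reg s′ 0 ∸ (reg s′ 4 + 1)) ≡ toℕ (it′ i)
        id≡ = trans (cong₂ (λ f k → f k) a4 (cong₂ _∸_ (trans r0 0≡) (next (reg s′ 4) 4≡)))
          (ids (n ∸ suc i) (∸-monoʳ-< z<s i<n))

    LowCells : State → Set
    LowCells s = ∀ j c x → j ≤ n → c ≤ n → x ≤ B → TL.Cell (arr s 7) (arr s 8) (arr s 9) (TL.offset j c x) j c x

    HighCells : State → Set
    HighCells s = ∀ j c x → j ≤ n → c ≤ n → x ≤ B → TH.Cell (arr s 7) (arr s 8) (arr s 9) (W + TH.offset j c x) j c x

    offset<W : ∀ {j c x} → j ≤ n → c ≤ n → x ≤ B → TL.offset j c x < W
    offset<W {j} {c} {x} j≤n c≤n x≤B = begin-strict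
      (j * suc n + c) * suc B + x       <⟨ +-monoʳ-< _ (s≤s x≤B) ⟩
      (j * suc n + c) * suc B + suc B   ≡⟨ +-comm _ (suc B) ⟩
      suc (j * suc n + c) * suc B       ≤⟨ *-monoˡ-≤ (suc B) (begin
        suc (j * suc n + c)               ≡⟨ +-suc (j * suc n) c ⟨
        j * suc n + suc c                 ≤⟨ +-mono-≤ (*-monoˡ-≤ (suc n) j≤n) (s≤s c≤n) ⟩
        n * suc n + suc n                 ≡⟨ +-comm _ (suc n) ⟩
        suc n * suc n                     ∎) ⟩
      suc n * suc n * suc B             ≡⟨ *-assoc (suc n) (suc n) (suc B) ⟩
      W                                 ∎
      where open ≤-Reasoning

    LowFilled HighFilled : State → Set
    LowFilled s = Given s × Ids s × reg s 7 ≡ B × reg s 8 ≡ suc B × reg s 9 ≡ suc n * suc B × reg s 10 ≡ W × LowCells s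
    HighFilled s = Given s × Ids s × reg s 7 ≡ B × reg s 8 ≡ suc B × reg s 9 ≡ suc n * suc B × reg s 10 ≡ W + W ×
      LowCells s × HighCells s

    low-table-correct : ∀ {s} → LowReady s → Run table s (table-time n B) LowFilled
    low-table-correct {s} ((0≡ , 1≡ , a0 , a1) , ids , 10≡ , su) = run-map finish (TL.table-correct su)
      where
      finish : ∀ s′ → TL.Written s (reg s 10) (reg s 10 + W) (reg s 10 + W) s′ → LowFilled s′
      finish s′ (TL.setup 0≡′ 7≡ 8≡ 9≡ _ _ , (_ , r1 , _ , _ , _ , f0 , f1 , f4 , _) , w≡ , _ , cells) =
        (0≡′ , trans r1 1≡ , trans f0 a0 , trans f1 a1) , (λ i i<n → trans (cong (λ f → f i) f4) (ids i i<n)) ,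
        7≡ , 8≡ , 9≡ , trans w≡ (cong (_+ W) 10≡) ,
        λ j c x j≤n c≤n x≤B → subst (λ b → TL.Cell (arr s′ 7) (arr s′ 8) (arr s′ 9) (b + TL.offset j c x) j c x) 10≡
          (cells j c x c≤n x≤B (+-monoʳ-< (reg s 10) (offset<W j≤n c≤n x≤B)))

    -- The second run writes to addresses from `W` on, while the low cells and all their links lie
    -- below `W`; `cell-frame` thus carries them over.
    high-table-correct : ∀ {s s₁} → LowFilled s → LoadHigh s n s₁ → Run table s₁ (table-time n B) HighFilled
    high-table-correct {s} {s₁} ((0≡ , 1≡ , a0 , a1) , ids , 7≡ , 8≡ , 9≡ , 10≡ , lows)
      ((r0 , r1 , r7 , r8 , r9 , r10 , f0 , f1 , f4 , f7 , f8 , f9 , _) , _ , qs , fs) =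
      run-map finish (TH.table-correct (TH.setup (trans r0 0≡) (trans r7 7≡) (trans r8 8≡) (trans r9 9≡) qs fs))
      where
      10≡₁ = trans r10 10≡
      finish : ∀ s′ → TH.Written s₁ (reg s₁ 10) (reg s₁ 10 + W) (reg s₁ 10 + W) s′ → HighFilled s′
      finish s′ (TH.setup 0≡′ 7≡′ 8≡′ 9≡′ _ _ , (_ , r1′ , _ , _ , _ , f0′ , f1′ , f4′ , _) , w≡ , agree , cells) =
        (0≡′ , trans r1′ (trans r1 1≡) , trans f0′ (trans f0 a0) , trans f1′ (trans f1 a1)) ,
        (λ i i<n → trans (cong (λ f → f i) (trans f4′ f4)) (ids i i<n)) ,
        7≡′ , 8≡′ , 9≡′ , trans w≡ (cong (_+ W) 10≡₁) ,
        (λ j c x j≤n c≤n x≤B → TL.cell-frame {s} {s′} agree′ (offset<W j≤n c≤n x≤B) (lows j c x j≤n c≤n x≤B)) ,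
        (λ j c x j≤n c≤n x≤B → subst (λ b → TH.Cell (arr s′ 7) (arr s′ 8) (arr s′ 9) (b + TH.offset j c x) j c x) 10≡₁
          (cells j c x c≤n x≤B (+-monoʳ-< (reg s₁ 10) (offset<W j≤n c≤n x≤B))))
        where
        agree′ : TL.AgreeBelow W s s′
        agree′ a a<W with agree a (subst (a <_) (sym 10≡₁) a<W)
        ... | e₇ , e₈ , e₉ = trans e₇ (cong (λ f → f a) f7) , trans e₈ (cong (λ f → f a) f8) , trans e₉ (cong (λ f → f a) f9)

    module SC = Scan n B W (flag ∘ it) (p ∘ it) (flag ∘ it′) (p ∘ it′)

    Scanned : State → Set
    Scanned s = Ids s × reg s 0 ≡ n × Min (SC.Affordable (arr s)) (SC.PairEncodes (arr s) (reg s 22) (reg s 23) (reg s 24)) (SC.pairCost (arr s)) (reg s 21)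

    scanned : ∀ {s} → HighFilled s → Run scan s (scan-time n B) Scanned
    scanned {s} ((0≡ , _) , ids , 7≡ , 8≡ , 9≡ , 10≡ , lows , highs) =
      run-map finish (SC.Loops.scan-correct (arr s) lows highs refl 0≡ 7≡ 8≡ 9≡ 10≡)
      where
      finish : ∀ s′ → arr s′ ≡ arr s × reg s′ 0 ≡ n × Min (SC.Affordable (arr s))
        (SC.PairEncodes (arr s) (reg s′ 22) (reg s′ 23) (reg s′ 24)) (SC.pairCost (arr s)) (reg s′ 21) → Scanned s′
      finish s′ (refl , 0≡′ , best) = ids , 0≡′ , best

    module _ {f f′ : ℕ → ℕ} {key : ℕ → ℕ} where
      open Labels n {f} {f′}

      low-key<3 : ∀ {j} (T : Choice f j) → LowKeys key T → ∀ i → i < j → key i < 3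
      low-key<3 (inside {j} T) (k , l) i i<sj with m<1+n⇒m<n∨m≡n i<sj
      ... | inj₁ i<j  = low-key<3 T l i i<j
      ... | inj₂ refl = subst (_< 3) (sym k) (s≤s (s≤s z≤n))
      low-key<3 (outside {j} _ T) (k , l) i i<sj with m<1+n⇒m<n∨m≡n i<sj
      ... | inj₁ i<j  = low-key<3 T l i i<j
      ... | inj₂ refl = subst (_< 3) (sym k) (s≤s z≤n)

      high-key<3 : ∀ {m} (T : Choice f′ m) → m ≤ n → HighKeys key T → ∀ i → n ∸ m ≤ i → i < n → key i < 3
      high-key<3 none _ _ i n≤i i<n = contradiction i<n (≤⇒≯ n≤i)
      high-key<3 (inside {m} T) m<n (k , l) i le i<n with m≤n⇒m<n∨m≡n le
      ... | inj₁ lt   = high-key<3 T (<⇒≤ m<n) l i (subst (_≤ i) (sym (+-∸-assoc 1 m<n)) lt) i<n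
      ... | inj₂ refl = subst (_< 3) (sym k) (s≤s (s≤s z≤n))
      high-key<3 (outside {m} _ T) m<n (k , l) i le i<n with m≤n⇒m<n∨m≡n le
      ... | inj₁ lt   = high-key<3 T (<⇒≤ m<n) l i (subst (_≤ i) (sym (+-∸-assoc 1 m<n)) lt) i<n
      ... | inj₂ refl = subst (_< 3) (sym k) ≤-refl

    infeasible : (A : ℕ → ℕ → ℕ) → (∀ a → ¬ SC.Affordable A a) → ∀ π → ¬ Feasible π
    infeasible A empty π feasible = empty (h , h≤n , low , high) ≤budget
      where open Improvement (improve π feasible)

    output-correct : ∀ {s} → Scanned s → Run output s (output-time n) (Output I)
    output-correct {s} (ids , 0≡ , inj₁ (21≡ , empty)) = run-if {c = labels ⨟ bucketSort ⨟ 2 ≔ lit 1} {t = labels-time n + (bucketSort-time n 3 + 2)}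
      (λ 1≤ → contradiction (subst (1 ≤_) 21≡ 1≤) λ ())
      (λ _ → run-wp (2 ≔ lit 0) (inj₂ (refl , infeasible (arr s) empty)))
    output-correct {s} (ids , 0≡ , inj₂ ((h , h≤n , T , T′) , ≤B , (24≡ , enc , enc′) , 21≡ , least)) = run-if {d = 2 ≔ lit 0} {u = 2}
      (λ _ → run-seq (labels-correct T T′ h≤n 0≡ 24≡ enc enc′) λ { s₁ (lowKeys , highKeys , 3≡ , 0≡₁ , a4≡) →
        run-seq (bucketSort-correct toℕ {n} {3} {arr s₁ 3} {it} {s₁}
          (keyed 0≡₁ 3≡ (λ _ _ → refl) (λ i i<n → trans (cong (λ f → f i) a4≡) (ids i i<n))
            (refl , refl , refl , refl , refl , refl , refl , refl , tt)))
        λ { s₂ (_ , _ , listed) → run-wp (2 ≔ lit 1) (inj₁ (refl , optimal s₁ lowKeys highKeys s₂ listed)) } })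
      (λ 1≰ → contradiction (subst (1 ≤_) (sym 21≡) z<s) 1≰)
      where
      open Labels n {flag ∘ it} {flag ∘ it′}
      optimal : ∀ s₁ → LowKeys (arr s₁ 3) T → HighKeys (arr s₁ 3) T′ → ∀ s₂ →
        prefix (arr s₂ 2) (length (Buckets.buckets (arr s₁ 3) it 3 n)) ≡ map toℕ (Buckets.buckets (arr s₁ 3) it 3 n) →
        ∃[ π ] Optimal π × (∀ k → arr s₂ 2 (toℕ k) ≡ toℕ (π ⟨$⟩ʳ k))
      optimal s₁ lowKeys highKeys s₂ listed = π , (feasible , minimal) , stores
        where
        open Buckets (arr s₁ 3) it
        list = buckets 3 n
        key<3 : ∀ i → i < n → arr s₁ 3 i < 3
        key<3 i i<n with i <? h
        ... | yes i<h = low-key<3 {flag ∘ it} {flag ∘ it′} T lowKeys i i<h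
        ... | no  i≮h = high-key<3 {flag ∘ it} {flag ∘ it′} T′ (m∸n≤m n h) highKeys i (subst (_≤ i) (sym (m∸[m∸n]≡n h≤n)) (≮⇒≥ i≮h)) i<n
        list↭ : list ↭ allFin n
        list↭ = ↭-trans (buckets-↭ 3 n key<3) perm
        π = proj₁ (fromOrder list↭)
        order≡ : order π ≡ list
        order≡ = proj₂ (fromOrder list↭)
        order≡′ : order π ≡ arrangement T T′
        order≡′ = trans order≡ (buckets-arrangement it (arr s₁ 3) T T′ h≤n lowKeys highKeys)
        feasible : Feasible π
        feasible = arrangement-feasible π T T′ order≡′ ≤B
        minimal : ∀ π′ → Feasible π′ → totalCompletionTime π ≤ totalCompletionTime π′
        minimal π′ feasible′ = begin
          totalCompletionTime π        ≡⟨ totalCompletionTime≡flow π ⟩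
          flow (order π)               ≡⟨ cong flow order≡′ ⟩
          flow (arrangement T T′)      ≡⟨ flow-arrangement h≤n T T′ ⟩
          -- Both costs are measured from the sorted sequence. The rival `π′` is first replaced by
          -- the affordable pair from `improve`, which the scan has taken into account.
          flow (prefix it n) + _       ≤⟨ +-monoʳ-≤ (flow (prefix it n)) (s≤s⁻¹ (least (i.h , i.h≤n , i.low , i.high) i.≤budget)) ⟩
          flow (prefix it n) + _       ≤⟨ i.better ⟩
          totalCompletionTime π′       ∎
          where
          open ≤-Reasoning
          module i = Improvement (improve π′ feasible′)
        stores : ∀ k → arr s₂ 2 (toℕ k) ≡ toℕ (π ⟨$⟩ʳ k)
        stores = tabulate-injective (begin
          tabulate (arr s₂ 2 ∘ toℕ)            ≡⟨ applyUpTo-tabulate (arr s₂ 2) n ⟨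
          applyUpTo (arr s₂ 2) n               ≡⟨ prefix≡applyUpTo (arr s₂ 2) n ⟨
          prefix (arr s₂ 2) n                  ≡⟨ cong (prefix (arr s₂ 2)) (length≡n list↭) ⟨
          prefix (arr s₂ 2) (length list)      ≡⟨ listed ⟩
          map toℕ list                         ≡⟨ cong (map toℕ) order≡ ⟨
          map toℕ (tabulate (π ⟨$⟩ʳ_))          ≡⟨ map-tabulate (π ⟨$⟩ʳ_) toℕ ⟩
          tabulate (λ k → toℕ (π ⟨$⟩ʳ k))       ∎)
          where open ≡-Reasoning

    solve-sorted : ∀ {s} → SortedIn it s → Run (prepare-low ⨟ table ⨟ prepare-high ⨟ table ⨟ scan ⨟ output) s
      (prepare-low-time n + (table-time n B + (prepare-high-time n + (table-time n B + (scan-time n B + output-time n))))) (Output I)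
    solve-sorted {s} si =
      run-seq (prepare-low-correct {s} si) λ s₁ ready →
      run-seq (low-table-correct {s₁} ready) λ { s₂ filled@(g , ids , _) →
      run-seq (prepare-high-correct {s₂} g ids) λ s₃ loaded →
      run-seq (high-table-correct {s₂} {s₃} filled loaded) λ s₄ filled′ →
      run-seq (scanned {s₄} filled′) λ s₅ → output-correct {s₅} }

  solver-correct : Run solver s₀ (solver-time n P budget) (Output I)
  solver-correct =
    run-seq (collect-correct {s₀} (Input.jobs input , Input.budget input , refl , refl)) λ s₁ collected →
    run-seq (sort-correct {s₁} collected) λ { s₂ (it , sorted , si) → Solve.solve-sorted it sorted {s₂} si }

-- The running time

const-bound : ∀ c {X} → 1 ≤ X → c ≤ c * X
const-bound c 1≤X = ≤-trans (≤-reflexive (sym (*-identityʳ c))) (*-monoʳ-≤ c 1≤X)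

-- A loop of at most `j * m` rounds, with test cost `d`, between pieces of cost `a` and `r`. The
-- constant has the shape of the running time with the number of rounds replaced by `j`, so nested
-- loops are bounded by nesting this lemma.
loop-bound : ∀ a j d k l {N T r m X} → N ≤ j * m → T ≤ k * X → r ≤ l * (m * X) → 1 ≤ m → 1 ≤ X →
  a + (N * (d + T) + r) ≤ (a + (j * (d + k) + l)) * (m * X)
loop-bound a j d k l {N} {T} {r} {m} {X} N≤ T≤ r≤ 1≤m 1≤X = begin
  a + (N * (d + T) + r)
    ≤⟨ +-mono-≤ (const-bound a (*-mono-≤ 1≤m 1≤X)) (+-mono-≤ (*-mono-≤ N≤ (+-mono-≤ (const-bound d 1≤X) T≤)) r≤) ⟩
  a * (m * X) + (j * m * (d * X + k * X) + l * (m * X))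
    ≡⟨ lemma a j d k l m X ⟩
  (a + (j * (d + k) + l)) * (m * X) ∎
  where
  open ≤-Reasoning
  lemma : ∀ a j d k l m X → a * (m * X) + (j * m * (d * X + k * X) + l * (m * X)) ≡ (a + (j * (d + k) + l)) * (m * X)
  lemma = solve-∀

loop-bound₀ : ∀ a j d k {N T m X} → N ≤ j * m → T ≤ k * X → 1 ≤ m → 1 ≤ X →
  a + N * (d + T) ≤ (a + (j * (d + k) + 0)) * (m * X)
loop-bound₀ a j d k {N} {T} N≤ T≤ 1≤m 1≤X =
  ≤-trans (≤-reflexive (cong (a +_) (sym (+-identityʳ (N * (d + T)))))) (loop-bound a j d k 0 N≤ T≤ z≤n 1≤m 1≤X)

-- Each definition copies a running time, with 3 in place of loop lengths such as `n + 2` or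
-- `B + 2`. The 4 in `c-sort` is due to the final sort, whose three keys cost four tests even if `P`
-- is at most 1.
c-row c-rows c-table c-bucket c-sort c-step c-scan-row c-scan c-labels c-collect c-low c-high c-output c-total : ℕ
c-row = 2 + (3 * (3 + time fill) + 8)
c-rows = 9 + (3 * (3 + c-row) + 4)
c-table = 2 + (3 * (3 + c-rows) + 0)
c-bucket = 2 + (3 * (5 + time bucketStep) + 4)
c-sort = 4 + (4 * (5 + c-bucket) + 0)
c-step = 6 + (3 * (3 + time low-step) + (8 + (3 * (3 + time high-step) + 4)))
c-scan-row = 4 + (3 * (3 + c-step) + 12)
c-scan = 10 + (3 * (3 + c-scan-row) + 0)
c-labels = 4 + (3 * (3 + time label-low) + (4 + (3 * (5 + time label-high) + 2)))
c-collect = 4 + (3 * (5 + time collect-step) + 4)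
c-low = 21 + (3 * (5 + time load-low) + 0)
c-high = 2 + (3 * (5 + time load-high) + 0)
c-output = 3 + ((c-labels + (c-sort + 2)) + 2)
c-total = c-collect + (c-sort + (c-low + (c-table + (c-high + (c-table + (c-scan + c-output))))))

module Bounds {n P B : ℕ} (1≤n : 1 ≤ n) (B≤P : B ≤ P) where

  -- For `P = 0` the loops over weights still run once, hence the maximum with 1.
  Z : ℕ
  Z = 1 ⊔ P

  1≤Z : 1 ≤ Z
  1≤Z = m≤m⊔n 1 P

  n+2≤ : suc (suc n) ≤ 3 * n
  n+2≤ = ≤-trans (+-mono-≤ {2} {2 * n} (*-monoʳ-≤ 2 1≤n) (≤-refl {n})) (≤-reflexive (lemma n))
    where
    lemma : ∀ n → 2 * n + n ≡ 3 * n
    lemma = solve-∀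

  n+1≤ : suc n ≤ 3 * n
  n+1≤ = ≤-trans (n≤1+n _) n+2≤

  P+2≤ : suc (suc P) ≤ 3 * Z
  P+2≤ = ≤-trans (+-mono-≤ {2} {2 * Z} (*-monoʳ-≤ 2 1≤Z) (m≤n⊔m 1 P)) (≤-reflexive (lemma Z))
    where
    lemma : ∀ n → 2 * n + n ≡ 3 * n
    lemma = solve-∀

  B+2≤ : suc (suc B) ≤ 3 * Z
  B+2≤ = ≤-trans (s≤s (s≤s B≤P)) P+2≤

  unit : ∀ c → c ≤ c * 1
  unit c = ≤-reflexive (sym (*-identityʳ c))

  1≤n*1 : 1 ≤ n * 1
  1≤n*1 = *-mono-≤ 1≤n ≤-refl

  1≤Z*1 : 1 ≤ Z * 1
  1≤Z*1 = *-mono-≤ 1≤Z ≤-refl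

  -- The shape that nested uses of `loop-bound` produce; the trailing 1 is the bound of a loop-free
  -- body.
  Y : ℕ
  Y = n * (n * (Z * 1))

  n≤Y : n * 1 ≤ Y
  n≤Y = *-monoʳ-≤ n (*-mono-≤ 1≤n 1≤Z*1)

  simple : ∀ a d t b → a + (suc n * (d + t) + b) ≤ (a + (3 * (d + t) + b)) * (n * 1)
  simple a d t b = loop-bound a 3 d t b n+1≤ (unit t) (const-bound b 1≤n*1) 1≤n ≤-refl

  simple₀ : ∀ a d t → a + suc n * (d + t) ≤ (a + (3 * (d + t) + 0)) * (n * 1)
  simple₀ a d t = loop-bound₀ a 3 d t n+1≤ (unit t) 1≤n ≤-refl

  row≤ : row-time n B ≤ c-row * (Z * 1)
  row≤ = loop-bound 2 3 3 (time fill) 8 B+2≤ (unit (time fill)) (const-bound 8 1≤Z*1) 1≤Z ≤-refl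

  rows≤ : rows-time n B ≤ c-rows * (n * (Z * 1))
  rows≤ = loop-bound 9 3 3 c-row 4 n+2≤ row≤ (const-bound 4 (*-mono-≤ 1≤n 1≤Z*1)) 1≤n 1≤Z*1

  table≤ : table-time n B ≤ c-table * Y
  table≤ = loop-bound₀ 2 3 3 c-rows n+2≤ rows≤ 1≤n (*-mono-≤ 1≤n 1≤Z*1)

  sort≤ : ∀ {V} → suc V ≤ 4 * Z → bucketSort-time n V ≤ c-sort * Y
  sort≤ {V} V≤ = ≤-trans
    (loop-bound₀ 4 4 5 c-bucket {suc V} {2 + (suc n * (5 + time bucketStep) + 4)} V≤ (simple 2 5 (time bucketStep) 4) 1≤Z 1≤n*1)
    (*-monoʳ-≤ c-sort (≤-trans (≤-reflexive (lemma Z n)) (*-mono-≤ 1≤n (≤-refl {n * (Z * 1)}))))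
    where
    lemma : ∀ z n → z * (n * 1) ≡ 1 * (n * (z * 1))
    lemma = solve-∀

  step≤ : scan-step-time n B ≤ c-step * (n * 1)
  step≤ = loop-bound 6 3 3 (time low-step) (8 + (3 * (3 + time high-step) + 4)) n+2≤ (unit (time low-step))
    (loop-bound 8 3 3 (time high-step) 4 n+2≤ (unit (time high-step)) (const-bound 4 1≤n*1) 1≤n ≤-refl) 1≤n ≤-refl

  scan-row≤ : scan-row-time n B ≤ c-scan-row * (Z * (n * 1))
  scan-row≤ = loop-bound 4 3 3 c-step 12 B+2≤ step≤ (const-bound 12 (*-mono-≤ 1≤Z 1≤n*1)) 1≤Z 1≤n*1

  scan≤ : scan-time n B ≤ c-scan * Y
  scan≤ = ≤-trans (loop-bound₀ 10 3 3 c-scan-row n+2≤ scan-row≤ 1≤n (*-mono-≤ 1≤Z 1≤n*1))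
    (*-monoʳ-≤ c-scan (≤-reflexive (lemma Z n)))
    where
    lemma : ∀ z n → n * (z * (n * 1)) ≡ n * (n * (z * 1))
    lemma = solve-∀

  labels≤ : labels-time n ≤ c-labels * (n * 1)
  labels≤ = loop-bound 4 3 3 (time label-low) (4 + (3 * (5 + time label-high) + 2)) n+1≤ (unit (time label-low))
    (simple 4 5 (time label-high) 2) 1≤n ≤-refl

  output≤ : ∀ x y k l {t u} → t ≤ k * Y → u ≤ l * Y → x ≤ x * Y → y ≤ y * Y →
    x + ((t + (u + y)) + y) ≤ (x + ((k + (l + y)) + y)) * Y
  output≤ x y k l t≤ u≤ x≤ y≤ =
    ≤-trans (+-mono-≤ x≤ (+-mono-≤ (+-mono-≤ t≤ (+-mono-≤ u≤ y≤)) y≤)) (≤-reflexive (lemma x y k l Y))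
    where
    lemma : ∀ x y k l Y → x * Y + ((k * Y + (l * Y + y * Y)) + y * Y) ≡ (x + ((k + (l + y)) + y)) * Y
    lemma = solve-∀

  -- Abstract in the constants, so that the ring solver works with variables and not with the
  -- numerals behind them.
  stages≤ : ∀ a b c d e f g {t₁ t₂ t₃ t₄ t₅ t₆ t₇} →
    t₁ ≤ a * Y → t₂ ≤ b * Y → t₃ ≤ c * Y → t₄ ≤ d * Y → t₅ ≤ e * Y → t₆ ≤ f * Y → t₇ ≤ g * Y →
    t₁ + (t₂ + (t₃ + (t₄ + (t₅ + (t₄ + (t₆ + t₇)))))) ≤ (a + (b + (c + (d + (e + (d + (f + g))))))) * Y
  stages≤ a b c d e f g a≤ b≤ c≤ d≤ e≤ f≤ g≤ =
    ≤-trans (+-mono-≤ a≤ (+-mono-≤ b≤ (+-mono-≤ c≤ (+-mono-≤ d≤ (+-mono-≤ e≤ (+-mono-≤ d≤ (+-mono-≤ f≤ g≤)))))))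
      (≤-reflexive (lemma a b c d e f g Y))
    where
    lemma : ∀ a b c d e f g Y → a * Y + (b * Y + (c * Y + (d * Y + (e * Y + (d * Y + (f * Y + g * Y)))))) ≡
      (a + (b + (c + (d + (e + (d + (f + g))))))) * Y
    lemma = solve-∀

  solver≤ : solver-time n P B ≤ c-total * Y
  solver≤ = stages≤ c-collect c-sort c-low c-table c-high c-scan c-output
    (linear c-collect (simple 4 5 (time collect-step) 4)) (sort≤ (≤-trans P+2≤ (*-monoˡ-≤ Z (n≤1+n 3))))
    (linear c-low (simple₀ 21 5 (time load-low))) table≤ (linear c-high (simple₀ 2 5 (time load-high))) scan≤
    (output≤ 3 2 c-labels c-sort (linear c-labels labels≤) (sort≤ (*-monoʳ-≤ 4 1≤Z)) (const-bound 3 1≤Y) (const-bound 2 1≤Y))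
    where
    1≤Y : 1 ≤ Y
    1≤Y = ≤-trans 1≤n*1 n≤Y
    linear : ∀ k {t} → t ≤ k * (n * 1) → t ≤ k * Y
    linear k t≤ = ≤-trans t≤ (*-monoʳ-≤ k n≤Y)

  Y≡ : Y ≡ n ^ 2 * (1 ⊔ P)
  Y≡ = lemma n (1 ⊔ P)
    where
    lemma : ∀ n z → n * (n * (z * 1)) ≡ n * (n * 1) * z
    lemma = solve-∀

corollary1 : ∃[ c ] ∃[ k ] c SolvesWithin (λ I → k * (Instance.n I ^ 2 * (1 ⊔ Instance.P I)))
corollary1 = solver , c-total , λ I s input →
  let open Instance I
      open Bounds {n} {P} {Schedules.budget I} (n≥1 (proj₁ nonempty)) (m⊓n≤n Kʳ P)
  in run-weaken (≤-trans solver≤ (≤-reflexive (cong (c-total *_) Y≡))) (Correctness.solver-correct I s input)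
  where
  n≥1 : ∀ {n} → Fin n → 1 ≤ n
  n≥1 {suc n} _ = s≤s z≤n
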